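{- Let $\sigma$ be a primitive substitution of size $M\times M$ over a finite alphabet $A$ having a determining position, such that $X^\sigma$ is aperiodic. Then there exists a constant $K>1$ such that for every $c\in X^\sigma$ and every $n\in\mathbb{N}$, \[ |\mathcal{L}_{n,n}(c)|\ \ge\ K n^2. \]
   Context: Patterns are elements $p\in A^D$ with $D\subseteq\mathbb{Z}^2$; configurations are elements of $A^{\mathbb{Z}^2}$. A pattern $p$ of support $D$ appears in $p'$ if there is $\vec u\in\mathbb{Z}^2$ with $p_{\vec v}=p'_{\vec v-\vec u}$ for all $\vec v\in D$. A configuration $c$ is periodic if $c_{\vec v}=c_{\vec v-\vec u}$ for all $\vec v$, for some $\vec u\ne(0,0)$; a set of configurations is aperiodic if it is nonempty and contains no periodic configuration. A substitution of size $M\times N$ is a map $\sigma:A\to A^{\{0,\dots,M-1\}\times\{0,\dots,N-1\}}$, extended to patterns by $\sigma(p)_{(Mx+i,Ny+j)}=\sigma(p_{(x,y)})_{(i,j)}$ for $(x,y)$ in the support of $p$, $0\le i<M$, $0\le j<N$; $\sigma^k$ is the $k$-fold iterate. $\sigma$ is primitive if there is $k$ such that every letter $a$ appears in $\sigma^k(b)$ for every $b\in A$. $X^\sigma$ is the set of configurations $c$ such that every finite pattern appearing in $c$ appears in $\sigma^k(a)$ for some $a\in A$, $k\in\mathbb{N}$. $\sigma$ has a determining position $(i,j)$ if $\sigma(a)_{(i,j)}=\sigma(b)_{(i,j)}$ implies $a=b$ for all $a,b\in A$. $\mathcal{L}_{n,n}(c)$ is the set of patterns of support $\{0,\dots,n-1\}^2$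 appearing in $c$. -}

module Defs where

open import Data.Nat as ℕ using (ℕ; zero; suc; _<_; _^_; NonZero)
open import Data.Nat.DivMod using (_/_; _%_; m%n<n)
open import Data.Fin using (Fin; toℕ; fromℕ<)
open import Data.Integer as ℤ using (ℤ; +_)
open import Data.Product using (Σ; ∃; ∃-syntax; _×_; _,_)
open import Data.List using (List; length)
open import Data.List.Membership.Propositional using (_∈_)
open import Data.List.Relation.Unary.All using (All)
open import Data.List.Relation.Unary.AllPairs using (AllPairs)
open import Relation.Binary.PropositionalEquality using (_≡_; _≢_)
open import Relation.Nullary using (¬_)

Pos : Set
Pos = ℤ × ℤ

_-ᵥ_ : Pos → Pos → Pos
(a , b) -ᵥ (c , d) = (a ℤ.- c , b ℤ.- d)

Config : ℕ → Set
Config k = Pos → Fin k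

-- A finite pattern: a finite support D ⊆ ℤ² (given as a list) together with
-- its values (values outside D are irrelevant).
record Pattern (k : ℕ) : Set where
  constructor pat
  field
    support : List Pos
    value   : Pos → Fin k
open Pattern public

AppearsInConfig : ∀ {k} → Pattern k → Config k → Set
AppearsInConfig p c =
  ∃[ u ] (∀ {v} → v ∈ support p → value p v ≡ c (v -ᵥ u))

Substitution : ℕ → ℕ → Set
Substitution k M = Fin k → Fin M → Fin M → Fin k

-- σ^n(a), as a function on ℕ², meaningful on {0,…,M^n-1}².
-- σ^0(a) is the letter a at (0,0); σ^(n+1)(a) = σ(σ^n(a)), i.e.
-- σ^(n+1)(a)_(Mx+i , My+j) = σ(σ^n(a)_(x,y))_(i,j).
iter : ∀ {k M} .{{_ : NonZero M}} → Substitution k M → ℕ → Fin k → ℕ → ℕ → Fin k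
iter σ zero    a x y = a
iter {M = M} σ (suc n) a x y =
  σ (iter σ n a (x / M) (y / M)) (fromℕ< (m%n<n x M)) (fromℕ< (m%n<n y M))

AppearsInIter : ∀ {k M} .{{_ : NonZero M}} → Substitution k M →
                Pattern k → ℕ → Fin k → Set
AppearsInIter {M = M} σ p n a =
  ∃[ u ] (∀ {v} → v ∈ support p →
    ∃[ x ] ∃[ y ] (v -ᵥ u ≡ (+ x , + y) × x < M ^ n × y < M ^ n ×
                   value p v ≡ iter σ n a x y))

LetterIn : ∀ {k M} .{{_ : NonZero M}} → Substitution k M → Fin k → ℕ → Fin k → Set
LetterIn {M = M} σ b n a =
  ∃[ x ] ∃[ y ] (x < M ^ n × y < M ^ n × iter σ n a x y ≡ b)

Primitive : ∀ {k M} .{{_ : NonZero M}} → Substitution k M → Set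
Primitive {k} σ = ∃[ n ] (∀ (a b : Fin k) → LetterIn σ a n b)

HasDeterminingPosition : ∀ {k M} → Substitution k M → Set
HasDeterminingPosition {k} {M} σ =
  ∃[ i ] ∃[ j ] (∀ (a b : Fin k) → σ a i j ≡ σ b i j → a ≡ b)

InX : ∀ {k M} .{{_ : NonZero M}} → Substitution k M → Config k → Set
InX {k} σ c = ∀ (p : Pattern k) → AppearsInConfig p c →
  ∃[ a ] ∃[ n ] AppearsInIter σ p n a

Periodic : ∀ {k} → Config k → Set
Periodic c = ∃[ u ] (u ≢ (+ 0 , + 0) × (∀ v → c v ≡ c (v -ᵥ u)))

Aperiodic : ∀ {k M} .{{_ : NonZero M}} → Substitution k M → Set
Aperiodic σ = (∃[ c ] InX σ c) × (∀ c → InX σ c → ¬ Periodic c)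

Square : ℕ → ℕ → Set
Square k n = Fin n → Fin n → Fin k

SquareAppears : ∀ {k n} → Square k n → Config k → Set
SquareAppears {n = n} q c =
  ∃[ u ] (∀ (i j : Fin n) → q i j ≡ c ((+ toℕ i , + toℕ j) -ᵥ u))

DistinctSquares : ∀ {k n} → Square k n → Square k n → Set
DistinctSquares {n = n} p q = ¬ (∀ (i j : Fin n) → p i j ≡ q i j)

LangAtLeast : ∀ {k} → Config k → ℕ → ℕ → Set
LangAtLeast {k} c n m =
  ∃[ L ] (AllPairs DistinctSquares L × All (λ q → SquareAppears q c) L ×
          m ℕ.≤ length {A = Square k n} L)

{-# OPTIONS --safe #-}
-- Let c₀ be a configuration of X^σ. It is uniformly recurrent, because every finite pattern sits in a
-- σ^n-image of one of finitely many 2 × 2 seeds, and it is not periodic.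
--
-- Step 1 (rectangles; the theorem of Kari and Moutot on uniformly recurrent configurations): every
-- a × b rectangle has more than a b patterns. Otherwise some non-trivial integer combination of the
-- letters in a window of that shape is constant. Hence, if a horizontal strip one row thinner than
-- the window has a long horizontal period, the rows next to it satisfy a linear recurrence and inherit
-- the period, and c₀ would be periodic. On the other hand, cut the window by rows down to a minimal one
-- E with at most |E| patterns; if the strip below a line does not determine the line, then the windows
-- along that strip take few values, and the strip is periodic by Morse–Hedlund. So the line is determined
-- from one side. It is then determined from the other side too: two positions agreeing on that other side
-- differ by a horizontally periodic pattern, each class of positions modulo such differences is finite,
-- and by recurrence its size cannot change from one row to the next. By unimodular changes of
-- coordinates this holds for all small directions. Now take two positions with the same large pattern
-- around them, and the point z of disagreement closest to the origin: near z the disc of agreement looks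
-- like a half-plane, so the letter at z is determined, a contradiction.
--
-- Step 2 (recognizability): the residue modulo M of a block of σ(c₀) can be read off a large enough
-- window. If σ(x) and σ(y) agree up to a shift r, a determining position turns x into a letterwise image
-- of a translate of y, and y into one of x; this gives a period of x unless the two translations cancel,
-- and in that case the determining position can be moved by r modulo M, which cannot go on forever.
--
-- Step 3: a large m × m′ window of σ(c₀) determines its residue class and the rectangle of letters of c₀
-- above its determining positions, and the areas of these rectangles over all residue classes add up to
-- m m′. So a lower bound K a b for the a × b rectangles with a, b below the threshold N₀ propagates to all
-- sizes, and K = 1 + 1/N₀² works there by Step 1.
module Submission where

open import Defs
open import Data.Nat as ℕ using (ℕ; zero; suc; _+_; _*_; _∸_; _^_; _!; _<_; _≤_; z≤n; s≤s; NonZero; _<?_; _≤?_)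
open import Data.Nat.Properties as ℕₚ using (≤-refl; ≤-trans; ≤-reflexive; ≤-<-trans; m≤m+n; m≤n+m; n≤1+n; +-mono-≤; +-monoˡ-≤; +-monoʳ-≤; *-mono-≤; *-monoˡ-≤; *-monoʳ-≤; ≮⇒≥; ≰⇒>; <⇒≤; <⇒≱; <-irrefl; m≤n⇒m≤1+n; m≤n⇒m<n∨m≡n; +-comm; +-assoc; +-suc; +-identityʳ; *-comm; *-assoc; m+[n∸m]≡n; m∸n+n≡m; _!≢0)
open import Data.Integer as ℤ using (ℤ; +_; -[1+_]; ∣_∣; 0ℤ; 1ℤ) renaming (_+_ to _+ᶻ_; _*_ to _*ᶻ_; -_ to -ᶻ_; _-_ to _-ᶻ_; _≤_ to _≤ᶻ_; _<_ to _<ᶻ_)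
import Data.Integer.Properties as ℤₚ
open import Data.Integer.Tactic.RingSolver using (solve-∀)
open import Data.Fin as Fin using (Fin; toℕ; fromℕ<; funToFin; finToFun)
import Data.Fin.Properties as Finₚ
open import Data.Product using (∃-syntax; _×_; _,_; proj₁; proj₂; map₂)
open import Data.Sum using (_⊎_; inj₁; inj₂; [_,_]′)
open import Data.Empty using (⊥; ⊥-elim)
open import Data.Vec as Vec using (Vec; []; _∷_)
open import Data.Nat.Divisibility using (n∣m*n; _∣_; divides; ∣-trans; m∣m*n; m≤n⇒m!∣n!)
open import Data.Integer.DivMod using (_/ℕ_; _%ℕ_; a≡a%ℕn+[a/ℕn]*n; n%ℕd<d)
open import Data.Nat.GCD using (gcd; gcd[m,n]∣m; gcd[m,n]∣n; gcd-GCD; gcd[m,n]≢0; module Bézout)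
import Data.Nat.Tactic.RingSolver as ℕ-Solver
open import Data.Nat.DivMod using (_/_; _%_; m%n<n; m≡m%n+[m/n]*n; [m+kn]%n≡m%n; m<n⇒m%n≡m; m<n⇒m/n≡0; m*n/n≡m; m<n*o⇒m/o<n; +-distrib-/-∣ʳ; m%n%n≡m%n; /-monoˡ-≤; m/n<m; m≥n⇒m/n>0; m/n*n≤m)
open import Data.Unit using (⊤; tt)
open import Data.List using (allFin; List; []; _∷_; _++_; length; map; filter; applyUpTo; cartesianProduct)
open import Data.List.Properties using (length-++; length-map; length-applyUpTo; filter-++; filter-none; filter-all; length-filter; length-tabulate)
open import Data.List.Membership.Propositional using (_∈_; find; lose)
import Data.List.Membership.DecPropositional as DecMembership
open import Data.List.Membership.Propositional.Properties using (∈-map⁺; ∈-map⁻; ∈-filter⁺; ∈-filter⁻; ∈-++⁺ˡ; ∈-++⁺ʳ; ∈-++⁻; ∈-applyUpTo⁺; ∈-applyUpTo⁻; ∈-cartesianProduct⁺; ∈-cartesianProduct⁻; ∈-allFin)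
open import Data.List.Relation.Unary.Any as Any using (Any; here; there)
open import Data.List.Relation.Unary.All as All using (All; []; _∷_)
open import Data.List.Relation.Unary.AllPairs as AllPairs using (AllPairs; []; _∷_)
import Data.List.Relation.Unary.All.Properties as Allₚ
import Data.List.Relation.Unary.AllPairs.Properties as APₚ
open import Relation.Binary.PropositionalEquality using (_≡_; _≢_; refl; sym; trans; cong; cong₂; subst; subst₂)
open import Relation.Nullary using (¬_; Dec; yes; no; contradiction)
open import Relation.Nullary.Decidable using (map′; _×-dec_; ¬?; decidable-stable)
open import Relation.Binary.Definitions as Tri using (Tri)
open import Data.List.Relation.Unary.Unique.Propositional using (Unique)
import Data.List.Relation.Unary.Unique.Propositional.Properties as Uniqueₚ
open import Function using (_∘_; id; case_of_)

-- This shapes Step 1: its results are handed to continuations into the empty type, and maximality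
-- or minimality arguments become descents on a natural number. The double negation that remains is
-- removed in `over!`, because primitivity makes the recurrence radius explicit, so that the
-- patterns of a given shape can be listed from a finite box. Determinism has to hold from both
-- sides of a line because the disc of agreement fills the half-plane on the side of `z` that
-- contains the origin, and nothing controls which side this is. The constant exceeds 1 by
-- integrality: more than `a b` patterns means at least `a b + 1`, a relative gain of at least
-- `1 / N₀²` as long as both sides are at most `N₀`. Step 1 alone would let this gain fade as the
-- sizes grow. Desubstitution preserves it, since the areas over all residue classes add up exactly
-- and recognizability keeps these classes from sharing patterns.

-- Excluded middle is available in every refutation.
em : {P : Set} → (Dec P → ⊥) → ⊥
em f = f (no λ p → f (yes p))

-- Translations of the plane lattice and sup-norm balls

infixl 6 _⊕_
_⊕_ : Pos → Pos → Pos
(a , b) ⊕ (c , d) = a +ᶻ c , b +ᶻ d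

⊖_ : Pos → Pos
⊖ (a , b) = -ᶻ a , -ᶻ b

pos-≡ : ∀ {a b c d : ℤ} → a ≡ c → b ≡ d → (a , b) ≡ (c , d)
pos-≡ = cong₂ _,_

⊕-assoc : ∀ u v w → u ⊕ v ⊕ w ≡ u ⊕ (v ⊕ w)
⊕-assoc (a , b) (c , d) (e , f) = pos-≡ (ℤₚ.+-assoc a c e) (ℤₚ.+-assoc b d f)

⊕-comm : ∀ u v → u ⊕ v ≡ v ⊕ u
⊕-comm (a , b) (c , d) = pos-≡ (ℤₚ.+-comm a c) (ℤₚ.+-comm b d)

⊕-swap : ∀ u v w → u ⊕ v ⊕ w ≡ u ⊕ w ⊕ v
⊕-swap u v w = trans (⊕-assoc u v w) (trans (cong (u ⊕_) (⊕-comm v w)) (sym (⊕-assoc u w v)))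

𝟎 : Pos
𝟎 = 0ℤ , 0ℤ

⊕-identityʳ : ∀ u → u ⊕ 𝟎 ≡ u
⊕-identityʳ (a , b) = pos-≡ (ℤₚ.+-identityʳ a) (ℤₚ.+-identityʳ b)

⊕-inverseʳ : ∀ u → u ⊕ (⊖ u) ≡ 𝟎
⊕-inverseʳ (a , b) = pos-≡ (ℤₚ.+-inverseʳ a) (ℤₚ.+-inverseʳ b)

⊕-cancel : ∀ u v → u ⊕ v ⊕ (⊖ v) ≡ u
⊕-cancel u v = trans (⊕-assoc u v (⊖ v)) (trans (cong (u ⊕_) (⊕-inverseʳ v)) (⊕-identityʳ u))

⊖-cancel : ∀ u v → u ⊕ (⊖ v) ⊕ v ≡ u
⊖-cancel u v = trans (⊕-swap u (⊖ v) v) (⊕-cancel u v)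

_≟ᵖ_ : (u v : Pos) → Dec (u ≡ v)
(a , b) ≟ᵖ (c , d) with a ℤ.≟ c | b ℤ.≟ d
... | yes refl | yes refl = yes refl
... | no a≢c   | _        = no λ { refl → a≢c refl }
... | _        | no b≢d   = no λ { refl → b≢d refl }

Near : ℕ → Pos → Set
Near n (x , y) = ∣ x ∣ ≤ n × ∣ y ∣ ≤ n

abs-+ : ∀ {m n} i j → ∣ i ∣ ≤ m → ∣ j ∣ ≤ n → ∣ i +ᶻ j ∣ ≤ m + n
abs-+ i j p q = ≤-trans (ℤₚ.∣i+j∣≤∣i∣+∣j∣ i j) (+-mono-≤ p q)

abs-neg : ∀ {m} i → ∣ i ∣ ≤ m → ∣ -ᶻ i ∣ ≤ m
abs-neg i p = ≤-trans (≤-reflexive (ℤₚ.∣-i∣≡∣i∣ i)) p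

near-⊕ : ∀ {m n} p q → Near m p → Near n q → Near (m + n) (p ⊕ q)
near-⊕ (a , b) (c , d) (a≤ , b≤) (c≤ , d≤) = abs-+ a c a≤ c≤ , abs-+ b d b≤ d≤

near-⊖ : ∀ {n} p → Near n p → Near n (⊖ p)
near-⊖ (a , b) (a≤ , b≤) = abs-neg a a≤ , abs-neg b b≤

near-mono : ∀ {m n p} → m ≤ n → Near m p → Near n p
near-mono m≤n (x≤ , y≤) = ≤-trans x≤ m≤n , ≤-trans y≤ m≤n

-- Counting classes of an equivalence relation

record IsEq {U : Set} (_≈_ : U → U → Set) : Set where
  field
    ≈-refl  : ∀ {a} → a ≈ a
    ≈-sym   : ∀ {a b} → a ≈ b → b ≈ a
    ≈-trans : ∀ {a b c} → a ≈ b → b ≈ c → a ≈ c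
    _≈?_    : ∀ a b → Dec (a ≈ b)

module _ {U : Set} {_≈_ : U → U → Set} (E : IsEq _≈_) where
  open IsEq E

  -- Pairwise inequivalent elements meet a given class at most once, so clearing that class costs at
  -- most one element.
  removeClass : ∀ a us → AllPairs (λ u v → ¬ u ≈ v) us →
    ∃[ us′ ] (AllPairs (λ u v → ¬ u ≈ v) us′ × All (λ u → ¬ a ≈ u) us′ ×
              All (_∈ us) us′ × length us ≤ suc (length us′))
  removeClass a [] [] = [] , [] , [] , [] , z≤n
  removeClass a (u ∷ us) (u≉ ∷ ap) with a ≈? u
  ... | yes a≈u = us , ap , All.map (λ u≉v a≈v → u≉v (≈-trans (≈-sym a≈u) a≈v)) u≉ , All.tabulate there , ≤-refl
  ... | no a≉u with removeClass a us ap
  ...   | us′ , ap′ , a≉ , sub , len =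
    u ∷ us′ , All.map (λ v∈ → All.lookup u≉ v∈) sub ∷ ap′ , a≉u ∷ a≉ , here refl ∷ All.map there sub , s≤s len

  covered-by-few : ∀ rs us → All (λ u → Any (_≈ u) rs) us → length rs < length us →
    ¬ AllPairs (λ u v → ¬ u ≈ v) us
  covered-by-few [] (u ∷ us) (() ∷ _) _ _
  covered-by-few (r ∷ rs) us cov lt ap with removeClass r us ap
  ... | us′ , ap′ , r≉ , sub , len = covered-by-few rs us′
          (All.zipWith (λ { (r≉u , here r≈u) → contradiction r≈u r≉u ; (_ , there c) → c })
            (r≉ , All.map (All.lookup cov) sub))
          (ℕ.s≤s⁻¹ (≤-trans lt len)) ap′

module _ {U : Set} {_≈₀_ _≈₁_ : U → U → Set} (E₀ : IsEq _≈₀_) (sub : ∀ {a b} → a ≈₁ b → a ≈₀ b) where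
  open IsEq E₀

  Split : U × U → Set
  Split (a , a′) = a ≈₀ a′ × ¬ a ≈₁ a′

  -- A class of the coarse relation hit by a split pair is replaced by the two halves of the pair.
  refine : ∀ (P : U → Set) us as → AllPairs (λ u v → ¬ u ≈₀ v) us → All P us →
    All Split as → All (λ q → P (proj₁ q) × P (proj₂ q)) as →
    AllPairs (λ p q → ¬ proj₁ p ≈₀ proj₁ q) as →
    ∃[ vs ] (AllPairs (λ u v → ¬ u ≈₁ v) vs × All P vs ×
             All (λ v → Any (v ≈₀_) us ⊎ Any (λ q → v ≈₀ proj₁ q) as) vs ×
             length us + length as ≤ length vs)
  refine P us [] ap Pus _ _ _ =
    us , AllPairs.map (λ n e → n (sub e)) ap , Pus ,
    All.tabulate (λ v∈ → inj₁ (lose v∈ ≈-refl)) , ≤-reflexive (+-identityʳ _)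
  refine P us ((a , a′) ∷ as) ap Pus ((a≈a′ , a≉a′) ∷ sp) ((Pa , Pa′) ∷ Pas) (a≉ ∷ aps)
    with removeClass E₀ a us ap
  ... | us′ , ap′ , a≉us , us′⊆ , len with refine P us′ as ap′ (All.map (All.lookup Pus) us′⊆) sp Pas aps
  ...   | vs , apv , Pvs , orig , lenv =
    a ∷ a′ ∷ vs ,
    (a≉a′ ∷ All.map (λ n e → n (sub e)) far) ∷ All.map (λ n e → n (≈-trans a≈a′ (sub e))) far ∷ apv ,
    Pa ∷ Pa′ ∷ Pvs ,
    inj₂ (here ≈-refl) ∷ inj₂ (here (≈-sym a≈a′)) ∷ All.map lift orig ,
    ≤-trans (≤-reflexive (+-suc (length us) (length as))) (s≤s (≤-trans (+-monoˡ-≤ (length as) len) (s≤s lenv)))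
    where
    far : All (λ v → ¬ a ≈₀ v) vs
    far = All.map (λ { (inj₁ c) a≈v → case find c of λ { (w , w∈ , v≈w) → All.lookup a≉us w∈ (≈-trans a≈v v≈w) }
                     ; (inj₂ c) a≈v → case find c of λ { (w , w∈ , v≈w) → All.lookup a≉ w∈ (≈-trans a≈v v≈w) } }) orig
    lift : ∀ {v} → Any (v ≈₀_) us′ ⊎ Any (λ q → v ≈₀ proj₁ q) as → Any (v ≈₀_) us ⊎ Any (λ q → v ≈₀ proj₁ q) ((a , a′) ∷ as)
    lift (inj₁ c) with find c
    ... | w , w∈ , e = inj₁ (lose (All.lookup us′⊆ w∈) e)
    lift (inj₂ c) = inj₂ (there c)

-- Pattern classes of a configuration


module Lang {k : ℕ} (c : Config k) where

  record Agree (S : List Pos) (u v : Pos) : Set where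
    constructor agree
    field at : ∀ {p} → p ∈ S → c (u ⊕ p) ≡ c (v ⊕ p)
  open Agree public

  Agree-isEq : ∀ S → IsEq (Agree S)
  Agree-isEq S = record
    { ≈-refl = agree λ _ → refl
    ; ≈-sym = λ a → agree (λ p∈ → sym (at a p∈))
    ; ≈-trans = λ a b → agree (λ p∈ → trans (at a p∈) (at b p∈))
    ; _≈?_ = λ u v → map′ (λ a → agree (All.lookup a)) (λ a → All.tabulate (at a))
                       (All.all? (λ p → c (u ⊕ p) Finₚ.≟ c (v ⊕ p)) S) }

  agree-⊆ : ∀ {S S′ u v} → (∀ {p} → p ∈ S → p ∈ S′) → Agree S′ u v → Agree S u v
  agree-⊆ S⊆S′ ag = agree (λ p∈ → at ag (S⊆S′ p∈))

  -- Patterns of shape `S` are represented by positions at which they are read, so counting them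
  -- means counting classes of `Agree S`. The negation is the low-complexity hypothesis that Step 1
  -- refutes. The comparison is strict, and the empty shape with its single pattern satisfies it.
  Over : List Pos → Set
  Over S = ∃[ us ] (AllPairs (λ u v → ¬ Agree S u v) us × length S < length us)

  over-[] : Over []
  over-[] = 𝟎 ∷ [] , [] ∷ [] , s≤s z≤n

  over-subst : ∀ {S S′} → (∀ {p} → p ∈ S → p ∈ S′) → length S′ ≤ length S → Over S → Over S′
  over-subst S⊆ len (us , ap , lt) =
    us , AllPairs.map (λ n ag → n (agree-⊆ S⊆ ag)) ap , ≤-<-trans len lt

-- Growing a window cell by cell

length-filter-⊎ : {A : Set} {P Q R : A → Set} (P? : ∀ a → Dec (P a)) (Q? : ∀ a → Dec (Q a)) (R? : ∀ a → Dec (R a)) →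
  (∀ {a} → R a → P a ⊎ Q a) → (∀ {a} → P a → R a) → (∀ {a} → Q a → R a) → (∀ {a} → P a → Q a → ⊥) →
  ∀ as → length (filter R? as) ≡ length (filter P? as) + length (filter Q? as)
length-filter-⊎ P? Q? R? split P⇒R Q⇒R excl [] = refl
length-filter-⊎ P? Q? R? split P⇒R Q⇒R excl (a ∷ as)
  with length-filter-⊎ P? Q? R? split P⇒R Q⇒R excl as | R? a | P? a | Q? a
... | ih | yes r | yes p | yes q = ⊥-elim (excl p q)
... | ih | yes r | yes p | no ¬q = cong suc ih
... | ih | yes r | no ¬p | yes q = trans (cong suc ih) (sym (+-suc _ _))
... | ih | yes r | no ¬p | no ¬q = ⊥-elim ([ ¬p , ¬q ]′ (split r))
... | ih | no ¬r | yes p | _     = ⊥-elim (¬r (P⇒R p))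
... | ih | no ¬r | no ¬p | yes q = ⊥-elim (¬r (Q⇒R q))
... | ih | no ¬r | no ¬p | no ¬q = ih

length-filter-≤1 : {A : Set} {P : A → Set} (P? : ∀ a → Dec (P a)) (as : List A) → Unique as →
  (∀ {a b} → a ∈ as → b ∈ as → P a → P b → a ≡ b) → length (filter P? as) ≤ 1
length-filter-≤1 P? [] _ inj = z≤n
length-filter-≤1 {P = P} P? (a ∷ as) (a≢ ∷ u) inj with P? a
... | no _ = length-filter-≤1 P? as u (λ p q → inj (there p) (there q))
... | yes Pa = s≤s (none as a≢ (λ b∈ Pb → inj (here refl) (there b∈) Pa Pb))
  where
  none : ∀ bs → All (a ≢_) bs → (∀ {b} → b ∈ bs → P b → a ≡ b) → length (filter P? bs) ≤ 0
  none [] _ _ = z≤n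
  none (b ∷ bs) (a≢b ∷ a≢bs) eq with P? b
  ... | yes Pb = ⊥-elim (a≢b (eq (here refl) Pb))
  ... | no _ = none bs a≢bs (eq ∘ there)

-- Cells of key 0 form a base in no particular order; from key 1 on, cells are added one at a time.
-- This serves twice: for the cells of a top row taken from left to right, and for the cells of a
-- rectangle ordered by an inner product.
module Threshold {k : ℕ} (c : Config k) (key : Pos → ℕ) (E : List Pos) where
  open Lang c

  below : ℕ → List Pos
  below t = filter (λ p → key p <? t) E

  below⇒∈ : ∀ {t p} → p ∈ below t → p ∈ E × key p < t
  below⇒∈ {t} = ∈-filter⁻ (λ p → key p <? t) {xs = E}

  ∈⇒below : ∀ {t p} → p ∈ E → key p < t → p ∈ below t
  ∈⇒below {t} = ∈-filter⁺ (λ p → key p <? t)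

  length-below-suc : ∀ t → length (below (suc t)) ≡ length (below t) + length (filter (λ p → key p ℕ.≟ t) E)
  length-below-suc t = length-filter-⊎ (λ p → key p <? t) (λ p → key p ℕ.≟ t) (λ p → key p <? suc t)
    (λ lt → m≤n⇒m<n∨m≡n (ℕ.s≤s⁻¹ lt)) (m≤n⇒m≤1+n) (λ { refl → ≤-refl }) (λ lt → λ { refl → <-irrefl refl lt }) E

  -- The first threshold at which the complexity stops exceeding the size: there the new cell
  -- is determined by the cells below it.
  threshold : Unique E → (∀ {p q} → p ∈ E → q ∈ E → 1 ≤ key p → key p ≡ key q → p ≡ q) →
    ∀ N → Over (below 1) → ¬ Over (below (1 + N)) →
    (∀ t p₀ → p₀ ∈ E → key p₀ ≡ t → 1 ≤ t → ¬ Over (below (suc t)) →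
       (∀ u v → Agree (below t) u v → c (u ⊕ p₀) ≡ c (v ⊕ p₀)) → ⊥) → ⊥
  threshold uniq inj zero ov nov _ = nov ov
  threshold uniq inj (suc N) ov nov goal = em λ
    { (no nov′) → threshold uniq inj N ov nov′ goal
    ; (yes ov′) → found ov′ }
    where
    t : ℕ
    t = suc N
    new : List Pos
    new = filter (λ p → key p ℕ.≟ t) E
    new≤1 : length new ≤ 1
    new≤1 = length-filter-≤1 (λ p → key p ℕ.≟ t) E uniq
      (λ p∈ q∈ kp kq → inj p∈ q∈ (subst (1 ≤_) (sym kp) (s≤s z≤n)) (trans kp (sym kq)))
    sub : ∀ {u v} → Agree (below (suc t)) u v → Agree (below t) u v
    sub = agree-⊆ (λ p∈ → let a , b = below⇒∈ p∈ in ∈⇒below a (m≤n⇒m≤1+n b))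
    found : Over (below t) → ⊥
    found ov′@(us , ap , lt) with new in eqn
    ... | [] = nov (over-subst (λ p∈ → let a , b = below⇒∈ p∈ in ∈⇒below a (m≤n⇒m≤1+n b))
                 (≤-reflexive (trans (length-below-suc t) (trans (cong (λ l → length (below t) + length l) eqn) (+-identityʳ _)))) ov′)
    ... | p₀ ∷ _ = goal t p₀ (proj₁ p₀∈) (proj₂ p₀∈) (s≤s z≤n) nov determined
      where
      p₀∈ : p₀ ∈ E × key p₀ ≡ t
      p₀∈ = ∈-filter⁻ (λ p → key p ℕ.≟ t) {xs = E} (subst (p₀ ∈_) (sym eqn) (here refl))
      len : length (below (suc t)) ≤ suc (length (below t))
      len = ≤-trans (≤-reflexive (length-below-suc t)) (≤-trans (+-monoʳ-≤ (length (below t)) new≤1) (≤-reflexive (+-comm _ 1)))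
      determined : ∀ u v → Agree (below t) u v → c (u ⊕ p₀) ≡ c (v ⊕ p₀)
      determined u v ag with c (u ⊕ p₀) Finₚ.≟ c (v ⊕ p₀)
      ... | yes e = e
      -- A disagreement would split a class in two and yield more than `length (below t) + 1`
      -- patterns, against `nov`.
      ... | no ne with refine (Agree-isEq (below t)) sub (λ _ → ⊤) us ((u , v) ∷ []) ap (All.universal (λ _ → tt) us)
                       ((ag , λ ag′ → ne (at ag′ (∈⇒below (proj₁ p₀∈) (≤-reflexive (cong suc (proj₂ p₀∈)))))) ∷ [])
                       ((tt , tt) ∷ []) ([] ∷ [])
      ...   | vs , apv , _ , _ , lenv = ⊥-elim (nov (vs , apv , ≤-trans (s≤s len) (≤-trans (s≤s lt) (≤-trans (≤-reflexive (+-comm 1 (length us))) lenv))))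

-- An integer linear relation between the letters of a window

dot : ∀ {n} → Vec ℤ n → Vec ℤ n → ℤ
dot []       []       = 0ℤ
dot (a ∷ as) (b ∷ bs) = a *ᶻ b +ᶻ dot as bs

dot-0 : ∀ {n} (as : Vec ℤ n) → dot as (Vec.replicate n 0ℤ) ≡ 0ℤ
dot-0 [] = refl
dot-0 (a ∷ as) = cong₂ _+ᶻ_ (ℤₚ.*-zeroʳ a) (dot-0 as)

eliminate : ∀ {n} (α β : ℤ) → Vec ℤ n → Vec ℤ n → Vec ℤ n
eliminate α β r r₀ = Vec.zipWith (λ x y → α *ᶻ x -ᶻ β *ᶻ y) r r₀

-- With the pivot row `α ∷ r₀`, the vector `- dot r₀ x ∷ α x` is back-substitution cleared of
-- denominators: it solves the pivot row, and on another row `β ∷ r` it takes the value of the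
-- eliminated row at `x`.
dot-eliminate : ∀ {n} α β (r r₀ x : Vec ℤ n) →
  β *ᶻ (-ᶻ dot r₀ x) +ᶻ dot r (Vec.map (α *ᶻ_) x) ≡ dot (eliminate α β r r₀) x
dot-eliminate α β [] [] [] = lem β
  where
  lem : ∀ β → β *ᶻ (-ᶻ 0ℤ) +ᶻ 0ℤ ≡ 0ℤ
  lem = solve-∀
dot-eliminate α β (a ∷ r) (a₀ ∷ r₀) (x ∷ xs) =
  trans (lem α β a a₀ x (dot r₀ xs) (dot r (Vec.map (α *ᶻ_) xs)))
        (cong ((α *ᶻ a -ᶻ β *ᶻ a₀) *ᶻ x +ᶻ_) (dot-eliminate α β r r₀ xs))
  where
  lem : ∀ α β a a₀ x d e → β *ᶻ (-ᶻ (a₀ *ᶻ x +ᶻ d)) +ᶻ (a *ᶻ (α *ᶻ x) +ᶻ e) ≡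
        (α *ᶻ a -ᶻ β *ᶻ a₀) *ᶻ x +ᶻ (β *ᶻ (-ᶻ d) +ᶻ e)
  lem = solve-∀

dot-map : ∀ {n} α (r x : Vec ℤ n) → dot r (Vec.map (α *ᶻ_) x) ≡ α *ᶻ dot r x
dot-map α [] [] = sym (ℤₚ.*-zeroʳ α)
dot-map α (a ∷ r) (x ∷ xs) = trans (cong (a *ᶻ (α *ᶻ x) +ᶻ_) (dot-map α r xs)) (lem α a x (dot r xs))
  where
  lem : ∀ α a x d → a *ᶻ (α *ᶻ x) +ᶻ α *ᶻ d ≡ α *ᶻ (a *ᶻ x +ᶻ d)
  lem = solve-∀

NonZeroVec : ∀ {n} → Vec ℤ n → Set
NonZeroVec []       = ⊥
NonZeroVec (x ∷ xs) = x ≢ 0ℤ ⊎ NonZeroVec xs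

scale-nonZero : ∀ {n} {α} (x : Vec ℤ n) → α ≢ 0ℤ → NonZeroVec x → NonZeroVec (Vec.map (α *ᶻ_) x)
scale-nonZero {α = α} (x ∷ xs) α≢0 (inj₁ x≢0) = inj₁ (λ e → [ α≢0 , x≢0 ]′ (ℤₚ.i*j≡0⇒i≡0∨j≡0 α e))
scale-nonZero (x ∷ xs) α≢0 (inj₂ nz) = inj₂ (scale-nonZero xs α≢0 nz)

pivot : ∀ {n} (eqs : List (Vec ℤ (suc n))) → All (λ e → Vec.head e ≡ 0ℤ) eqs ⊎
  ∃[ e ] ∃[ eqs′ ] (Vec.head e ≢ 0ℤ × (∀ {q} → q ∈ eqs → q ≡ e ⊎ q ∈ eqs′) × length eqs ≡ suc (length eqs′))
pivot [] = inj₁ []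
pivot (e ∷ eqs) with Vec.head e ℤ.≟ 0ℤ
... | no e≢0 = inj₂ (e , eqs , e≢0 , (λ { (here q≡) → inj₁ q≡ ; (there q∈) → inj₂ q∈ }) , refl)
... | yes e≡0 with pivot eqs
...   | inj₁ all = inj₁ (e≡0 ∷ all)
...   | inj₂ (f , eqs′ , f≢0 , split , len) = inj₂ (f , e ∷ eqs′ , f≢0 ,
          (λ { (here q≡) → inj₂ (here q≡) ; (there q∈) → [ inj₁ , inj₂ ∘ there ]′ (split q∈) }) , cong suc len)

-- Fraction-free Gaussian elimination: each pivot removes one equation and one unknown, so the
-- surplus unknown survives. Without a pivot the first unit vector is a solution.
homogeneous-solution : ∀ n (eqs : List (Vec ℤ (suc n))) → length eqs ≤ n →
  ∃[ x ] (NonZeroVec x × (∀ {e} → e ∈ eqs → dot e x ≡ 0ℤ))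
homogeneous-solution n eqs len with pivot eqs
... | inj₁ all = 1ℤ ∷ Vec.replicate n 0ℤ , inj₁ (λ ()) , λ {e} e∈ → zero-head e (All.lookup all e∈)
  where
  zero-head : ∀ e → Vec.head e ≡ 0ℤ → dot e (1ℤ ∷ Vec.replicate n 0ℤ) ≡ 0ℤ
  zero-head (.0ℤ ∷ r) refl = trans (ℤₚ.+-identityˡ _) (dot-0 r)
homogeneous-solution zero (_ ∷ _) () | inj₂ _
homogeneous-solution (suc n) eqs len | inj₂ ((α ∷ r₀) , eqs′ , α≢0 , split , len≡)
  with homogeneous-solution n (map (λ { (β ∷ r) → eliminate α β r r₀ }) eqs′)
         (≤-trans (≤-reflexive (length-map _ eqs′)) (ℕ.s≤s⁻¹ (subst (_≤ suc n) len≡ len)))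
... | x , nz , sol = -ᶻ dot r₀ x ∷ Vec.map (α *ᶻ_) x , inj₂ (scale-nonZero x α≢0 nz) , λ {e} e∈ → solves e (split e∈)
  where
  lem : ∀ α d → α *ᶻ (-ᶻ d) +ᶻ α *ᶻ d ≡ 0ℤ
  lem = solve-∀
  solves : ∀ e → e ≡ α ∷ r₀ ⊎ e ∈ eqs′ → dot e (-ᶻ dot r₀ x ∷ Vec.map (α *ᶻ_) x) ≡ 0ℤ
  solves _ (inj₁ refl) = trans (cong (α *ᶻ (-ᶻ dot r₀ x) +ᶻ_) (dot-map α r₀ x)) (lem α (dot r₀ x))
  solves (β ∷ r) (inj₂ e∈) = trans (dot-eliminate α β r r₀ x) (sol (∈-map⁺ _ e∈))

Form : Set
Form = List (ℤ × Pos)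

apply : Form → (Pos → ℤ) → Pos → ℤ
apply []            g u = 0ℤ
apply ((a , p) ∷ F) g u = a *ᶻ g (u ⊕ p) +ᶻ apply F g u

Δ[_] : Pos → (Pos → ℤ) → Pos → ℤ
Δ[ t ] g v = g (v ⊕ t) -ᶻ g v

apply-Δ : ∀ F t g u → apply F (Δ[ t ] g) u ≡ apply F g (u ⊕ t) -ᶻ apply F g u
apply-Δ [] t g u = refl
apply-Δ ((a , p) ∷ F) t g u =
  trans (cong₂ (λ x y → a *ᶻ (x -ᶻ g (u ⊕ p)) +ᶻ y) (cong g (⊕-swap u p t)) (apply-Δ F t g u))
        (lem a (g (u ⊕ t ⊕ p)) (g (u ⊕ p)) (apply F g (u ⊕ t)) (apply F g u))
  where
  lem : ∀ a x y z w → a *ᶻ (x -ᶻ y) +ᶻ (z -ᶻ w) ≡ a *ᶻ x +ᶻ z -ᶻ (a *ᶻ y +ᶻ w)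
  lem = solve-∀

Annihilates : Form → (Pos → ℤ) → Set
Annihilates F g = ∀ u → apply F g u ≡ 0ℤ

annihilates-Δ : ∀ F t g → Annihilates F g → Annihilates F (Δ[ t ] g)
annihilates-Δ F t g ann u = trans (apply-Δ F t g u) (cong₂ _-ᶻ_ (ann (u ⊕ t)) (ann u))

apply-cong : ∀ F g {u v} → (∀ {p} → p ∈ map proj₂ F → g (u ⊕ p) ≡ g (v ⊕ p)) → apply F g u ≡ apply F g v
apply-cong [] g _ = refl
apply-cong ((a , p) ∷ F) g h = cong₂ (λ x y → a *ᶻ x +ᶻ y) (h (here refl)) (apply-cong F g (h ∘ there))

NonZeroForm : Form → Set
NonZeroForm F = Any (λ q → proj₁ q ≢ 0ℤ) F

module LinearRelation {k : ℕ} (c : Config k) where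
  open Lang c

  γ : Pos → ℤ
  γ v = + toℕ (c v)

  form : ∀ {n} → Vec ℤ n → Vec Pos n → Form
  form []       []       = []
  form (x ∷ xs) (p ∷ ps) = (x , p) ∷ form xs ps

  apply-form : ∀ {n} (xs : Vec ℤ n) ps g u → apply (form xs ps) g u ≡ dot (Vec.map (λ p → g (u ⊕ p)) ps) xs
  apply-form [] [] g u = refl
  apply-form (x ∷ xs) (p ∷ ps) g u = cong₂ _+ᶻ_ (ℤₚ.*-comm x (g (u ⊕ p))) (apply-form xs ps g u)

  support-form : ∀ {n} (xs : Vec ℤ n) ps → map proj₂ (form xs ps) ≡ Vec.toList ps
  support-form [] [] = refl
  support-form (x ∷ xs) (p ∷ ps) = cong (p ∷_) (support-form xs ps)

  nonZero-form : ∀ {n} (xs : Vec ℤ n) ps → NonZeroVec xs → NonZeroForm (form xs ps)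
  nonZero-form (x ∷ xs) (p ∷ ps) (inj₁ x≢0) = here x≢0
  nonZero-form (x ∷ xs) (p ∷ ps) (inj₂ nz) = there (nonZero-form xs ps nz)

  toList-fromList : (E : List Pos) → Vec.toList (Vec.fromList E) ≡ E
  toList-fromList [] = refl
  toList-fromList (p ∷ E) = cong (p ∷_) (toList-fromList E)

  -- Greedy choice: a position showing a new pattern is added as long as there is one. The fuel `n`
  -- counts the additions left before `Over E` would hold.
  representatives : ∀ E n us → length us + n ≡ suc (length E) → AllPairs (λ u v → ¬ Agree E u v) us → ¬ Over E →
    (∀ rs → length rs ≤ length E → (∀ u → Any (λ r → Agree E r u) rs) → ⊥) → ⊥
  representatives E zero us len ap nov goal = nov (us , ap , ≤-reflexive (trans (sym len) (+-identityʳ _)))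
  representatives E (suc n) us len ap nov goal = em {∃[ u ] ¬ Any (λ r → Agree E r u) us} λ
    { (yes (u , new)) → representatives E n (u ∷ us) (trans (sym (+-suc (length us) n)) len)
        (All.tabulate (λ v∈ ag → new (lose v∈ (IsEq.≈-sym (Agree-isEq E) ag))) ∷ ap) nov goal
    ; (no none) → goal us (ℕ.s≤s⁻¹ (≤-trans (s≤s (m≤m+n (length us) n)) (≤-reflexive (trans (sym (+-suc (length us) n)) len))))
        (λ u → cover none u (Any? u)) }
    where
    Any? : ∀ u → Dec (Any (λ r → Agree E r u) us)
    Any? u = Any.any? (λ r → IsEq._≈?_ (Agree-isEq E) r u) us
    cover : ¬ (∃[ u ] ¬ Any (λ r → Agree E r u) us) → ∀ u → Dec (Any (λ r → Agree E r u) us) → Any (λ r → Agree E r u) us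
    cover none u (yes a) = a
    cover none u (no na) = ⊥-elim (none (u , na))

  -- The coefficients are `length E` unknowns. Asking the combination to take the same value at
  -- every representative as at `r₀` costs at most `length E - 1` homogeneous equations. The
  -- combination is then constant, and passing to the differences `Δ[ t ] γ` turns the constant into
  -- 0.
  relation : ∀ E → ¬ Over E →
    (∀ F → map proj₂ F ≡ E → NonZeroForm F → (∀ t → Annihilates F (Δ[ t ] γ)) → ⊥) → ⊥
  relation [] nov _ = nov over-[]
  relation E@(p₀ ∷ E′) nov goal = representatives E (suc (length E)) [] refl [] nov
    λ { [] _ cov → case cov 𝟎 of λ ()
      ; (r₀ ∷ rs) (s≤s len) cov → solved r₀ rs len cov }
    where
    row : (Pos → ℤ) → Pos → Vec ℤ (length E)
    row g r = Vec.map (λ p → g (r ⊕ p)) (Vec.fromList E)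
    solved : ∀ r₀ rs → length rs ≤ length E′ → (∀ u → Any (λ r → Agree E r u) (r₀ ∷ rs)) → ⊥
    solved r₀ rs len cov with homogeneous-solution (length E′) (map (λ r → row (Δ[ r ⊕ (⊖ r₀) ] γ) r₀) rs)
                                (≤-trans (≤-reflexive (length-map _ rs)) len)
    ... | x , nz , sol = goal F (trans (support-form x (Vec.fromList E)) (toList-fromList E)) (nonZero-form x _ nz)
            (λ t u → trans (apply-Δ F t γ u) (trans (cong₂ _-ᶻ_ (const (u ⊕ t)) (const u)) (ℤₚ.+-inverseʳ (apply F γ r₀))))
      where
      F : Form
      F = form x (Vec.fromList E)
      supp : map proj₂ F ≡ E
      supp = trans (support-form x (Vec.fromList E)) (toList-fromList E)
      r₀-shift : ∀ r → r₀ ⊕ (r ⊕ (⊖ r₀)) ≡ r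
      r₀-shift r = trans (⊕-comm r₀ _) (⊖-cancel r r₀)
      on-rep : ∀ {r} → r ∈ r₀ ∷ rs → apply F γ r ≡ apply F γ r₀
      on-rep (here refl) = refl
      on-rep {r} (there r∈) = ℤₚ.i-j≡0⇒i≡j _ _ (trans (cong (λ v → apply F γ v -ᶻ apply F γ r₀) (sym (r₀-shift r)))
        (trans (sym (apply-Δ F (r ⊕ (⊖ r₀)) γ r₀))
          (trans (apply-form x _ (Δ[ r ⊕ (⊖ r₀) ] γ) r₀) (sol (∈-map⁺ (λ r → row (Δ[ r ⊕ (⊖ r₀) ] γ) r₀) r∈)))))
      const : ∀ u → apply F γ u ≡ apply F γ r₀
      const u with find (cov u)
      ... | r , r∈ , ag = trans (apply-cong F γ (λ p∈ → cong (+_ ∘ toℕ) (sym (at ag (subst (_ ∈_) supp p∈))))) (on-rep r∈)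

-- The leading cell is the rightmost one in the lowest row.
Leads : Pos → Pos → Set
Leads (x , y) (x′ , y′) = y <ᶻ y′ ⊎ (y ≡ y′ × x′ <ᶻ x)

leads-trans : ∀ {p q r} → Leads p q → Leads q r → Leads p r
leads-trans (inj₁ a) (inj₁ b) = inj₁ (ℤₚ.<-trans a b)
leads-trans (inj₁ a) (inj₂ (refl , _)) = inj₁ a
leads-trans (inj₂ (refl , _)) (inj₁ b) = inj₁ b
leads-trans (inj₂ (refl , a)) (inj₂ (refl , b)) = inj₂ (refl , ℤₚ.<-trans b a)

leads-total : ∀ p q → p ≢ q → Leads p q ⊎ Leads q p
leads-total (x , y) (x′ , y′) p≢q with ℤₚ.<-cmp y y′
... | Tri.tri< a _ _ = inj₁ (inj₁ a)
... | Tri.tri> _ _ a = inj₂ (inj₁ a)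
... | Tri.tri≈ _ refl _ with ℤₚ.<-cmp x x′
...   | Tri.tri< a _ _ = inj₂ (inj₂ (refl , a))
...   | Tri.tri> _ _ a = inj₁ (inj₂ (refl , a))
...   | Tri.tri≈ _ refl _ = ⊥-elim (p≢q refl)

-- Terms with coefficient 0 are discarded, since the coefficient of the extreme cell will be
-- cancelled.
record Leading (F : Form) : Set where
  field
    coeff   : ℤ
    cell    : Pos
    rest    : Form
    coeff≢0 : coeff ≢ 0ℤ
    split   : ∀ g u → apply F g u ≡ coeff *ᶻ g (u ⊕ cell) +ᶻ apply rest g u
    cell∈   : cell ∈ map proj₂ F
    rest⊆   : ∀ {p} → p ∈ map proj₂ rest → p ∈ map proj₂ F × Leads cell p

leading : ∀ F → Unique (map proj₂ F) → (∀ g u → apply F g u ≡ 0ℤ) × ¬ NonZeroForm F ⊎ Leading F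
leading [] _ = inj₁ ((λ _ _ → refl) , λ ())
leading ((a , p) ∷ F) (p≢ ∷ uq) with a ℤ.≟ 0ℤ | leading F uq
... | yes refl | inj₁ (z , nz) = inj₁ ((λ g u → trans (ℤₚ.+-identityˡ _) (z g u)) , λ { (here a≢0) → a≢0 refl ; (there n) → nz n })
... | yes refl | inj₂ l = inj₂ record
  { coeff = coeff ; cell = cell ; rest = rest ; coeff≢0 = coeff≢0
  ; split = λ g u → trans (ℤₚ.+-identityˡ _) (split g u)
  ; cell∈ = there cell∈ ; rest⊆ = λ p∈ → let x , y = rest⊆ p∈ in there x , y }
  where open Leading l
... | no a≢0 | inj₁ (z , _) = inj₂ record
  { coeff = a ; cell = p ; rest = [] ; coeff≢0 = a≢0
  ; split = λ g u → cong (a *ᶻ g (u ⊕ p) +ᶻ_) (z g u)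
  ; cell∈ = here refl ; rest⊆ = λ () }
... | no a≢0 | inj₂ l with leads-total p (Leading.cell l) (All.lookup p≢ (Leading.cell∈ l))
...   | inj₁ p<c = inj₂ record
  { coeff = a ; cell = p ; rest = (coeff , cell) ∷ rest ; coeff≢0 = a≢0
  ; split = λ g u → cong (a *ᶻ g (u ⊕ p) +ᶻ_) (split g u)
  ; cell∈ = here refl
  ; rest⊆ = λ { (here refl) → there cell∈ , p<c
              ; (there p∈) → let x , y = rest⊆ p∈ in there x , leads-trans {p} {cell} p<c y } }
  where open Leading l
...   | inj₂ c<p = inj₂ record
  { coeff = coeff ; cell = cell ; rest = (a , p) ∷ rest ; coeff≢0 = coeff≢0
  ; split = λ g u → trans (cong (a *ᶻ g (u ⊕ p) +ᶻ_) (split g u))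
                          (lem (a *ᶻ g (u ⊕ p)) (coeff *ᶻ g (u ⊕ cell)) (apply rest g u))
  ; cell∈ = there cell∈
  ; rest⊆ = λ { (here refl) → here refl , c<p
              ; (there p∈) → let x , y = rest⊆ p∈ in there x , y } }
  where
  open Leading l
  lem : ∀ x y z → x +ᶻ (y +ᶻ z) ≡ y +ᶻ (x +ᶻ z)
  lem = solve-∀

-- Eventual periodicity of deterministic sequences

1≤m≤n⇒m∣n! : ∀ {m n} → 1 ≤ m → m ≤ n → m ∣ n !
1≤m≤n⇒m∣n! {suc m} _ m≤n = ∣-trans (m∣m*n (m !)) (m≤n⇒m!∣n! m≤n)

module _ (R : ℕ → ℕ → Set) (R-refl : ∀ {i} → R i i) (R-trans : ∀ {i j l} → R i j → R j l → R i l)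
         (len Q : ℕ) (step : ∀ i j → i < len → j < len → R i j → R (suc i) (suc j)) where

  private
    run : ∀ i j r → i ≤ j → j + r ≤ len → R i j → R (i + r) (j + r)
    run i j zero    _ _ e = subst₂ R (sym (+-identityʳ i)) (sym (+-identityʳ j)) e
    run i j (suc r) i≤j le e = subst₂ R (sym (+-suc i r)) (sym (+-suc j r))
      (step (i + r) (j + r) (≤-trans (s≤s (+-monoˡ-≤ r i≤j)) lt) lt (run i j r i≤j (<⇒≤ lt) e))
      where
      lt : j + r < len
      lt = subst (_≤ len) (+-suc j r) le

    multiple : ∀ π → (∀ n → Q ≤ n → n + π ≤ len → R n (n + π)) → ∀ q n → Q ≤ n → n + q * π ≤ len → R n (n + q * π)
    multiple π per zero n _ _ = subst (R n) (sym (+-identityʳ n)) R-refl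
    multiple π per (suc q) n Q≤n le = R-trans (per n Q≤n (≤-trans (+-monoʳ-≤ n (m≤m+n π (q * π))) le))
      (subst (R (n + π)) (+-assoc n π (q * π))
        (multiple π per q (n + π) (≤-trans Q≤n (m≤m+n n π)) (subst (_≤ len) (sym (+-assoc n π (q * π))) le)))

  -- A coincidence at `i < j` propagates and gives the period `j - i`. Its multiple `Q !` is one
  -- period for all sequences with a coincidence up to `Q`; such a common period is what can be
  -- carried from row to row.
  eventually-periodic : ∀ i j → i < j → j ≤ Q → R i j → ∀ n → Q ≤ n → n + Q ! ≤ len → R n (n + Q !)
  eventually-periodic i j i<j j≤Q e n Q≤n le with 1≤m≤n⇒m∣n! {j ∸ i} {Q} (ℕₚ.m<n⇒0<n∸m i<j) (≤-trans (ℕₚ.m∸n≤m j i) j≤Q)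
  ... | divides q eq = subst (λ z → R n (n + z)) (sym eq) (multiple (j ∸ i) per q n Q≤n (subst (λ z → n + z ≤ len) eq le))
    where
    per : ∀ n → Q ≤ n → n + (j ∸ i) ≤ len → R n (n + (j ∸ i))
    per n Q≤n le = subst₂ R (m+[n∸m]≡n i≤n) eq₂ (run i j (n ∸ i) (<⇒≤ i<j) (subst (_≤ len) (sym eq₂) le) e)
      where
      i≤n : i ≤ n
      i≤n = ≤-trans (<⇒≤ i<j) (≤-trans j≤Q Q≤n)
      eq₂ : j + (n ∸ i) ≡ n + (j ∸ i)
      eq₂ = trans (cong (_+ (n ∸ i)) (sym (m∸n+n≡m (<⇒≤ i<j))))
              (trans (+-assoc (j ∸ i) i (n ∸ i)) (trans (cong (λ z → (j ∸ i) + z) (m+[n∸m]≡n i≤n)) (+-comm (j ∸ i) n)))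

funToFin-injective : ∀ {m n} (f g : Fin m → Fin n) → funToFin f ≡ funToFin g → ∀ t → f t ≡ g t
funToFin-injective f g e t = trans (sym (Finₚ.finToFun-funToFin f t)) (trans (cong (λ z → finToFun z t) e) (Finₚ.finToFun-funToFin g t))

-- Propagation of a horizontal period from row to row

i<j⇒j-i≡+suc : ∀ {i j} → i <ᶻ j → ∃[ n ] j -ᶻ i ≡ + suc n
i<j⇒j-i≡+suc {i} {j} i<j = ∣ j -ᶻ ℤ.suc i ∣ ,
  trans (lem i j) (cong (1ℤ +ᶻ_) (sym (ℤₚ.0≤i⇒+∣i∣≡i (ℤₚ.i≤j⇒0≤j-i (ℤₚ.i<j⇒suc[i]≤j i<j)))))
  where
  lem : ∀ i j → j -ᶻ i ≡ 1ℤ +ᶻ (j -ᶻ (1ℤ +ᶻ i))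
  lem = solve-∀

+∣i+n∣ : ∀ i n → ∣ i ∣ ≤ n → + ∣ i +ᶻ + n ∣ ≡ i +ᶻ + n
+∣i+n∣ (+ m) n _ = refl
+∣i+n∣ -[1+ m ] n le = trans (cong (λ z → + ∣ z ∣) (ℤₚ.⊖-≥ le)) (sym (ℤₚ.⊖-≥ le))

shift-x : ∀ u a b → u ⊕ (a , 0ℤ) ⊕ (b , 0ℤ) ≡ u ⊕ (a +ᶻ b , 0ℤ)
shift-x u a b = ⊕-assoc u (a , 0ℤ) (b , 0ℤ)

-- After `2 B + 1` steps a nonzero increment would carry `f` further than `2 B`, the largest
-- distance between two admissible values.
bounded-progression : ∀ (f : ℕ → ℤ) B s → (∀ i → ∣ f i ∣ ≤ B) →
  (∀ i → i < suc (B + B) → f (suc i) ≡ f i +ᶻ s) → s ≡ 0ℤ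
bounded-progression f B s bound step = case s ℤ.≟ 0ℤ of λ { (yes e) → e ; (no ne) → ⊥-elim (<⇒≱ (big ne) small) }
  where
  J : ℕ
  J = suc (B + B)
  lem₀ : ∀ x s → x ≡ x +ᶻ 0ℤ *ᶻ s
  lem₀ = solve-∀
  lem₁ : ∀ x s j → x +ᶻ j *ᶻ s +ᶻ s ≡ x +ᶻ (1ℤ +ᶻ j) *ᶻ s
  lem₁ = solve-∀
  lem₂ : ∀ x y → x +ᶻ y -ᶻ x ≡ y
  lem₂ = solve-∀
  term : ∀ j → j ≤ J → f j ≡ f 0 +ᶻ + j *ᶻ s
  term zero _ = lem₀ (f 0) s
  term (suc j) le = trans (step j le) (trans (cong (_+ᶻ s) (term j (<⇒≤ le))) (lem₁ (f 0) s (+ j)))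
  small : J * ∣ s ∣ ≤ B + B
  small = ≤-trans (≤-reflexive (trans (sym (ℤₚ.abs-* (+ J) s)) (cong ∣_∣ (trans (sym (lem₂ (f 0) (+ J *ᶻ s))) (cong (_-ᶻ f 0) (sym (term J ≤-refl)))))))
            (abs-+ (f J) (-ᶻ f 0) (bound J) (abs-neg (f 0) (bound 0)))
  big : s ≢ 0ℤ → B + B < J * ∣ s ∣
  big ne = ≤-trans (≤-reflexive (sym (ℕₚ.*-identityʳ J))) (*-monoʳ-≤ J (ℕₚ.n≢0⇒n>0 (λ e → ne (ℤₚ.∣i∣≡0⇒i≡0 e))))

module RowPeriod (F : Form) (lead : Leading F) (h Δ B m₀ : ℕ)
  (rows : ∀ {p} → p ∈ map proj₂ F → ∣ proj₁ p ∣ ≤ Δ × ∃[ n ] (n ≤ h × proj₂ p ≡ -ᶻ (+ n))) where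
  open Leading lead

  W : ℕ
  W = suc (Δ + Δ)

  -- The relation, placed with its leading cell on `v`, expresses `coeff * s v` through its other
  -- cells. By the choice of the leading cell these lie above `v`, or to its left in the same row.
  determined : ∀ s → Annihilates F s → ∀ v₁ v₂ →
    (∀ x n → ∣ x ∣ ≤ W → n < h → s (v₁ ⊕ (x , + suc n)) ≡ s (v₂ ⊕ (x , + suc n))) →
    (∀ i → i < W → s (v₁ ⊕ (-ᶻ (+ suc i) , 0ℤ)) ≡ s (v₂ ⊕ (-ᶻ (+ suc i) , 0ℤ))) → s v₁ ≡ s v₂
  determined s ann v₁ v₂ above left =
    ℤₚ.*-cancelˡ-≡ coeff (s v₁) (s v₂) {{ℤ.≢-nonZero coeff≢0}}
      (trans (lead-value v₁) (trans (cong -ᶻ_ (apply-cong rest s (λ {p} p∈ → trans (cong s (regroup v₁ p)) (trans (same p∈) (cong s (sym (regroup v₂ p))))))) (sym (lead-value v₂))))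
    where
    regroup : ∀ v p → v ⊕ (⊖ cell) ⊕ p ≡ v ⊕ (p ⊕ (⊖ cell))
    regroup v p = trans (⊕-assoc v (⊖ cell) p) (cong (v ⊕_) (⊕-comm (⊖ cell) p))
    lem : ∀ x y → x ≡ -ᶻ y +ᶻ (x +ᶻ y)
    lem = solve-∀
    lead-value : ∀ v → coeff *ᶻ s v ≡ -ᶻ apply rest s (v ⊕ (⊖ cell))
    lead-value v = trans (lem _ (apply rest s (v ⊕ (⊖ cell))))
      (trans (cong (-ᶻ apply rest s (v ⊕ (⊖ cell)) +ᶻ_)
        (trans (cong (λ z → coeff *ᶻ s z +ᶻ apply rest s (v ⊕ (⊖ cell))) (sym (⊖-cancel v cell))) (trans (sym (split s (v ⊕ (⊖ cell)))) (ann _))))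
        (ℤₚ.+-identityʳ _))
    same : ∀ {p} → p ∈ map proj₂ rest → s (v₁ ⊕ (p ⊕ (⊖ cell))) ≡ s (v₂ ⊕ (p ⊕ (⊖ cell)))
    same {p@(px , py)} p∈ with rest⊆ p∈
    ... | p∈F , inj₁ cy<py with i<j⇒j-i≡+suc cy<py
    ...   | n , eq = subst (λ z → s (v₁ ⊕ (px -ᶻ proj₁ cell , z)) ≡ s (v₂ ⊕ (px -ᶻ proj₁ cell , z))) (sym eq)
              (above (px -ᶻ proj₁ cell) n (m≤n⇒m≤1+n (abs-+ px (-ᶻ proj₁ cell) (proj₁ (rows p∈F)) (abs-neg (proj₁ cell) (proj₁ (rows cell∈))))) (n<h (rows p∈F) (rows cell∈)))
      where
      lem₂ : ∀ s a b → -ᶻ a -ᶻ (-ᶻ b) ≡ s → s +ᶻ a ≡ b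
      lem₂ _ a b refl = lem₃ a b
        where
        lem₃ : ∀ a b → -ᶻ a -ᶻ (-ᶻ b) +ᶻ a ≡ b
        lem₃ = solve-∀
      n<h : ∣ px ∣ ≤ Δ × ∃[ a ] (a ≤ h × py ≡ -ᶻ (+ a)) → ∣ proj₁ cell ∣ ≤ Δ × ∃[ b ] (b ≤ h × proj₂ cell ≡ -ᶻ (+ b)) → n < h
      n<h (_ , a , a≤h , ya) (_ , b , b≤h , yb) =
        ≤-trans (m≤m+n (suc n) a) (≤-trans (≤-reflexive (ℤₚ.+-injective (lem₂ (+ suc n) (+ a) (+ b) (trans (cong₂ _-ᶻ_ (sym ya) (sym yb)) eq)))) b≤h)
    same {p@(px , py)} p∈ | p∈F , inj₂ (cy≡py , px<cx) with i<j⇒j-i≡+suc px<cx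
    ... | i , eq = subst₂ (λ z w → s (v₁ ⊕ (z , w)) ≡ s (v₂ ⊕ (z , w))) (sym x≡) (sym y≡) (left i i<W)
      where
      lem₂ : ∀ a b → a -ᶻ b ≡ -ᶻ (b -ᶻ a)
      lem₂ = solve-∀
      x≡ : px -ᶻ proj₁ cell ≡ -ᶻ (+ suc i)
      x≡ = trans (lem₂ px (proj₁ cell)) (cong -ᶻ_ eq)
      y≡ : py -ᶻ proj₂ cell ≡ 0ℤ
      y≡ = trans (cong (λ z → py -ᶻ z) cy≡py) (ℤₚ.+-inverseʳ py)
      i<W : i < W
      i<W = m≤n⇒m≤1+n (≤-trans (≤-reflexive (cong ∣_∣ (sym eq))) (abs-+ (proj₁ cell) (-ᶻ px) (proj₁ (rows cell∈)) (abs-neg px (proj₁ (rows p∈F)))))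

  -- The power counts the states of `W` consecutive values of absolute value at most `2 B`. The
  -- summand `m₀` makes `T = Q !` a multiple also of every period up to `m₀`, in particular of the
  -- one that Morse-Hedlund will supply.
  Q : ℕ
  Q = suc (B + B + (B + B)) ^ W + m₀

  T : ℕ
  T = Q !

  τ : Pos
  τ = + T , 0ℤ

  -- Room for the preperiod `Q` and a window `W`, for `2 B + 1` steps of length `T`, and for a last
  -- comparison at distance `T`. The constant `C` below is the resulting loss of width on each side
  -- for one new row.
  len : ℕ
  len = Q + W + suc (B + B) * T + T

  C : ℕ
  C = Q + W + (len + W) + W

  -- On the new row, Δ[ τ ] g satisfies a linear recurrence and takes finitely many values, so it is
  -- T-periodic; then g is an arithmetic progression along steps of length T, and it is bounded.
  next-row : ∀ g → (∀ v → ∣ g v ∣ ≤ B) → Annihilates F (Δ[ τ ] g) → ∀ u L →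
    (∀ x n → ∣ x ∣ ≤ L + C → n < h → Δ[ τ ] g (u ⊕ (x , + suc n)) ≡ 0ℤ) →
    ∀ x → ∣ x ∣ ≤ L → Δ[ τ ] g (u ⊕ (x , 0ℤ)) ≡ 0ℤ
  next-row g bound ann u L above x x≤ = trans (cong s (sym at-x)) s≡0
    where
    s : Pos → ℤ
    s = Δ[ τ ] g
    -- Starting `Q + W` cells to the left puts `x` itself past the preperiod.
    x₀ : ℤ
    x₀ = x -ᶻ + (Q + W)
    pt : ℕ → Pos
    pt i = u ⊕ (x₀ +ᶻ + i , 0ℤ)
    lem₁ : ∀ x q → x -ᶻ q +ᶻ q ≡ x
    lem₁ = solve-∀
    at-x : pt (Q + W) ≡ u ⊕ (x , 0ℤ)
    at-x = cong (λ z → u ⊕ (z , 0ℤ)) (lem₁ x (+ (Q + W)))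
    R : ℕ → ℕ → Set
    R i j = ∀ t → t < W → s (pt (i + t)) ≡ s (pt (j + t))
    s≤ : ∀ v → ∣ s v ∣ ≤ B + B
    s≤ v = abs-+ (g (v ⊕ τ)) (-ᶻ g v) (bound _) (abs-neg (g v) (bound v))
    zero-above : ∀ i → i < len → ∀ y n → ∣ y ∣ ≤ W → n < h → s (pt (i + W) ⊕ (y , + suc n)) ≡ 0ℤ
    zero-above i i< y n y≤ n< = trans (cong s (trans (⊕-assoc u _ _) (cong (λ z → u ⊕ (z , + suc n)) (ℤₚ.+-assoc x₀ (+ (i + W)) y))))
      (above (x₀ +ᶻ (+ (i + W) +ᶻ y)) n (≤-trans (abs-+ x₀ _ (abs-+ x (-ᶻ (+ (Q + W))) x≤ (abs-neg (+ (Q + W)) ≤-refl)) (abs-+ (+ (i + W)) y (+-monoˡ-≤ W (<⇒≤ i<)) y≤))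
        (≤-reflexive (trans (+-assoc L (Q + W) _) (cong (λ z → L + z) (sym (+-assoc (Q + W) (len + W) W)))))) n<)
    step : ∀ i j → i < len → j < len → R i j → R (suc i) (suc j)
    step i j i< j< r t t< with m≤n⇒m<n∨m≡n (ℕ.s≤s⁻¹ t<)
    ... | inj₁ t<2Δ = subst₂ (λ a b → s (pt a) ≡ s (pt b)) (+-suc i t) (+-suc j t) (r (suc t) (s≤s t<2Δ))
    ... | inj₂ refl = subst₂ (λ a b → s (pt a) ≡ s (pt b)) (+-suc i (Δ + Δ)) (+-suc j (Δ + Δ))
            (determined s ann (pt (i + W)) (pt (j + W))
              (λ y n y≤ n< → trans (zero-above i i< y n y≤ n<) (sym (zero-above j j< y n y≤ n<)))
              (λ a a< → trans (cong s (back i a a<)) (trans (r (W ∸ suc a) (ℕ.s≤s (ℕₚ.m∸n≤m (Δ + Δ) a))) (cong s (sym (back j a a<))))))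
      where
      lem₂ : ∀ x i w a → x +ᶻ (i +ᶻ (a +ᶻ w)) +ᶻ -ᶻ a ≡ x +ᶻ (i +ᶻ w)
      lem₂ = solve-∀
      back : ∀ i a → a < W → pt (i + W) ⊕ (-ᶻ (+ suc a) , 0ℤ) ≡ pt (i + (W ∸ suc a))
      back i a a< = trans (shift-x u _ _) (cong (λ z → u ⊕ (z , 0ℤ))
        (trans (cong (λ w → x₀ +ᶻ + (i + w) +ᶻ -ᶻ (+ suc a)) (sym (m+[n∸m]≡n a<))) (lem₂ x₀ (+ i) (+ (W ∸ suc a)) (+ suc a))))
    num : ℕ
    num = suc (B + B + (B + B))
    code : Pos → Fin num
    code v = fromℕ< {∣ s v +ᶻ + (B + B) ∣} (s≤s (abs-+ (s v) (+ (B + B)) (s≤ v) ≤-refl))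
    code-inj : ∀ v w → code v ≡ code w → s v ≡ s w
    code-inj v w e = lem₃ (s v) (s w) (+ (B + B)) (trans (sym (+∣i+n∣ (s v) _ (s≤ v)))
       (trans (cong +_ (trans (sym (Finₚ.toℕ-fromℕ< _)) (trans (cong toℕ e) (Finₚ.toℕ-fromℕ< _)))) (+∣i+n∣ (s w) _ (s≤ w))))
      where
      lem₃ : ∀ a b c → a +ᶻ c ≡ b +ᶻ c → a ≡ b
      lem₃ a b c e = trans (lem₅ a c) (trans (cong (_-ᶻ c) e) (sym (lem₅ b c)))
        where
        lem₅ : ∀ a c → a ≡ a +ᶻ c -ᶻ c
        lem₅ = solve-∀
    state : ℕ → Fin (num ^ W)
    state i = funToFin {W} (λ t → code (pt (i + toℕ t)))
    state-inj : ∀ i j → state i ≡ state j → R i j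
    state-inj i j e t t< = subst (λ z → s (pt (i + z)) ≡ s (pt (j + z))) (Finₚ.toℕ-fromℕ< t<)
      (code-inj _ _ (funToFin-injective {W} (λ t → code (pt (i + toℕ t))) (λ t → code (pt (j + toℕ t))) e t′))
      where
      t′ : Fin W
      t′ = fromℕ< t<
    periodic : ∀ n → Q ≤ n → n + T ≤ len → R n (n + T)
    periodic with Finₚ.pigeonhole {num ^ W} {suc Q} (s≤s (m≤m+n (num ^ W) m₀)) (λ i → state (toℕ i))
    ... | i , j , i<j , e = eventually-periodic R (λ _ _ → refl) (λ r r′ t t< → trans (r t t<) (r′ t t<)) len Q step
                              (toℕ i) (toℕ j) i<j (ℕ.s≤s⁻¹ (Finₚ.toℕ<n j)) (state-inj (toℕ i) (toℕ j) e)
    n₀ : ℕ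
    n₀ = Q + W
    pt-τ : ∀ i → pt i ⊕ τ ≡ pt (i + T)
    pt-τ i = trans (shift-x u _ _) (cong (λ z → u ⊕ (z , 0ℤ)) (ℤₚ.+-assoc x₀ (+ i) (+ T)))
    next : ∀ i → n₀ + (suc i) * T ≡ n₀ + i * T + T
    next i = trans (cong (λ z → n₀ + z) (+-comm T (i * T))) (sym (+-assoc n₀ (i * T) T))
    s-const : ∀ i → i ≤ suc (B + B) → s (pt (n₀ + i * T)) ≡ s (pt n₀)
    s-const zero _ = cong (λ z → s (pt z)) (+-identityʳ n₀)
    s-const (suc i) i≤ = trans (cong (λ z → s (pt z)) (next i)) (trans (sym eq) (s-const i (<⇒≤ i≤)))
      where
      eq : s (pt (n₀ + i * T)) ≡ s (pt (n₀ + i * T + T))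
      eq = subst₂ (λ a b → s (pt a) ≡ s (pt b)) (+-identityʳ _) (+-identityʳ _)
        (periodic (n₀ + i * T) (≤-trans (m≤m+n Q W) (m≤m+n n₀ (i * T))) (+-monoˡ-≤ T (+-monoʳ-≤ n₀ (*-monoˡ-≤ T (<⇒≤ i≤)))) 0 (s≤s z≤n))
    lem₄ : ∀ a b → a ≡ b +ᶻ (a -ᶻ b)
    lem₄ = solve-∀
    s≡0 : s (pt n₀) ≡ 0ℤ
    s≡0 = bounded-progression (λ i → g (pt (n₀ + i * T))) B (s (pt n₀)) (λ i → bound _)
      (λ i i< → trans (cong (λ z → g (pt z)) (next i)) (trans (cong g (sym (pt-τ (n₀ + i * T))))
        (trans (lem₄ _ (g (pt (n₀ + i * T)))) (cong (g (pt (n₀ + i * T)) +ᶻ_) (s-const i (<⇒≤ i<))))))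

  -- The strip grows downwards: its last `h` rows supply the zeros that `next-row` asks for, and
  -- each new row costs the width `C` on both sides.
  more-rows : ∀ g → (∀ v → ∣ g v ∣ ≤ B) → Annihilates F (Δ[ τ ] g) → ∀ u L r →
    (∀ x n → ∣ x ∣ ≤ L + r * C → n < h → Δ[ τ ] g (u ⊕ (x , -ᶻ (+ n))) ≡ 0ℤ) →
    ∀ x n → ∣ x ∣ ≤ L → n < h + r → Δ[ τ ] g (u ⊕ (x , -ᶻ (+ n))) ≡ 0ℤ
  more-rows g bound ann u L zero top x n x≤ n< =
    top x n (≤-trans x≤ (m≤m+n L 0)) (subst (n <_) (+-identityʳ h) n<)
  more-rows g bound ann u L (suc r) top x n x≤ n< with m≤n⇒m<n∨m≡n (ℕ.s≤s⁻¹ (subst (n <_) (+-suc h r) n<))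
  ... | inj₁ n<h+r = more-rows g bound ann u (L + C) r
          (λ x n x≤ → top x n (≤-trans x≤ (≤-reflexive (+-assoc L C (r * C))))) x n (≤-trans x≤ (m≤m+n L C)) n<h+r
  ... | inj₂ refl = trans (cong (Δ[ τ ] g) (sym row₀)) (next-row g bound ann (u ⊕ (0ℤ , -ᶻ (+ (h + r)))) L
          (λ y m y≤ m< → trans (cong (Δ[ τ ] g) (row₁ y m m<))
            (more-rows g bound ann u (L + C) r (λ x n x≤ → top x n (≤-trans x≤ (≤-reflexive (+-assoc L C (r * C)))))
              y (h + r ∸ suc m) y≤ (ℕₚ.∸-monoʳ-< (s≤s z≤n) (≤-trans m< (m≤m+n h r)))))
          x x≤)
    where
    row₀ : u ⊕ (0ℤ , -ᶻ (+ (h + r))) ⊕ (x , 0ℤ) ≡ u ⊕ (x , -ᶻ (+ (h + r)))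
    row₀ = trans (⊕-assoc u _ _) (cong (u ⊕_) (pos-≡ (ℤₚ.+-identityˡ x) (ℤₚ.+-identityʳ _)))
    lem : ∀ a b → -ᶻ (a +ᶻ b) +ᶻ a ≡ -ᶻ b
    lem = solve-∀
    row₁ : ∀ y m → m < h → u ⊕ (0ℤ , -ᶻ (+ (h + r))) ⊕ (y , + suc m) ≡ u ⊕ (y , -ᶻ (+ (h + r ∸ suc m)))
    row₁ y m m< = trans (⊕-assoc u _ _) (cong (u ⊕_) (pos-≡ (ℤₚ.+-identityˡ y)
      (trans (cong (λ z → -ᶻ (+ z) +ᶻ + suc m) (sym (m+[n∸m]≡n {suc m} (≤-trans m< (m≤m+n h r))))) (lem (+ suc m) (+ (h + r ∸ suc m))))))

UniformlyRecurrent : ∀ {k} → Config k → Set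
UniformlyRecurrent c = ∀ n → ∃[ R ] (∀ u v → ∃[ o ] (Near R o × (∀ p → Near n p → c (u ⊕ p) ≡ c (v ⊕ o ⊕ p))))

NonPeriodic : ∀ {k} → Config k → Set
NonPeriodic c = ∀ t → t ≢ 𝟎 → ¬ (∀ v → c (v ⊕ t) ≡ c v)

-- Take for `S` the recurrence radius of patterns of radius `n`. The surroundings of any `w` recur
-- within distance `S` of `v`, so a period `t` valid around `v` would be a period at every `w`.
no-local-period : ∀ {k} (c : Config k) → UniformlyRecurrent c → NonPeriodic c → ∀ n →
  ∃[ S ] (∀ t → t ≢ 𝟎 → Near n t → ∀ v → ¬ (∀ p → Near S p → c (v ⊕ p ⊕ t) ≡ c (v ⊕ p)))
no-local-period c ur np n with ur n
... | S , rec = S , λ t t≢0 t≤ v per → np t t≢0 (λ w → let o , o≤ , eq = rec w v in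
      trans (eq t t≤) (trans (per o o≤) (trans (cong c (sym (⊕-identityʳ _))) (trans (sym (eq 𝟎 (z≤n , z≤n))) (cong c (⊕-identityʳ w))))))

-- Deterministic and non-deterministic sides of a horizontal line

Below Above : ∀ {k} → Config k → ℕ → Pos → Pos → Set
Below c L u v = ∀ x n → ∣ x ∣ ≤ L → n < L → c (u ⊕ (x , -ᶻ (+ suc n))) ≡ c (v ⊕ (x , -ᶻ (+ suc n)))
Above c L u v = ∀ x n → ∣ x ∣ ≤ L → n < L → c (u ⊕ (x , + suc n)) ≡ c (v ⊕ (x , + suc n))

UpDet DownDet : ∀ {k} → Config k → ℕ → Set
UpDet c L = ∀ u v → Below c L u v → c u ≡ c v
DownDet c L = ∀ u v → Above c L u v → c u ≡ c v

-- The minimal window: `E₁` is the line of `m + 1` cells and `E₀` the strip of `h` rows below it;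
-- the number of patterns exceeds the size for `E₀`, but no longer once the line is added. By `long`
-- each row of the strip has at least `m` cells, one fewer than the line, which is just enough for
-- Morse-Hedlund with at most `m` classes.
record Balanced {k : ℕ} (c : Config k) (E₀ E₁ : List Pos) (Δ h m : ℕ) : Set where
  open Lang c
  field
    width   : ∀ {p} → p ∈ E₀ ++ E₁ → ∣ proj₁ p ∣ ≤ Δ
    lower   : ∀ {p} → p ∈ E₀ → ∃[ n ] (n < h × proj₂ p ≡ -ᶻ (+ suc n))
    top     : ∀ {p} → p ∈ E₁ → proj₂ p ≡ 0ℤ
    unique  : Unique (E₀ ++ E₁)
    convex  : ∀ x y i j → (x , y) ∈ E₀ ++ E₁ → (x +ᶻ + (i + j) , y) ∈ E₀ ++ E₁ → (x +ᶻ + i , y) ∈ E₀ ++ E₁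
    long    : ∀ n → n < h → 1 ≤ m → ∃[ x ] ((x , -ᶻ (+ suc n)) ∈ E₀ × (x +ᶻ + (m ∸ 1) , -ᶻ (+ suc n)) ∈ E₀)
    length₁ : length E₁ ≡ suc m
    over₀   : Over E₀
    ¬over   : ¬ Over (E₀ ++ E₁)

module BalancedSet {k : ℕ} (c : Config k) (ur : UniformlyRecurrent c) (np : NonPeriodic c)
  (E₀ E₁ : List Pos) (Δ h m : ℕ) (bal : Balanced c E₀ E₁ Δ h m)
  (F : Form) (supp : map proj₂ F ≡ E₀ ++ E₁) (nz : NonZeroForm F)
  (ann : ∀ t → Annihilates F (Δ[ t ] (LinearRelation.γ c))) where
  open Lang c
  open LinearRelation c using (γ)
  open Balanced bal
  open DecMembership _≟ᵖ_ using (_∈?_)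

  E : List Pos
  E = E₀ ++ E₁

  lead : Leading F
  lead = [ (λ z → ⊥-elim (proj₂ z nz)) , id ]′ (leading F (subst Unique (sym supp) unique))

  rows : ∀ {p} → p ∈ map proj₂ F → ∣ proj₁ p ∣ ≤ Δ × ∃[ n ] (n ≤ h × proj₂ p ≡ -ᶻ (+ n))
  rows {p} p∈F = width p∈ , [ (λ q → let n , n< , e = lower q in suc n , n< , e) , (λ q → 0 , z≤n , top q) ]′ (∈-++⁻ E₀ p∈)
    where
    p∈ : p ∈ E
    p∈ = subst (p ∈_) supp p∈F

  open RowPeriod F lead h Δ (k + k) m rows public

  γ≤k : ∀ v → ∣ γ v ∣ ≤ k
  γ≤k v = <⇒≤ (Finₚ.toℕ<n (c v))

  T>0 : 0 < T
  T>0 = ℕₚ.n≢0⇒n>0 (ℕ.≢-nonZero⁻¹ T {{Q !≢0}})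

  τ≢𝟎 : τ ≢ 𝟎
  τ≢𝟎 e = <-irrefl (sym (ℤₚ.+-injective (cong proj₁ e))) T>0

  -- `S` is the radius within which `τ` cannot be a local period, `r₀` rows cover a ball of that
  -- radius, and a strip of half-width `L₁` still has half-width `S` after `r₀` new rows. Among the
  -- `Len` windows considered along the line, such a strip is centred at index `K`, past the
  -- preperiod `Q`. All cells of these windows lie in a half-window of size `Lup`.
  S r₀ L₁ K Len Lup : ℕ
  S = proj₁ (no-local-period c ur np T)
  r₀ = suc (S + S)
  L₁ = S + r₀ * C
  K = Q + L₁ + Δ
  Len = K + L₁ + Δ + T
  Lup = Len + (Δ + Δ) + h

  -- Extended downwards, the strip covers a ball of radius `S` centred `S` rows below its top row,
  -- and `τ` would be a local period there.
  periodic-strip-absurd : ∀ v → (∀ x n → ∣ x ∣ ≤ L₁ → n < h → Δ[ τ ] γ (v ⊕ (x , -ᶻ (+ n))) ≡ 0ℤ) → ⊥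
  periodic-strip-absurd v strip = proj₂ (no-local-period c ur np T) τ τ≢𝟎 (≤-refl , z≤n) (v ⊕ (0ℤ , -ᶻ (+ S)))
    λ p p≤ → Finₚ.toℕ-injective (ℤₚ.+-injective (ℤₚ.i-j≡0⇒i≡j _ _ (trans (cong (Δ[ τ ] γ) (point p p≤))
      (more-rows γ (λ v → ≤-trans (γ≤k v) (m≤m+n k k)) (ann τ) v S r₀ strip (proj₁ p) ∣ -ᶻ proj₂ p +ᶻ + S ∣ (proj₁ p≤) (depth p p≤)))))
    where
    lem : ∀ y s → -ᶻ s +ᶻ y ≡ -ᶻ (-ᶻ y +ᶻ s)
    lem = solve-∀
    point : ∀ p → Near S p → v ⊕ (0ℤ , -ᶻ (+ S)) ⊕ p ≡ v ⊕ (proj₁ p , -ᶻ (+ ∣ -ᶻ proj₂ p +ᶻ + S ∣))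
    point (x , y) (_ , y≤) = trans (⊕-assoc v _ _) (cong (v ⊕_) (pos-≡ (ℤₚ.+-identityˡ x)
      (trans (lem y (+ S)) (cong -ᶻ_ (sym (+∣i+n∣ (-ᶻ y) S (abs-neg y y≤)))))))
    depth : ∀ p → Near S p → ∣ -ᶻ proj₂ p +ᶻ + S ∣ < h + r₀
    depth (x , y) (_ , y≤) = ≤-trans (s≤s (abs-+ (-ᶻ y) (+ S) (abs-neg y y≤) ≤-refl)) (m≤n+m r₀ h)

  key : Pos → ℕ
  key (x , y) with y ℤ.≟ 0ℤ
  ... | yes _ = suc ∣ x +ᶻ + Δ ∣
  ... | no _  = 0

  key-low : ∀ {p} → p ∈ E₀ → key p ≡ 0
  key-low {x , y} p∈ with y ℤ.≟ 0ℤ | lower p∈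
  ... | no _ | _ = refl
  ... | yes refl | _ , _ , ()

  key-pos : ∀ {p} → 1 ≤ key p → proj₂ p ≡ 0ℤ
  key-pos {x , y} le with y ℤ.≟ 0ℤ
  ... | yes e = e
  key-pos {x , y} () | no _

  open Threshold c key E

  ∣x+Δ∣-inj : ∀ {x x′} → ∣ x ∣ ≤ Δ → ∣ x′ ∣ ≤ Δ → ∣ x +ᶻ + Δ ∣ ≡ ∣ x′ +ᶻ + Δ ∣ → x ≡ x′
  ∣x+Δ∣-inj {x} {x′} x≤ x′≤ e = trans (lem x (+ Δ)) (trans (cong (_-ᶻ + Δ) (trans (sym (+∣i+n∣ x Δ x≤)) (trans (cong +_ e) (+∣i+n∣ x′ Δ x′≤)))) (sym (lem x′ (+ Δ))))
    where
    lem : ∀ a c → a ≡ a +ᶻ c -ᶻ c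
    lem = solve-∀

  key-inj : ∀ {p q} → p ∈ E → q ∈ E → 1 ≤ key p → key p ≡ key q → p ≡ q
  key-inj {x , y} {x′ , y′} p∈ q∈ le e with key-pos {x , y} le | key-pos {x′ , y′} (subst (1 ≤_) e le)
  ... | refl | refl = pos-≡ (∣x+Δ∣-inj (width p∈) (width q∈) (ℕₚ.suc-injective e)) refl

  over-below-1 : Over (below 1)
  over-below-1 = over-subst (λ p∈ → ∈⇒below (∈-++⁺ˡ p∈) (≤-reflexive (cong suc (key-low p∈)))) len≤ over₀
    where
    none : All (λ p → ¬ key p < 1) E₁
    none = All.tabulate (λ { {x , y} p∈ lt → case top p∈ of λ { refl → case lt of λ { (s≤s ()) } } })
    len≤ : length (below 1) ≤ length E₀
    len≤ = ≤-trans (≤-reflexive (trans (cong length (filter-++ (λ p → key p <? 1) E₀ E₁))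
             (trans (length-++ (filter (λ p → key p <? 1) E₀)) (trans (cong (λ l → length (filter (λ p → key p <? 1) E₀) + length l) (filter-none (λ p → key p <? 1) none)) (+-identityʳ _)))))
             (length-filter (λ p → key p <? 1) E₀)

  N : ℕ
  N = suc (Δ + Δ)

  key<N : ∀ {p} → p ∈ E → key p < 1 + N
  key<N {x , y} p∈ with y ℤ.≟ 0ℤ
  ... | yes _ = s≤s (s≤s (abs-+ x (+ Δ) (width p∈) ≤-refl))
  ... | no _ = s≤s z≤n

  ¬over-below-N : ¬ Over (below (1 + N))
  ¬over-below-N ov = ¬over (over-subst (proj₁ ∘ below⇒∈)
    (≤-reflexive (cong length (sym (filter-all (λ p → key p <? 1 + N) (All.tabulate key<N))))) ov)

  -- If two positions agree below the line but not on it, then every window to the left is ambiguous.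
  module Ambiguous (u v : Pos) (agree↓ : Below c Lup u v) (u≉v : c u ≢ c v) (t : ℕ) (x₁ : ℤ)
    (p₁∈ : (x₁ , 0ℤ) ∈ E) (key₁ : key (x₁ , 0ℤ) ≡ t) (¬over-t : ¬ Over (below (suc t)))
    (det : ∀ u v → Agree (below t) u v → c (u ⊕ (x₁ , 0ℤ)) ≡ c (v ⊕ (x₁ , 0ℤ))) where

    back : Pos → ℕ → Pos
    back w r = w ⊕ (-ᶻ x₁ -ᶻ + r , 0ℤ)

    E₀-agree : ∀ r → r ≤ Len → Agree E₀ (back u r) (back v r)
    E₀-agree r r≤ = agree λ { {x , y} p∈ → case lower p∈ of λ { (n , n< , refl) →
      subst₂ (λ a b → c a ≡ c b) (sym (⊕-assoc u _ _)) (sym (⊕-assoc v _ _))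
        (agree↓ (-ᶻ x₁ -ᶻ + r +ᶻ x) n
          (≤-trans (abs-+ (-ᶻ x₁ -ᶻ + r) x (abs-+ (-ᶻ x₁) (-ᶻ (+ r)) (abs-neg x₁ (width p₁∈)) (abs-neg (+ r) r≤)) (width (∈-++⁺ˡ p∈)))
            (≤-trans (≤-reflexive (trans (cong (_+ Δ) (+-comm Δ Len)) (+-assoc Len Δ Δ))) (m≤m+n _ h)))
          (≤-trans n< (m≤n+m h _))) } }

    right : ∀ {x} → (x , 0ℤ) ∈ E → key (x , 0ℤ) < t → (x +ᶻ 1ℤ , 0ℤ) ∈ E × key (x +ᶻ 1ℤ , 0ℤ) ≤ t
    right {x} p∈ lt with ℕₚ.m≤n⇒∃[o]m+o≡n lt′
      where
      lt′ : suc ∣ x +ᶻ + Δ ∣ ≤ ∣ x₁ +ᶻ + Δ ∣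
      lt′ = ℕ.s≤s⁻¹ (subst (suc ∣ x +ᶻ + Δ ∣ <_) (sym key₁) lt)
    ... | j , e = convex x 0ℤ 1 j p∈ (subst (λ z → (z , 0ℤ) ∈ E) x₁≡ p₁∈) ,
                  ≤-trans (s≤s (≤-reflexive (ℤₚ.+-injective k≡))) (≤-trans (s≤s (≤-trans (m≤m+n _ j) (≤-reflexive e))) (≤-reflexive key₁))
      where
      lem₁ : ∀ x d j → x +ᶻ (1ℤ +ᶻ j) ≡ 1ℤ +ᶻ (x +ᶻ d) +ᶻ j -ᶻ d
      lem₁ = solve-∀
      lem₂ : ∀ a c → a ≡ a +ᶻ c -ᶻ c
      lem₂ = solve-∀
      lem₃ : ∀ x d → x +ᶻ 1ℤ +ᶻ d ≡ 1ℤ +ᶻ (x +ᶻ d)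
      lem₃ = solve-∀
      x₁≡ : x₁ ≡ x +ᶻ + (1 + j)
      x₁≡ = trans (lem₂ x₁ (+ Δ)) (trans (cong (_-ᶻ + Δ) (trans (sym (+∣i+n∣ x₁ Δ (width p₁∈))) (trans (cong +_ (sym e)) (cong (λ z → 1ℤ +ᶻ z +ᶻ + j) (+∣i+n∣ x Δ (width p∈)))))) (sym (lem₁ x (+ Δ) (+ j))))
      k≡ : + ∣ x +ᶻ 1ℤ +ᶻ + Δ ∣ ≡ + suc ∣ x +ᶻ + Δ ∣
      k≡ = trans (cong (λ z → + ∣ z ∣) (trans (lem₃ x (+ Δ)) (cong (1ℤ +ᶻ_) (sym (+∣i+n∣ x Δ (width p∈)))))) refl

    split-E : ∀ {p} → p ∈ E → p ∈ E₀ ⊎ proj₂ p ≡ 0ℤ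
    split-E p∈ = [ inj₁ , inj₂ ∘ top ]′ (∈-++⁻ E₀ p∈)

    lem-back : ∀ w r x → back w r ⊕ (x , 0ℤ) ≡ back w (suc r) ⊕ (x +ᶻ 1ℤ , 0ℤ)
    lem-back w r x = trans (shift-x w _ x) (trans (cong (λ z → w ⊕ (z , 0ℤ)) (lem x₁ (+ r) x)) (sym (shift-x w _ _)))
      where
      lem : ∀ a r x → -ᶻ a -ᶻ r +ᶻ x ≡ -ᶻ a -ᶻ (1ℤ +ᶻ r) +ᶻ (x +ᶻ 1ℤ)
      lem = solve-∀

    -- Agreement at `r + 1` would travel to the right: a top cell of the window at `r` is the next
    -- cell of the window at `r + 1`, and the last one, at `x₁`, is determined by the smaller ones.
    -- It would finally reach `u` and `v`, where the letters differ.
    ambiguous : ∀ r → r ≤ Len → ¬ Agree (below (suc t)) (back u r) (back v r)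
    ambiguous zero _ ag = u≉v (subst₂ (λ a b → c a ≡ c b) (home u) (home v) (at ag (∈⇒below p₁∈ (≤-reflexive (cong suc key₁)))))
      where
      lem : ∀ a → -ᶻ a -ᶻ 0ℤ +ᶻ a ≡ 0ℤ
      lem = solve-∀
      home : ∀ w → back w 0 ⊕ (x₁ , 0ℤ) ≡ w
      home w = trans (shift-x w _ x₁) (trans (cong (λ z → w ⊕ (z , 0ℤ)) (lem x₁)) (⊕-identityʳ w))
    ambiguous (suc r) r≤ ag = ambiguous r (<⇒≤ r≤) (agree λ { {x , y} p∈ → case below⇒∈ p∈ of λ { (p∈E , lt) → go p∈E (split-E p∈E) (m≤n⇒m<n∨m≡n (ℕ.s≤s⁻¹ lt)) } })
      where
      smaller : ∀ {x y} → (x , y) ∈ E → (x , y) ∈ E₀ ⊎ y ≡ 0ℤ → key (x , y) < t → c (back u r ⊕ (x , y)) ≡ c (back v r ⊕ (x , y))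
      smaller p∈ (inj₁ q) _ = at (E₀-agree r (<⇒≤ r≤)) q
      smaller {x} p∈ (inj₂ refl) lt = trans (cong c (lem-back u r x)) (trans (at ag (let a , b = right p∈ lt in ∈⇒below a (s≤s b))) (cong c (sym (lem-back v r x))))
      go : ∀ {x y} → (x , y) ∈ E → (x , y) ∈ E₀ ⊎ y ≡ 0ℤ → key (x , y) < t ⊎ key (x , y) ≡ t → c (back u r ⊕ (x , y)) ≡ c (back v r ⊕ (x , y))
      go p∈ s (inj₁ lt) = smaller p∈ s lt
      go p∈ (inj₁ q) (inj₂ _) = at (E₀-agree r (<⇒≤ r≤)) q
      go {x} p∈ (inj₂ refl) (inj₂ e) with key-inj p∈ p₁∈ (s≤s z≤n) (trans e (sym key₁))
      ... | refl = det (back u r) (back v r) (agree λ { {x , y} q∈ → let a , b = below⇒∈ q∈ in smaller a (split-E a) b })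

    pt : ℕ → Pos
    pt i = back u Len ⊕ (+ i , 0ℤ)

    back-pt : ∀ w i → i ≤ Len → back w Len ⊕ (+ i , 0ℤ) ≡ back w (Len ∸ i)
    back-pt w i i≤ = trans (shift-x w _ _) (cong (λ z → w ⊕ (z , 0ℤ)) (trans (cong (λ z → -ᶻ x₁ -ᶻ z +ᶻ + i) (cong +_ (sym (m∸n+n≡m i≤)))) (lem x₁ (+ (Len ∸ i)) (+ i))))
      where
      lem : ∀ a l i → -ᶻ a -ᶻ (l +ᶻ i) +ᶻ i ≡ -ᶻ a -ᶻ l
      lem = solve-∀

    -- Each of these windows shows a pattern of `E₀` with two continuations on the line. With
    -- `m + 1` such patterns, more than `length E₀ + m + 1` patterns would occur, that is, more than
    -- `E` has cells.
    few-classes : ∀ is → AllPairs (λ i j → ¬ Agree E₀ (pt i) (pt j)) is → All (_≤ Len) is → ¬ suc m ≤ length is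
    few-classes is ap is≤ long′ with over₀
    ... | us , apu , lt = case
        refine (Agree-isEq E₀) (agree-⊆ (λ p∈ → ∈⇒below (∈-++⁺ˡ p∈) (subst (_< suc t) (sym (key-low p∈)) (s≤s z≤n)))) (λ _ → ⊤)
          us (map pr is) apu (All.universal (λ _ → tt) us) (Allₚ.map⁺ (All.map split is≤)) (All.universal (λ _ → tt , tt) _) (APₚ.map⁺ ap)
        of λ { (vs , apv , _ , _ , len≤) → ¬over-t (vs , apv , ≤-trans bound len≤) }
      where
      pr : ℕ → Pos × Pos
      pr i = pt i , back v Len ⊕ (+ i , 0ℤ)
      split : ∀ {i} → i ≤ Len → Agree E₀ (proj₁ (pr i)) (proj₂ (pr i)) × ¬ Agree (below (suc t)) (proj₁ (pr i)) (proj₂ (pr i))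
      split {i} i≤ = subst₂ (λ a b → Agree E₀ a b × ¬ Agree (below (suc t)) a b) (sym (back-pt u i i≤)) (sym (back-pt v i i≤))
        (E₀-agree (Len ∸ i) (ℕₚ.m∸n≤m Len i) , ambiguous (Len ∸ i) (ℕₚ.m∸n≤m Len i))
      bound : length (below (suc t)) < length us + length (map pr is)
      bound = ≤-trans (s≤s (≤-trans (length-filter _ E) (≤-trans (≤-reflexive (trans (length-++ E₀) (cong (λ z → length E₀ + z) length₁))) (+-monoʳ-≤ (length E₀) (≤-trans long′ (≤-reflexive (sym (length-map pr is))))))))
                (+-monoˡ-≤ (length (map pr is)) lt)

    -- Since rows are intervals, this is `E₀` without the last `d` cells of each row. These sets
    -- replace the words of decreasing length in Morse-Hedlund: one step to the right carries
    -- agreement on `V d` to agreement on `V (suc d)`.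
    V : ℕ → List Pos
    V d = filter (λ p → (p ⊕ (+ d , 0ℤ)) ∈? E₀) E₀

    V⇒ : ∀ {d p} → p ∈ V d → p ∈ E₀ × p ⊕ (+ d , 0ℤ) ∈ E₀
    V⇒ {d} = ∈-filter⁻ (λ p → (p ⊕ (+ d , 0ℤ)) ∈? E₀) {xs = E₀}

    ⇒V : ∀ {d p} → p ∈ E₀ → p ⊕ (+ d , 0ℤ) ∈ E₀ → p ∈ V d
    ⇒V {d} = ∈-filter⁺ (λ p → (p ⊕ (+ d , 0ℤ)) ∈? E₀)

    between : ∀ {x y} i j → (x , y) ∈ E₀ → (x , y) ⊕ (+ (i + j) , 0ℤ) ∈ E₀ → (x , y) ⊕ (+ i , 0ℤ) ∈ E₀
    between {x} {y} i j p∈ q∈ with ∈-++⁻ E₀ (convex x y i j (∈-++⁺ˡ p∈) (∈-++⁺ˡ (subst (λ z → (x +ᶻ + (i + j) , z) ∈ E₀) (ℤₚ.+-identityʳ y) q∈)))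
    ... | inj₁ r∈ = subst (λ z → (x +ᶻ + i , z) ∈ E₀) (sym (ℤₚ.+-identityʳ y)) r∈
    ... | inj₂ r∈ with lower p∈ | top r∈
    ...   | _ , _ , refl | ()

    V-mono : ∀ d e {p} → p ∈ V (d + e) → p ∈ V d
    V-mono d e {x , y} p∈ = let a , b = V⇒ p∈ in ⇒V a (between d e a b)

    V-shift : ∀ d {p} → p ∈ V (suc d) → p ⊕ (1ℤ , 0ℤ) ∈ V d
    V-shift d {x , y} p∈ = let a , b = V⇒ p∈ in ⇒V (between 1 d a b) (subst (_∈ E₀) (sym (shift-x (x , y) 1ℤ (+ d))) b)

    R : ℕ → ℕ → ℕ → Set
    R d i j = Agree (V d) (pt i) (pt j)

    R-0 : ∀ {i j} → Agree E₀ (pt i) (pt j) → ∀ d → R d i j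
    R-0 ag d = agree-⊆ (proj₁ ∘ V⇒) ag

    pt-suc : ∀ i p → pt i ⊕ (p ⊕ (1ℤ , 0ℤ)) ≡ pt (suc i) ⊕ p
    pt-suc i p = trans (cong (pt i ⊕_) (⊕-comm p _)) (trans (sym (⊕-assoc (pt i) (1ℤ , 0ℤ) p)) (cong (_⊕ p) (trans (shift-x (back u Len) (+ i) 1ℤ) (cong (λ z → back u Len ⊕ (z , 0ℤ)) (ℤₚ.+-comm (+ i) 1ℤ)))))

    R-step : ∀ {d i j} → R d i j → R (suc d) (suc i) (suc j)
    R-step {d} {i} {j} ag = agree λ {p} p∈ → trans (cong c (sym (pt-suc i p))) (trans (at ag (V-shift d p∈)) (cong c (pt-suc j p)))

    Det : ℕ → Set
    Det d = ∀ i j → i ≤ Len → j ≤ Len → R (suc d) i j → R d i j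

    -- Morse–Hedlund: m + 1 successive strict refinements would give m + 1 classes.
    some-det : ∀ d e → d + e ≡ m →
      (∀ is → AllPairs (λ i j → ¬ R d i j) is → All (_≤ Len) is → suc e ≤ length is → ⊥) →
      (∀ d → d < m → Det d → ⊥) → ⊥
    some-det d zero _ goal _ = goal (0 ∷ []) ([] ∷ []) (z≤n ∷ []) ≤-refl
    some-det d (suc e) eq goal done = some-det (suc d) e (trans (sym (+-suc d e)) eq)
      (λ is ap is≤ len → em {∃[ i ] ∃[ j ] (i ≤ Len × j ≤ Len × R (suc d) i j × ¬ R d i j)} λ
        { (yes (i , j , i≤ , j≤ , r , ¬r)) →
            case refine (record { ≈-refl = λ {i} → IsEq.≈-refl (Agree-isEq (V (suc d))) {pt i}
                                ; ≈-sym = IsEq.≈-sym (Agree-isEq (V (suc d))) ; ≈-trans = IsEq.≈-trans (Agree-isEq (V (suc d)))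
                                ; _≈?_ = λ i j → IsEq._≈?_ (Agree-isEq (V (suc d))) (pt i) (pt j) })
                   (agree-⊆ (λ {p} p∈ → V-mono d 1 (subst (λ z → p ∈ V z) (+-comm 1 d) p∈)))
                   (_≤ Len) is ((i , j) ∷ []) ap is≤ ((r , ¬r) ∷ []) ((i≤ , j≤) ∷ []) ([] ∷ [])
            of λ { (vs , apv , vs≤ , _ , lenv) → goal vs apv vs≤ (≤-trans (≤-reflexive (+-comm 1 (suc e))) (≤-trans (+-monoˡ-≤ 1 len) lenv)) }
        ; (no none) → done d (≤-trans (≤-trans (s≤s (m≤m+n d e)) (≤-reflexive (sym (+-suc d e)))) (≤-reflexive eq))
            (λ i j i≤ j≤ r → case IsEq._≈?_ (Agree-isEq (V d)) (pt i) (pt j) of λ { (yes a) → a ; (no ¬a) → ⊥-elim (none (i , j , i≤ , j≤ , r , ¬a)) }) })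
      done

    m≤Q : m ≤ Q
    m≤Q = m≤n+m m _

    Q≤Len : Q ≤ Len
    Q≤Len = ≤-trans (≤-trans (m≤m+n Q L₁) (m≤m+n _ Δ)) (≤-trans (m≤m+n K L₁) (≤-trans (m≤m+n _ Δ) (m≤m+n _ T)))

    -- As `d < m` and each row of `E₀` has two cells at distance `m - 1`, the set `V d` meets every
    -- row. A period of the windows is therefore a period of all rows of the strip.
    strip : ∀ d → d < m → (∀ n → Q ≤ n → n + T ≤ Len → R d n (n + T)) → ⊥
    strip d d<m per = periodic-strip-absurd (back u Len ⊕ (+ K , -ᶻ 1ℤ)) λ x n x≤ n< → zeroΔ x n x≤ (long n n< (≤-trans (s≤s z≤n) d<m))
      where
      zeroΔ : ∀ x n → ∣ x ∣ ≤ L₁ → ∃[ y ] ((y , -ᶻ (+ suc n)) ∈ E₀ × (y +ᶻ + (m ∸ 1) , -ᶻ (+ suc n)) ∈ E₀) →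
        Δ[ τ ] γ (back u Len ⊕ (+ K , -ᶻ 1ℤ) ⊕ (x , -ᶻ (+ n))) ≡ 0ℤ
      zeroΔ x n x≤ (y , p∈ , q∈) = ℤₚ.i≡j⇒i-j≡0 (trans (cong γ loc₁) (trans (cong (+_ ∘ toℕ) (sym (at (per i Q≤i i+T≤) p∈V))) (cong γ (sym loc₀))))
        where
        z : ℤ
        z = x -ᶻ y
        z≤ : ∣ z ∣ ≤ L₁ + Δ
        z≤ = abs-+ x (-ᶻ y) x≤ (abs-neg y (width (∈-++⁺ˡ p∈)))
        i : ℕ
        i = Q + ∣ z +ᶻ + (L₁ + Δ) ∣
        i≡ : + i ≡ + K +ᶻ z
        i≡ = trans (cong (λ w → + Q +ᶻ w) (+∣i+n∣ z (L₁ + Δ) z≤)) (lem (+ Q) z (+ L₁) (+ Δ))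
          where
          lem : ∀ q z l d → q +ᶻ (z +ᶻ (l +ᶻ d)) ≡ q +ᶻ l +ᶻ d +ᶻ z
          lem = solve-∀
        Q≤i : Q ≤ i
        Q≤i = m≤m+n Q _
        i+T≤ : i + T ≤ Len
        i+T≤ = +-monoˡ-≤ T (≤-trans (+-monoʳ-≤ Q (abs-+ z (+ (L₁ + Δ)) z≤ ≤-refl)) (≤-reflexive
          (trans (sym (+-assoc Q (L₁ + Δ) (L₁ + Δ))) (trans (cong (_+ (L₁ + Δ)) (sym (+-assoc Q L₁ Δ))) (sym (+-assoc K L₁ Δ))))))
        p∈V : (y , -ᶻ (+ suc n)) ∈ V d
        p∈V = V-mono d (m ∸ suc d) (⇒V p∈ (subst (_∈ E₀) (pos-≡ (cong (λ w → y +ᶻ + w) (sym (ℕₚ.suc-injective (trans (m+[n∸m]≡n d<m) (sym (ℕₚ.suc-pred m {{ℕ.>-nonZero (≤-trans (s≤s z≤n) d<m)}}))))))  (sym (ℤₚ.+-identityʳ _))) q∈))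
        lem₀ : ∀ b k x y z → z ≡ x -ᶻ y → b +ᶻ k +ᶻ x ≡ b +ᶻ (k +ᶻ z) +ᶻ y
        lem₀ b k x y _ refl = lem b k x y
          where
          lem : ∀ b k x y → b +ᶻ k +ᶻ x ≡ b +ᶻ (k +ᶻ (x -ᶻ y)) +ᶻ y
          lem = solve-∀
        lemy : ∀ b n → b +ᶻ -ᶻ 1ℤ +ᶻ -ᶻ n ≡ b +ᶻ 0ℤ +ᶻ -ᶻ (1ℤ +ᶻ n)
        lemy = solve-∀
        loc₀ : back u Len ⊕ (+ K , -ᶻ 1ℤ) ⊕ (x , -ᶻ (+ n)) ≡ pt i ⊕ (y , -ᶻ (+ suc n))
        loc₀ = pos-≡ (trans (lem₀ (proj₁ (back u Len)) (+ K) x y z refl) (cong (λ w → proj₁ (back u Len) +ᶻ w +ᶻ y) (sym i≡))) (lemy (proj₂ (back u Len)) (+ n))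
        loc₁ : back u Len ⊕ (+ K , -ᶻ 1ℤ) ⊕ (x , -ᶻ (+ n)) ⊕ τ ≡ pt (i + T) ⊕ (y , -ᶻ (+ suc n))
        loc₁ = trans (cong (_⊕ τ) loc₀) (trans (⊕-swap (pt i) _ τ) (cong (_⊕ (y , -ᶻ (+ suc n))) (shift-x (back u Len) (+ i) (+ T))))

    absurd : ⊥
    absurd = some-det 0 m refl (λ is ap is≤ → few-classes is (AllPairs.map (λ n ag → n (R-0 ag 0)) ap) is≤)
      λ d d<m det-d → em {∃[ i ] ∃[ j ] (i < j × j ≤ m × R d i j)} λ
        { (no none) → few-classes (applyUpTo id (suc m))
            (APₚ.applyUpTo⁺₁ id (suc m) (λ {i} {j} i<j j< ag → none (i , j , i<j , ℕ.s≤s⁻¹ j< , R-0 ag d)))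
            (Allₚ.applyUpTo⁺₁ id (suc m) (λ i< → ≤-trans (ℕ.s≤s⁻¹ i<) (≤-trans m≤Q Q≤Len)))
            (≤-reflexive (sym (length-applyUpTo id (suc m))))
        ; (yes (i , j , i<j , j≤m , r)) → strip d d<m (eventually-periodic (R d) (IsEq.≈-refl (Agree-isEq (V d))) (IsEq.≈-trans (Agree-isEq (V d))) Len Q
            (λ i j i< j< r → det-d (suc i) (suc j) i< j< (R-step r)) i j i<j (≤-trans j≤m m≤Q) r) }

  up-det : UpDet c Lup
  up-det u v ag with c u Finₚ.≟ c v
  ... | yes e = e
  ... | no ne = ⊥-elim (threshold unique key-inj N over-below-1 ¬over-below-N
        λ { t (x , y) p∈ k≡ 1≤t nov det → case key-pos {x , y} (subst (1 ≤_) (sym k≡) 1≤t) of λ { refl →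
              Ambiguous.absurd u v ag ne t x p∈ k≡ nov det } })

-- Determinism from the other side of the line

few-codes : {U : Set} {N : ℕ} (f : U → Fin N) (us : List U) → N < length us → ¬ AllPairs (λ u v → ¬ f u ≡ f v) us
few-codes {N = N} f us lt ap = covered-by-few
  (record { ≈-refl = refl ; ≈-sym = sym ; ≈-trans = trans ; _≈?_ = Finₚ._≟_ })
  (allFin N) (map f us) (All.tabulate (λ {x} _ → Any.map sym (∈-allFin x)))
  (subst₂ _<_ (sym (length-tabulate {n = N} id)) (sym (length-map f us)) lt) (APₚ.map⁺ ap)

module _ (T : ℕ) {{_ : NonZero T}} (b : ℕ) (P : ℤ → Set)
  (up : ∀ x → ∣ x ∣ ≤ b → P x → P (x +ᶻ + T)) (down : ∀ x → ∣ x ∣ ≤ b → P (x +ᶻ + T) → P x) where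

  fill : ∀ x₀ → (∀ i → i < T → P (x₀ +ᶻ + i)) → ∀ x → (∣ x₀ ∣ + T) + ((∣ x ∣ + ∣ x₀ ∣) + T) ≤ b → P x
  fill x₀ window x le = subst P (sym x≡) (go q ≤-refl)
    where
    r : ℕ
    r = (x -ᶻ x₀) %ℕ T
    r<T : r < T
    r<T = n%ℕd<d (x -ᶻ x₀) T
    q : ℤ
    q = (x -ᶻ x₀) /ℕ T
    lem₀ : ∀ x x₀ → x ≡ x₀ +ᶻ (x -ᶻ x₀)
    lem₀ = solve-∀
    x≡ : x ≡ x₀ +ᶻ + r +ᶻ q *ᶻ + T
    x≡ = trans (lem₀ x x₀) (trans (cong (x₀ +ᶻ_) (a≡a%ℕn+[a/ℕn]*n (x -ᶻ x₀) T)) (sym (ℤₚ.+-assoc x₀ (+ r) (q *ᶻ + T))))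
    lem₁ : ∀ x x₀ r qT → x ≡ x₀ +ᶻ r +ᶻ qT → qT ≡ x +ᶻ -ᶻ x₀ +ᶻ -ᶻ r
    lem₁ _ x₀ r qT refl = lem x₀ r qT
      where
      lem : ∀ x₀ r qT → qT ≡ x₀ +ᶻ r +ᶻ qT +ᶻ -ᶻ x₀ +ᶻ -ᶻ r
      lem = solve-∀
    qT≤ : ∣ q ∣ * T ≤ (∣ x ∣ + ∣ x₀ ∣) + T
    qT≤ = ≤-trans (≤-reflexive (trans (sym (ℤₚ.abs-* q (+ T))) (cong ∣_∣ (lem₁ x x₀ (+ r) (q *ᶻ + T) x≡))))
            (abs-+ (x +ᶻ -ᶻ x₀) (-ᶻ (+ r)) (abs-+ x (-ᶻ x₀) ≤-refl (abs-neg x₀ ≤-refl)) (abs-neg (+ r) (<⇒≤ r<T)))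
    range : ∀ j → ∣ j ∣ ≤ ∣ q ∣ → ∣ x₀ +ᶻ + r +ᶻ j *ᶻ + T ∣ ≤ b
    range j j≤ = ≤-trans (abs-+ (x₀ +ᶻ + r) (j *ᶻ + T) (abs-+ x₀ (+ r) ≤-refl (<⇒≤ r<T))
                   (≤-trans (≤-reflexive (ℤₚ.abs-* j (+ T))) (≤-trans (*-monoˡ-≤ T j≤) qT≤))) le
    lem₂ : ∀ a n t → a +ᶻ n *ᶻ t +ᶻ t ≡ a +ᶻ (1ℤ +ᶻ n) *ᶻ t
    lem₂ = solve-∀
    lem₃ : ∀ a n t → a +ᶻ -ᶻ (1ℤ +ᶻ n) *ᶻ t +ᶻ t ≡ a +ᶻ -ᶻ n *ᶻ t
    lem₃ = solve-∀
    lem₄ : ∀ a t → a ≡ a +ᶻ 0ℤ *ᶻ t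
    lem₄ = solve-∀
    pos : ∀ n → n ≤ ∣ q ∣ → P (x₀ +ᶻ + r +ᶻ + n *ᶻ + T)
    pos zero _ = subst P (lem₄ (x₀ +ᶻ + r) (+ T)) (window r r<T)
    pos (suc n) n≤ = subst P (lem₂ (x₀ +ᶻ + r) (+ n) (+ T)) (up _ (range (+ n) (<⇒≤ n≤)) (pos n (<⇒≤ n≤)))
    neg : ∀ n → n ≤ ∣ q ∣ → P (x₀ +ᶻ + r +ᶻ -ᶻ (+ n) *ᶻ + T)
    neg zero _ = subst P (lem₄ (x₀ +ᶻ + r) (+ T)) (window r r<T)
    neg (suc n) n≤ = down _ (range -[1+ n ] n≤) (subst P (sym (lem₃ (x₀ +ᶻ + r) (+ n) (+ T))) (neg n (<⇒≤ n≤)))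
    go : ∀ j → ∣ j ∣ ≤ ∣ q ∣ → P (x₀ +ᶻ + r +ᶻ j *ᶻ + T)
    go (+ n) = pos n
    go -[1+ n ] = neg (suc n)

module BalancedSetDown {k : ℕ} (c : Config k) (ur : UniformlyRecurrent c) (np : NonPeriodic c)
  (E₀ E₁ : List Pos) (Δ h m : ℕ) (bal : Balanced c E₀ E₁ Δ h m)
  (F : Form) (supp : map proj₂ F ≡ E₀ ++ E₁) (nz : NonZeroForm F)
  (ann : ∀ t → Annihilates F (Δ[ t ] (LinearRelation.γ c))) where
  open LinearRelation c using (γ)
  open BalancedSet c ur np E₀ E₁ Δ h m bal F supp nz ann

  instance
    T≢0 : NonZero T
    T≢0 = ℕ.>-nonZero T>0

  H : ℕ
  H = suc Lup

  depth : ℤ → ℕ → Pos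
  depth x n = x , -ᶻ (+ n)

  -- The letterwise difference between the views from `v` and from `u` has period `τ` in a box below
  -- them. This is the relation inside whose classes positions are counted; a finite box stands for
  -- the half-plane, so each use costs some of its size.
  record DPer (b : ℕ) (u v : Pos) : Set where
    constructor dper
    field per : ∀ x n → ∣ x ∣ ≤ b → n ≤ b →
                γ (v ⊕ depth x n ⊕ τ) -ᶻ γ (u ⊕ depth x n ⊕ τ) ≡ γ (v ⊕ depth x n) -ᶻ γ (u ⊕ depth x n)
  open DPer

  dper-refl : ∀ {b u} → DPer b u u
  dper-refl {b} {u} = dper λ x n _ _ → trans (ℤₚ.+-inverseʳ (γ (u ⊕ depth x n ⊕ τ))) (sym (ℤₚ.+-inverseʳ (γ (u ⊕ depth x n))))

  At : Pos → Pos → Pos → Set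
  At u v p = c (u ⊕ p) ≡ c (v ⊕ p)

  γ-inj : ∀ {u v} → γ u ≡ γ v → c u ≡ c v
  γ-inj e = Finₚ.toℕ-injective (ℤₚ.+-injective e)

  dper-up : ∀ {b u v} → DPer b u v → ∀ x n → ∣ x ∣ ≤ b → n ≤ b → At u v (depth x n) → At u v (depth x n ⊕ τ)
  dper-up {b} {u} {v} d x n x≤ n≤ e = sym (subst₂ (λ a b → c a ≡ c b) (⊕-assoc v _ τ) (⊕-assoc u _ τ)
    (γ-inj (ℤₚ.i-j≡0⇒i≡j _ _ (trans (per d x n x≤ n≤) (ℤₚ.i≡j⇒i-j≡0 (cong (+_ ∘ toℕ) (sym e)))))))

  dper-down : ∀ {b u v} → DPer b u v → ∀ x n → ∣ x ∣ ≤ b → n ≤ b → At u v (depth x n ⊕ τ) → At u v (depth x n)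
  dper-down {b} {u} {v} d x n x≤ n≤ e = sym (γ-inj (ℤₚ.i-j≡0⇒i≡j _ _ (trans (sym (per d x n x≤ n≤))
    (ℤₚ.i≡j⇒i-j≡0 (cong (+_ ∘ toℕ) (sym (subst₂ (λ a b → c a ≡ c b) (sym (⊕-assoc u _ τ)) (sym (⊕-assoc v _ τ)) e)))))))

  depth-τ : ∀ x n → depth x n ⊕ τ ≡ depth (x +ᶻ + T) n
  depth-τ x n = pos-≡ refl (ℤₚ.+-identityʳ _)

  fill-row : ∀ {b u v} → DPer b u v → ∀ n → n ≤ b → ∀ x₀ → (∀ i → i < T → At u v (depth (x₀ +ᶻ + i) n)) →
    ∀ x → (∣ x₀ ∣ + T) + ((∣ x ∣ + ∣ x₀ ∣) + T) ≤ b → At u v (depth x n)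
  fill-row {b} {u} {v} d n n≤ = fill T b (λ x → At u v (depth x n))
    (λ x x≤ a → subst (At u v) (depth-τ x n) (dper-up d x n x≤ n≤ a))
    (λ x x≤ a → dper-down d x n x≤ n≤ (subst (At u v) (sym (depth-τ x n)) a))

  -- One period `T` in width suffices to fill the rows when the difference is periodic, and `H` rows
  -- suffice to apply `up-det` above them.
  record Str (d : ℕ) (u v : Pos) : Set where
    constructor str
    field on : ∀ i n → i < T → n < H → At u v (depth (+ i) (d + n))
  open Str

  big : ℕ → ℕ
  big ρ = (ρ + T) + ((T + Lup + ρ) + T) + (ρ + H)

  big-depth : ∀ ρ → ρ + H ≤ big ρ
  big-depth ρ = m≤n+m (ρ + H) ((ρ + T) + ((T + Lup + ρ) + T))

  big-fill : ∀ ρ x₀ x → ∣ x₀ ∣ ≤ ρ → ∣ x ∣ ≤ T + Lup → (∣ x₀ ∣ + T) + ((∣ x ∣ + ∣ x₀ ∣) + T) ≤ big ρ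
  big-fill ρ x₀ x x₀≤ x≤ = ≤-trans (+-mono-≤ (+-monoˡ-≤ T x₀≤) (+-monoˡ-≤ T (+-mono-≤ x≤ x₀≤))) (m≤m+n _ (ρ + H))

  -- Periodicity of the difference spreads agreement along the rows of the block, and `up-det` then
  -- gives the row above. Read backwards: positions that differ in their block still differ in all
  -- blocks further down, so moving a family downwards merges no two of its members.
  climb : ∀ {ρ b u v} → DPer b u v → big ρ ≤ b → ∀ d → d ≤ ρ → Str d u v → Str 0 u v
  climb dp le zero _ s = s
  climb {ρ} {b} {u} {v} dp le (suc d) d≤ s = climb dp le d (<⇒≤ d≤) (str rows′)
    where
    above : ∀ i → i < T → Below c Lup (u ⊕ depth (+ i) d) (v ⊕ depth (+ i) d)
    above i i< x n x≤ n< = subst₂ (λ a b → c a ≡ c b) (place u) (place v)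
      (fill-row dp (suc d + n) n≤b 0ℤ (λ j j< → on s j n j< (m≤n⇒m≤1+n n<)) (+ i +ᶻ x)
        (≤-trans (big-fill ρ 0ℤ (+ i +ᶻ x) z≤n (abs-+ (+ i) x (<⇒≤ i<) x≤)) le))
      where
      n≤b : suc d + n ≤ b
      n≤b = ≤-trans (+-mono-≤ d≤ (<⇒≤ (m≤n⇒m≤1+n n<))) (≤-trans (big-depth ρ) le)
      lem : ∀ d n → -ᶻ d +ᶻ -ᶻ (1ℤ +ᶻ n) ≡ -ᶻ (1ℤ +ᶻ d +ᶻ n)
      lem = solve-∀
      place : ∀ w → w ⊕ depth (+ i +ᶻ x) (suc d + n) ≡ w ⊕ depth (+ i) d ⊕ (x , -ᶻ (+ suc n))
      place w = sym (trans (⊕-assoc w _ _) (cong (λ z → w ⊕ (+ i +ᶻ x , z)) (lem (+ d) (+ n))))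
    rows′ : ∀ i n → i < T → n < H → At u v (depth (+ i) (d + n))
    rows′ i zero i< _ = subst (λ z → At u v (depth (+ i) z)) (sym (+-identityʳ d))
      (up-det (u ⊕ depth (+ i) d) (v ⊕ depth (+ i) d) (above i i<))
    rows′ i (suc n) i< n< = subst (λ z → At u v (depth (+ i) z)) (sym (+-suc d n)) (on s i n i< (<⇒≤ n<))

  depth-⊕ : ∀ w x d y n → w ⊕ depth x d ⊕ depth y n ≡ w ⊕ depth (x +ᶻ y) (d + n)
  depth-⊕ w x d y n = trans (⊕-assoc w _ _) (cong (λ z → w ⊕ (x +ᶻ y , z)) (lem (+ d) (+ n)))
    where
    lem : ∀ d n → -ᶻ d +ᶻ -ᶻ n ≡ -ᶻ (d +ᶻ n)
    lem = solve-∀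

  shift-str : ∀ {ρ b u v} → DPer b u v → big ρ ≤ b → ∀ x d → ∣ x ∣ ≤ ρ → d ≤ ρ → Str 0 (u ⊕ depth x d) (v ⊕ depth x d) → Str 0 u v
  shift-str {ρ} {b} {u} {v} dp le x d x≤ d≤ s = climb {ρ} dp le d d≤ (str λ i n i< n< →
    fill-row dp (d + n) (≤-trans (+-mono-≤ d≤ (<⇒≤ n<)) (≤-trans (big-depth ρ) le)) x
      (λ j j< → subst₂ (λ a b → c a ≡ c b) (depth-⊕ u x d (+ j) n) (depth-⊕ v x d (+ j) n) (on s j n j< n<)) (+ i)
      (≤-trans (big-fill ρ x (+ i) x≤ (≤-trans (<⇒≤ i<) (m≤m+n T Lup))) le))

  shift-dper : ∀ {ρ b b′ u v} → DPer b′ u v → b + ρ ≤ b′ → ∀ x d → ∣ x ∣ ≤ ρ → d ≤ ρ → DPer b (u ⊕ depth x d) (v ⊕ depth x d)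
  shift-dper {ρ} {b} {b′} {u} {v} dp le x d x≤ d≤ = dper λ y n y≤ n≤ →
    subst₂ (λ a b → γ (b ⊕ τ) -ᶻ γ (a ⊕ τ) ≡ γ b -ᶻ γ a) (sym (depth-⊕ u x d y n)) (sym (depth-⊕ v x d y n))
      (per dp (x +ᶻ y) (d + n) (≤-trans (abs-+ x y x≤ y≤) (≤-trans (≤-reflexive (+-comm ρ b)) le))
                               (≤-trans (+-mono-≤ d≤ n≤) (≤-trans (≤-reflexive (+-comm ρ b)) le)))

  record Far (b : ℕ) (u v : Pos) : Set where
    constructor far
    field close : DPer b u v
          apart : ¬ Str 0 u v
  open Far

  Has : ℕ → ℕ → Set
  Has b n = ∃[ us ] (AllPairs (Far b) us × n ≤ length us)

  bound : ℕ
  bound = (k ^ T) ^ H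

  code : Pos → Fin bound
  code u = funToFin {H} (λ n → funToFin {T} (λ i → c (u ⊕ depth (+ toℕ i) (toℕ n))))

  ¬has-many : ∀ b → ¬ Has b (suc bound)
  ¬has-many b (us , ap , len) = few-codes code us len (AllPairs.map (λ {u} {v} f e → apart f (str λ i n i< n< →
    subst₂ (λ i n → At u v (depth (+ i) n)) (Finₚ.toℕ-fromℕ< i<) (Finₚ.toℕ-fromℕ< n<)
      (funToFin-injective {T} _ (λ i → c (v ⊕ depth (+ toℕ i) (toℕ (fromℕ< n<))))
        (funToFin-injective {H} (λ n → funToFin {T} (λ i → c (u ⊕ depth (+ toℕ i) (toℕ n)))) (λ n → funToFin {T} (λ i → c (v ⊕ depth (+ toℕ i) (toℕ n)))) e (fromℕ< n<)) (fromℕ< i<)))) ap)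

  -- Shrinking the box from `next-box b` to `b` pays for one recurrence (a shift by at most `ρ₂ b`)
  -- and for the periodic fillings (`big`). Agreement above on a region of size `L₂ b` makes the
  -- difference periodic on a box of size `B₂ b`.
  B₂ B₃ R₂ ρ₂ next-box L₂ : ℕ → ℕ
  B₂ b = big H + (b + H)
  B₃ b = B₂ b + T
  R₂ b = proj₁ (ur (B₃ b))
  ρ₂ b = R₂ b + R₂ b + H
  next-box b = big (ρ₂ b) + (B₂ b + ρ₂ b)
  L₂ b = B₂ b + suc (B₂ b) * C + T + H

  -- The largest size of a family can only drop as the box grows, and it lies between 1 and `bound`.
  -- So it is the same for some `b` and `next-box b`, and a violation of determinism will contradict
  -- that equality.
  stabilise : ∀ n b → ¬ Has b (suc n) → (∀ b n → 1 ≤ n → Has (next-box b) n → ¬ Has b (suc n) → ⊥) → ⊥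
  stabilise zero b nh _ = nh (𝟎 ∷ [] , [] ∷ [] , ≤-refl)
  stabilise (suc n) b nh goal = em λ
    { (yes has) → goal b (suc n) (s≤s z≤n) has nh
    ; (no nh′) → stabilise n (next-box b) nh′ goal }

  -- A pair violating determinism downwards adds one more element to the maximal family.
  module Extend (b : ℕ) (u v : Pos) (agree↑ : Above c (L₂ b) u v) (u≉v : c u ≢ c v) where

    U V : Pos
    U = u ⊕ (0ℤ , + H)
    V = v ⊕ (0ℤ , + H)

    t : Pos
    t = v ⊕ (⊖ u)

    U-t : ∀ p → U ⊕ p ⊕ t ≡ V ⊕ p
    U-t p = trans (⊕-swap U p t) (cong (_⊕ p) (trans (⊕-swap u (0ℤ , + H) t) (cong (_⊕ (0ℤ , + H)) (trans (⊕-comm u t) (⊖-cancel v u)))))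

    H≤L₂ : H ≤ L₂ b
    H≤L₂ = m≤n+m H (B₂ b + suc (B₂ b) * C + T)

    T≤L₂ : T ≤ L₂ b
    T≤L₂ = ≤-trans (m≤n+m T (B₂ b + suc (B₂ b) * C)) (m≤m+n (B₂ b + suc (B₂ b) * C + T) H)

    rows-agree : ∀ x n → ∣ x ∣ ≤ L₂ b → n < H → At U V (depth x n)
    rows-agree x n x≤ n< = subst₂ (λ a b → c a ≡ c b) (place u) (place v)
      (agree↑ x (H ∸ suc n) x≤ (≤-trans (ℕₚ.∸-monoʳ-< (s≤s z≤n) n<) H≤L₂))
      where
      lem : ∀ a b → a +ᶻ b +ᶻ -ᶻ b ≡ a
      lem = solve-∀
      eq : + suc (H ∸ suc n) ≡ + H +ᶻ -ᶻ (+ n)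
      eq = trans (sym (lem (+ suc (H ∸ suc n)) (+ n))) (cong (λ z → + z +ᶻ -ᶻ (+ n)) (trans (sym (+-suc (H ∸ suc n) n)) (m∸n+n≡m n<)))
      place : ∀ w → w ⊕ (x , + suc (H ∸ suc n)) ≡ w ⊕ (0ℤ , + H) ⊕ depth x n
      place w = sym (trans (⊕-assoc w _ _) (cong (w ⊕_) (pos-≡ (ℤₚ.+-identityˡ x) (sym eq))))

    g : Pos → ℤ
    g = Δ[ t ] γ

    h≤H : h ≤ H
    h≤H = ≤-trans (m≤n+m h (Len + (Δ + Δ))) (n≤1+n Lup)

    g-top : ∀ x n → ∣ x ∣ ≤ B₂ b + suc (B₂ b) * C + T → n < h → g (U ⊕ depth x n) ≡ 0ℤ
    g-top x n x≤ n< = ℤₚ.i≡j⇒i-j≡0 (trans (cong γ (U-t (depth x n)))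
      (cong (+_ ∘ toℕ) (sym (rows-agree x n (≤-trans x≤ (m≤m+n _ H)) (≤-trans n< h≤H)))))

    -- `more-rows` is applied not to `γ` but to the difference `g` of the two views: `g` vanishes on
    -- the top rows, so its `τ`-difference starts out zero and remains zero below.
    UV-dper : DPer (B₂ b) U V
    UV-dper = dper λ x n x≤ n≤ → subst₂ (λ a b → γ a -ᶻ γ (U ⊕ depth x n ⊕ τ) ≡ γ b -ᶻ γ (U ⊕ depth x n))
      (trans (⊕-swap (U ⊕ depth x n) τ t) (cong (_⊕ τ) (U-t (depth x n)))) (U-t (depth x n))
      (ℤₚ.i-j≡0⇒i≡j _ _ (more-rows g (λ w → abs-+ (γ (w ⊕ t)) (-ᶻ γ w) (γ≤k _) (abs-neg (γ w) (γ≤k w)))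
        (annihilates-Δ F τ g (ann t)) U (B₂ b) (suc (B₂ b)) topΔ x n x≤ (≤-trans (s≤s n≤) (m≤n+m (suc (B₂ b)) h))))
      where
      topΔ : ∀ x n → ∣ x ∣ ≤ B₂ b + suc (B₂ b) * C → n < h → Δ[ τ ] g (U ⊕ depth x n) ≡ 0ℤ
      topΔ x n x≤ n< = cong₂ _-ᶻ_
        (trans (cong g (trans (⊕-assoc U _ τ) (cong (U ⊕_) (depth-τ x n)))) (g-top (x +ᶻ + T) n (abs-+ x (+ T) x≤ ≤-refl) n<))
        (g-top x n (≤-trans x≤ (m≤m+n _ T)) n<)

    -- The family is moved down to a copy of the surroundings of `U` found below `u₁`, and `v′`,
    -- which is `v` itself, joins it. It differs from the image of `u₁` because `c u ≢ c v`.
    -- Agreement with the image of another `z` would climb to the rows where `V` agrees with `U`,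
    -- hence with the copy at `u₁`, although `u₁` and `z` are apart.
    extend : ∀ us → 1 ≤ length us → AllPairs (Far (next-box b)) us → Has b (suc (length us))
    extend (u₁ ∷ us) _ ap@(u₁-far ∷ _) = v′ ∷ map sh (u₁ ∷ us) ,
      (v′-u₁ ∷ Allₚ.map⁺ {f = sh} (All.map v′-far u₁-far)) ∷ APₚ.map⁺ {f = sh} (AllPairs.map sh-far ap) ,
      s≤s (≤-reflexive (sym (length-map sh (u₁ ∷ us))))
      where
      R : ℕ
      R = R₂ b
      -- The search starts `R` rows below `u₁`, so a copy at distance at most `R` from there does
      -- not lie above `u₁`.
      found : ∃[ o ] (Near R o × (∀ p → Near (B₃ b) p → c (U ⊕ p) ≡ c (u₁ ⊕ (0ℤ , -ᶻ (+ R)) ⊕ o ⊕ p)))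
      found = proj₂ (ur (B₃ b)) U (u₁ ⊕ (0ℤ , -ᶻ (+ R)))
      ox oy : ℤ
      ox = proj₁ (proj₁ found)
      oy = proj₂ (proj₁ found)
      d : ℕ
      d = ∣ -ᶻ oy +ᶻ + R ∣
      d≤ : d ≤ R + R
      d≤ = abs-+ (-ᶻ oy) (+ R) (abs-neg oy (proj₂ (proj₁ (proj₂ found)))) ≤-refl
      lem : ∀ r y → -ᶻ r +ᶻ y ≡ -ᶻ (-ᶻ y +ᶻ r)
      lem = solve-∀
      w : Pos → Pos
      w z = z ⊕ depth ox d
      place : u₁ ⊕ (0ℤ , -ᶻ (+ R)) ⊕ (ox , oy) ≡ w u₁
      place = trans (⊕-assoc u₁ _ _) (cong (u₁ ⊕_) (pos-≡ (ℤₚ.+-identityˡ ox) (trans (lem (+ R) oy) (cong -ᶻ_ (sym (+∣i+n∣ (-ᶻ oy) R (abs-neg oy (proj₂ (proj₁ (proj₂ found))))))))))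
      copy : ∀ p → Near (B₃ b) p → c (U ⊕ p) ≡ c (w u₁ ⊕ p)
      copy p p≤ = trans (proj₂ (proj₂ found) p p≤) (cong (λ z → c (z ⊕ p)) place)
      sh : Pos → Pos
      sh z = z ⊕ depth ox (d + H)
      sh-w : ∀ z → w z ⊕ depth 0ℤ H ≡ sh z
      sh-w z = trans (depth-⊕ z ox d 0ℤ H) (cong (λ x → z ⊕ depth x (d + H)) (ℤₚ.+-identityʳ ox))
      v′ : Pos
      v′ = V ⊕ depth 0ℤ H
      ox≤ : ∣ ox ∣ ≤ ρ₂ b
      ox≤ = ≤-trans (proj₁ (proj₁ (proj₂ found))) (≤-trans (m≤m+n R R) (m≤m+n _ H))
      big≤ : big (ρ₂ b) ≤ next-box b
      big≤ = m≤m+n (big (ρ₂ b)) (B₂ b + ρ₂ b)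
      shift≤ : B₂ b + ρ₂ b ≤ next-box b
      shift≤ = m≤n+m (B₂ b + ρ₂ b) (big (ρ₂ b))
      b≤B₂ : b ≤ B₂ b
      b≤B₂ = ≤-trans (m≤m+n b H) (m≤n+m _ (big H))
      d≤ρ : d ≤ ρ₂ b
      d≤ρ = ≤-trans d≤ (m≤m+n _ H)
      sh-far : ∀ {y z} → Far (next-box b) y z → Far b (sh y) (sh z)
      sh-far f = far (shift-dper (close f) (≤-trans (+-monoˡ-≤ (ρ₂ b) b≤B₂) shift≤) ox (d + H) ox≤ (+-monoˡ-≤ H d≤))
                     (λ s → apart f (shift-str {ρ₂ b} (close f) big≤ ox (d + H) ox≤ (+-monoˡ-≤ H d≤) s))
      Vw-dper : ∀ {z} → DPer (next-box b) u₁ z → DPer (B₂ b) V (w z)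
      Vw-dper {z} dp = dper λ x n x≤ n≤ → combine
          (γ (V ⊕ depth x n ⊕ τ)) (γ (U ⊕ depth x n ⊕ τ)) (γ (w u₁ ⊕ depth x n ⊕ τ)) (γ (w z ⊕ depth x n ⊕ τ))
          (γ (V ⊕ depth x n)) (γ (U ⊕ depth x n)) (γ (w u₁ ⊕ depth x n)) (γ (w z ⊕ depth x n))
          (per UV-dper x n x≤ n≤) (per (shift-dper dp shift≤ ox d ox≤ d≤ρ) x n x≤ n≤)
          (cong (+_ ∘ toℕ) (trans (cong c (trans (⊕-assoc U _ τ) (cong (U ⊕_) (depth-τ x n))))
            (trans (copy (depth (x +ᶻ + T) n) (abs-+ x (+ T) x≤ ≤-refl , ≤-trans (abs-neg (+ n) n≤) (m≤m+n _ T))) (cong c (sym (trans (⊕-assoc (w u₁) _ τ) (cong (w u₁ ⊕_) (depth-τ x n))))))))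
          (cong (+_ ∘ toℕ) (copy (depth x n) (≤-trans x≤ (m≤m+n _ T) , ≤-trans (abs-neg (+ n) n≤) (m≤m+n _ T))))
        where
        lem₁ : ∀ a b c → c -ᶻ a ≡ (c -ᶻ b) -ᶻ (a -ᶻ b)
        lem₁ = solve-∀
        combine : ∀ V′ U′ u′ z′ V U u z → V′ -ᶻ U′ ≡ V -ᶻ U → z′ -ᶻ u′ ≡ z -ᶻ u → U′ ≡ u′ → U ≡ u → z′ -ᶻ V′ ≡ z -ᶻ V
        combine V′ U′ .U′ z′ V U .U z e₁ e₂ refl refl = trans (lem₁ V′ U′ z′) (trans (cong₂ _-ᶻ_ e₂ e₁) (sym (lem₁ V U z)))
      v′w-dper : ∀ {z} → DPer (next-box b) u₁ z → DPer b v′ (sh z)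
      v′w-dper {z} dp = subst (DPer b v′) (sh-w z) (shift-dper (Vw-dper dp) (m≤n+m (b + H) (big H)) 0ℤ H z≤n ≤-refl)
      V-top : Str 0 V (w u₁)
      V-top = str λ i n i< n< → trans (sym (rows-agree (+ i) n (≤-trans (<⇒≤ i<) T≤L₂) n<))
        (copy (depth (+ i) n) (≤-trans (<⇒≤ i<) (m≤n+m T (B₂ b)) , ≤-trans (abs-neg (+ n) (≤-trans (<⇒≤ n<) (≤-trans (m≤n+m H b) (m≤n+m _ (big H))))) (m≤m+n _ T)))
      v′-far : ∀ {z} → Far (next-box b) u₁ z → Far b v′ (sh z)
      v′-far {z} f = far (v′w-dper (close f)) λ s →
        apart f (shift-str {ρ₂ b} (close f) big≤ ox d ox≤ d≤ρ
          (str λ i n i< n< → trans (sym (on V-top i n i< n<))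
            (on (shift-str {H} (Vw-dper (close f)) (m≤m+n (big H) (b + H)) 0ℤ H z≤n ≤-refl (subst (Str 0 v′) (sym (sh-w z)) s)) i n i< n<)))
      home : ∀ z → z ⊕ (0ℤ , + H) ⊕ depth 0ℤ H ⊕ depth (+ 0) 0 ≡ z
      home z = trans (⊕-identityʳ _) (⊕-cancel z (0ℤ , + H))
      v′-u₁ : Far b v′ (sh u₁)
      v′-u₁ = far (v′w-dper dper-refl) λ s → u≉v (sym (trans (cong c (sym (home v))) (trans (on s 0 0 T>0 (s≤s z≤n))
        (trans (cong (λ z → c (z ⊕ depth (+ 0) 0)) (sym (sh-w u₁))) (trans (cong c (⊕-identityʳ _))
          (trans (sym (copy (depth 0ℤ H) (z≤n , ≤-trans (abs-neg (+ H) (≤-trans (m≤n+m H b) (m≤n+m _ (big H)))) (m≤m+n _ T)))) (trans (cong c (sym (⊕-identityʳ _))) (cong c (home u)))))))))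

  down-det : (∀ L → DownDet c L → ⊥) → ⊥
  down-det goal = stabilise bound 0 (¬has-many 0) λ b n 1≤n (us , ap , len) nh → goal (L₂ b) λ u v ag →
    case c u Finₚ.≟ c v of λ
      { (yes e) → e
      ; (no ne) → ⊥-elim (nh (map₂ (map₂ (≤-trans (s≤s len))) (Extend.extend b u v ag ne us (≤-trans 1≤n len) ap))) }

-- Cutting a convex window by rows

updet-mono : ∀ {k} (c : Config k) {L L′} → L ≤ L′ → UpDet c L → UpDet c L′
updet-mono c L≤ ud u v ag = ud u v (λ x n x≤ n< → ag x n (≤-trans x≤ L≤) (≤-trans n< L≤))

downdet-mono : ∀ {k} (c : Config k) {L L′} → L ≤ L′ → DownDet c L → DownDet c L′
downdet-mono c L≤ dd u v ag = dd u v (λ x n x≤ n< → ag x n (≤-trans x≤ L≤) (≤-trans n< L≤))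

BothDet : ∀ {k} → Config k → ℕ → Set
BothDet c L = UpDet c L × DownDet c L

balanced⇒det : ∀ {k} (c : Config k) → UniformlyRecurrent c → NonPeriodic c → ∀ {E₀ E₁ Δ h m} →
  Balanced c E₀ E₁ Δ h m → (∀ L → BothDet c L → ⊥) → ⊥
balanced⇒det c ur np {E₀} {E₁} {Δ} {h} {m} bal goal = LinearRelation.relation c (E₀ ++ E₁) (Balanced.¬over bal)
  λ F supp nz ann → BalancedSetDown.down-det c ur np E₀ E₁ Δ h m bal F supp nz ann λ L dd →
    let Lup = BalancedSet.Lup c ur np E₀ E₁ Δ h m bal F supp nz ann in
    goal (Lup + L) (updet-mono c (m≤m+n Lup L) (BalancedSet.up-det c ur np E₀ E₁ Δ h m bal F supp nz ann) ,
                    downdet-mono c (m≤n+m L Lup) dd)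

over-map : ∀ {k} (c c′ : Config k) (f φ : Pos → Pos) → (∀ u p → c′ (φ u ⊕ f p) ≡ c (u ⊕ p)) →
  ∀ S → Lang.Over c S → Lang.Over c′ (map f S)
over-map c c′ f φ eq S (us , ap , lt) = map φ us ,
  APₚ.map⁺ (AllPairs.map (λ {u} {v} n ag → n (Lang.agree (λ {p} p∈ → trans (sym (eq u p)) (trans (Lang.at ag (∈-map⁺ f p∈)) (eq v p))))) ap) ,
  subst₂ _<_ (sym (length-map f S)) (sym (length-map φ us)) lt

record LinIso : Set where
  field
    to from  : Pos → Pos
    to-⊕     : ∀ p q → to (p ⊕ q) ≡ to p ⊕ to q
    to-from  : ∀ p → to (from p) ≡ p
    from-to  : ∀ p → from (to p) ≡ p
    from-𝟎   : from 𝟎 ≡ 𝟎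
    K        : ℕ
    near-to  : ∀ n p → Near n p → Near (K * n) (to p)
    near-from : ∀ n p → Near n p → Near (K * n) (from p)

module _ {k : ℕ} (c : Config k) (A : LinIso) where
  open LinIso A

  ur-iso : UniformlyRecurrent c → UniformlyRecurrent (c ∘ to)
  ur-iso ur n with ur (K * n)
  ... | R , rec = K * R , λ u v → let o , o≤ , eq = rec (to u) (to v) in
        from o , near-from R o o≤ , λ p p≤ → trans (cong c (to-⊕ u p)) (trans (eq (to p) (near-to n p p≤))
          (sym (cong c (trans (to-⊕ (v ⊕ from o) p) (cong (_⊕ to p) (trans (to-⊕ v (from o)) (cong (to v ⊕_) (to-from o))))))))

  np-iso : NonPeriodic c → NonPeriodic (c ∘ to)
  np-iso np t t≢0 per = np (to t) (λ e → t≢0 (trans (sym (from-to t)) (trans (cong from e) from-𝟎)))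
    (λ v → trans (cong (λ w → c (w ⊕ to t)) (sym (to-from v))) (trans (cong c (sym (to-⊕ (from v) t))) (trans (per (from v)) (cong c (to-from v)))))

flip : LinIso
flip = record
  { to = fl ; from = fl
  ; to-⊕ = λ { (a , b) (c , d) → pos-≡ refl (lem b d) }
  ; to-from = λ { (a , b) → pos-≡ refl (ℤₚ.neg-involutive b) }
  ; from-to = λ { (a , b) → pos-≡ refl (ℤₚ.neg-involutive b) }
  ; from-𝟎 = refl
  ; K = 1
  ; near-to = λ n p → near n p
  ; near-from = λ n p → near n p }
  where
  fl : Pos → Pos
  fl (x , y) = x , -ᶻ y
  lem : ∀ b d → -ᶻ (b +ᶻ d) ≡ -ᶻ b +ᶻ -ᶻ d
  lem = solve-∀
  near : ∀ n p → Near n p → Near (1 * n) (fl p)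
  near n (x , y) (x≤ , y≤) = near-mono {p = x , -ᶻ y} (≤-reflexive (sym (ℕₚ.*-identityˡ n))) (x≤ , abs-neg y y≤)

unique-map : {A B : Set} (f : A → B) (xs : List A) → (∀ {p q} → p ∈ xs → q ∈ xs → f p ≡ f q → p ≡ q) → Unique xs → Unique (map f xs)
unique-map f [] inj [] = []
unique-map f (x ∷ xs) inj (x≢ ∷ u) =
  Allₚ.map⁺ (All.tabulate (λ y∈ e → All.lookup x≢ y∈ (inj (here refl) (there y∈) e))) ∷ unique-map f xs (λ p q → inj (there p) (there q)) u

spread : ∀ m (ns : List ℕ) → Unique ns → suc m ≤ length ns → ∃[ a ] ∃[ b ] (a ∈ ns × b ∈ ns × a + m ≤ b)
spread m ns u len with minimum ns (≤-trans (s≤s z≤n) len)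
  where
  minimum : ∀ ns → 1 ≤ length ns → ∃[ a ] (a ∈ ns × All (a ≤_) ns)
  minimum (n ∷ []) _ = n , here refl , ≤-refl ∷ []
  minimum (n ∷ ns@(_ ∷ _)) _ with minimum ns (s≤s z≤n)
  ... | a , a∈ , a≤ with n ≤? a
  ...   | yes n≤a = n , here refl , ≤-refl ∷ All.map (≤-trans n≤a) a≤
  ...   | no n≰a = a , there a∈ , <⇒≤ (≰⇒> n≰a) ∷ a≤
... | a , a∈ , a≤ with Any.any? (λ b → a + m ≤? b) ns
...   | yes far = let b , b∈ , le = find far in a , b , a∈ , b∈ , le
...   | no none = ⊥-elim (covered-by-few (record { ≈-refl = refl ; ≈-sym = sym ; ≈-trans = trans ; _≈?_ = ℕ._≟_ })
          (applyUpTo (λ i → a + i) m) ns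
          (All.tabulate (λ {b} b∈ → Any.map sym (subst (_∈ applyUpTo (λ i → a + i) m) (m+[n∸m]≡n (All.lookup a≤ b∈))
            (∈-applyUpTo⁺ (λ i → a + i) (small (All.lookup a≤ b∈) (λ le → none (lose b∈ le)))))))
          (subst (_< length ns) (sym (length-applyUpTo (λ i → a + i) m)) len) u)
  where
  small : ∀ {b} → a ≤ b → ¬ a + m ≤ b → b ∸ a < m
  small {b} a≤b n = ℕₚ.+-cancelˡ-< a (b ∸ a) m (subst (_< a + m) (sym (m+[n∸m]≡n a≤b)) (≰⇒> n))

-- `middle` is convexity for lattice sets: a real segment of length `m + 1` contains `m + 1` lattice
-- points, so a row between two rows of `m + 2` cells has at least `m + 1`. The cell lost by
-- rounding is the one that `long` concedes in `Balanced`.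
record Shape (D : List Pos) (Δ : ℕ) : Set where
  field
    uniq   : Unique D
    near   : ∀ {p} → p ∈ D → Near Δ p
    hconv  : ∀ x y i j → (x , y) ∈ D → (x +ᶻ + (i + j) , y) ∈ D → (x +ᶻ + i , y) ∈ D
    middle : ∀ m x x′ y a b → 1 ≤ a → 1 ≤ b →
      (x , y) ∈ D → (x +ᶻ + suc m , y) ∈ D → (x′ , y +ᶻ + (a + b)) ∈ D → (x′ +ᶻ + suc m , y +ᶻ + (a + b)) ∈ D →
      ∃[ z ] ((z , y +ᶻ + a) ∈ D × (z +ᶻ + m , y +ᶻ + a) ∈ D)

-- The vertical coordinate `ψ` is a parameter because the removed row may be the top one, handled by
-- a translation, or the bottom one, handled by a reflection that also changes the configuration.
module Build {k : ℕ} (c c′ : Config k) (D L₀ L₁ : List Pos) (Δ h : ℕ) (shape : Shape D Δ)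
  (ψ ψ⁻ : ℤ → ℤ) (φ φ⁻ : Pos → Pos)
  (ψ⁻ψ : ∀ y → ψ⁻ (ψ y) ≡ y) (ψψ⁻ : ∀ y → ψ (ψ⁻ y) ≡ y)
  (eq₁ : ∀ u x y → c′ (φ u ⊕ (x , ψ y)) ≡ c (u ⊕ (x , y)))
  (eq₂ : ∀ u x y → c (φ⁻ u ⊕ (x , ψ⁻ y)) ≡ c′ (u ⊕ (x , y)))
  (L₀⇒ : ∀ {p} → p ∈ L₀ → p ∈ D × ∃[ n ] (n < h × ψ (proj₂ p) ≡ -ᶻ (+ suc n)))
  (L₁⇒ : ∀ {p} → p ∈ L₁ → p ∈ D × ψ (proj₂ p) ≡ 0ℤ)
  (⇒L₀ : ∀ {p n} → p ∈ D → n < h → ψ (proj₂ p) ≡ -ᶻ (+ suc n) → p ∈ L₀)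
  (⇒L₁ : ∀ {p} → p ∈ D → ψ (proj₂ p) ≡ 0ℤ → p ∈ L₁)
  (uniq₀ : Unique L₀) (uniq₁ : Unique L₁)
  (rows : ∀ m n → length L₁ ≡ suc (suc m) → n < h →
          ∃[ x ] ((x , ψ⁻ (-ᶻ (+ suc n))) ∈ D × (x +ᶻ + m , ψ⁻ (-ᶻ (+ suc n))) ∈ D))
  (over₀ : Lang.Over c L₀) (¬over : ¬ Lang.Over c (L₀ ++ L₁)) where
  open Shape shape

  f f⁻ : Pos → Pos
  f (x , y) = x , ψ y
  f⁻ (x , y) = x , ψ⁻ y

  f-inj : ∀ {p q} → f p ≡ f q → p ≡ q
  f-inj {x , y} {x′ , y′} e = pos-≡ (cong proj₁ e) (trans (sym (ψ⁻ψ y)) (trans (cong (ψ⁻ ∘ proj₂) e) (ψ⁻ψ y′)))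

  mem : ∀ {p} → p ∈ map f L₀ ++ map f L₁ → f⁻ p ∈ L₀ ++ L₁
  mem {p} p∈ with ∈-++⁻ (map f L₀) p∈
  ... | inj₁ q with ∈-map⁻ f q
  ...   | (x , y) , r , refl = ∈-++⁺ˡ (subst (_∈ L₀) (pos-≡ refl (sym (ψ⁻ψ y))) r)
  mem {p} p∈ | inj₂ q with ∈-map⁻ f q
  ...   | (x , y) , r , refl = ∈-++⁺ʳ L₀ (subst (_∈ L₁) (pos-≡ refl (sym (ψ⁻ψ y))) r)

  inD : ∀ {p} → p ∈ L₀ ++ L₁ → p ∈ D
  inD p∈ = [ proj₁ ∘ L₀⇒ , proj₁ ∘ L₁⇒ ]′ (∈-++⁻ L₀ p∈)

  put₀ : ∀ {x n} → n < h → (x , ψ⁻ (-ᶻ (+ suc n))) ∈ D → (x , -ᶻ (+ suc n)) ∈ map f L₀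
  put₀ {x} {n} n< p∈ = subst (λ z → (x , z) ∈ map f L₀) (ψψ⁻ _) (∈-map⁺ f (⇒L₀ p∈ n< (ψψ⁻ _)))

  same-row : ∀ x x′ y → (x , y) ∈ map f L₀ ++ map f L₁ → (x′ , ψ⁻ y) ∈ D → (x′ , y) ∈ map f L₀ ++ map f L₁
  same-row x x′ y p∈ q∈ with ∈-++⁻ L₀ (mem p∈)
  ... | inj₁ r = let _ , n , n< , e = L₀⇒ r in ∈-++⁺ˡ (subst (λ z → (x′ , z) ∈ map f L₀) (ψψ⁻ y) (∈-map⁺ f (⇒L₀ q∈ n< e)))
  ... | inj₂ r = ∈-++⁺ʳ (map f L₀) (subst (λ z → (x′ , z) ∈ map f L₁) (ψψ⁻ y) (∈-map⁺ f (⇒L₁ q∈ (proj₂ (L₁⇒ r)))))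

  ¬over′ : ¬ Lang.Over c′ (map f L₀ ++ map f L₁)
  ¬over′ ov = ¬over (Lang.over-subst c sub len (over-map c′ c f⁻ φ⁻ (λ { u (x , y) → eq₂ u x y }) (map f L₀ ++ map f L₁) ov))
    where
    sub : ∀ {p} → p ∈ map f⁻ (map f L₀ ++ map f L₁) → p ∈ L₀ ++ L₁
    sub p∈ with ∈-map⁻ f⁻ p∈
    ... | q , q∈ , refl = mem q∈
    len : length (L₀ ++ L₁) ≤ length (map f⁻ (map f L₀ ++ map f L₁))
    len = ≤-reflexive (sym (trans (length-map f⁻ (map f L₀ ++ map f L₁)) (trans (length-++ (map f L₀)) (trans (cong₂ _+_ (length-map f L₀) (length-map f L₁)) (sym (length-++ L₀))))))

  balanced : ∃[ m ] Balanced c′ (map f L₀) (map f L₁) Δ h m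
  balanced = of-length (length L₁) refl
   where
   of-length : ∀ l → length L₁ ≡ l → ∃[ m ] Balanced c′ (map f L₀) (map f L₁) Δ h m
   of-length zero eqn = ⊥-elim (¬over (Lang.over-subst c ∈-++⁺ˡ (≤-reflexive (trans (length-++ L₀) (trans (cong (λ z → length L₀ + z) eqn) (+-identityʳ _)))) over₀))
   of-length (suc m) eqn = m , record
     { width = λ p∈ → proj₁ (near (inD (mem p∈)))
     ; lower = λ p∈ → case ∈-map⁻ f p∈ of λ { (q , q∈ , refl) → proj₂ (L₀⇒ q∈) }
     ; top = λ p∈ → case ∈-map⁻ f p∈ of λ { (q , q∈ , refl) → proj₂ (L₁⇒ q∈) }
     ; unique = APₚ.++⁺ (unique-map f L₀ (λ _ _ → f-inj) uniq₀) (unique-map f L₁ (λ _ _ → f-inj) uniq₁)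
         (All.tabulate (λ p∈ → All.tabulate (λ q∈ → disjoint p∈ q∈)))
     ; convex = λ x y i j p∈ q∈ → same-row x (x +ᶻ + i) y p∈ (hconv x (ψ⁻ y) i j (inD (mem p∈)) (inD (mem q∈)))
     ; long = λ n n< 1≤m → long′ m eqn n n< 1≤m
     ; length₁ = trans (length-map f L₁) eqn
     ; over₀ = over-map c c′ f φ (λ { u (x , y) → eq₁ u x y }) L₀ over₀
     ; ¬over = ¬over′ }
     where
     disjoint : ∀ {p q} → p ∈ map f L₀ → q ∈ map f L₁ → p ≢ q
     disjoint p∈ q∈ refl with ∈-map⁻ f p∈ | ∈-map⁻ f q∈
     ... | a , a∈ , e | b , b∈ , e′ = case trans (sym (proj₂ (proj₂ (proj₂ (L₀⇒ a∈))))) (trans (cong proj₂ (trans (sym e) e′)) (proj₂ (L₁⇒ b∈))) of λ ()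
     long′ : ∀ m → length L₁ ≡ suc m → ∀ n → n < h → 1 ≤ m → ∃[ x ] ((x , -ᶻ (+ suc n)) ∈ map f L₀ × (x +ᶻ + (m ∸ 1) , -ᶻ (+ suc n)) ∈ map f L₀)
     long′ (suc m) e n n< _ = let x , p , q = rows m n e n< in x , put₀ n< p , put₀ n< q

module Cut {k : ℕ} (c : Config k) (ur : UniformlyRecurrent c) (np : NonPeriodic c)
  (D : List Pos) (Δ : ℕ) (shape : Shape D Δ) where
  open Lang c
  open Shape shape

  ρ : Pos → ℕ
  ρ (x , y) = ∣ y +ᶻ + Δ ∣

  yρ : ℕ → ℤ
  yρ r = + r -ᶻ + Δ

  y≡ : ∀ {p} → p ∈ D → proj₂ p ≡ yρ (ρ p)
  y≡ {x , y} p∈ = trans (lem y (+ Δ)) (cong (_-ᶻ + Δ) (sym (+∣i+n∣ y Δ (proj₂ (near p∈)))))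
    where
    lem : ∀ y d → y ≡ y +ᶻ d -ᶻ d
    lem = solve-∀

  ρ-yρ : ∀ x r → ρ (x , yρ r) ≡ r
  ρ-yρ x r = cong ∣_∣ (lem (+ r) (+ Δ))
    where
    lem : ∀ r d → r -ᶻ d +ᶻ d ≡ r
    lem = solve-∀

  In : ℕ → ℕ → Pos → Set
  In lo len p = lo ≤ ρ p × ρ p < lo + len

  in? : ∀ lo len p → Dec (In lo len p)
  in? lo len p = (lo ≤? ρ p) ×-dec (ρ p <? lo + len)

  band : ℕ → ℕ → List Pos
  band lo len = filter (in? lo len) D

  row : ℕ → List Pos
  row r = filter (λ p → ρ p ℕ.≟ r) D

  ∈row : ∀ {r p} → p ∈ row r → p ∈ D × ρ p ≡ r
  ∈row {r} = ∈-filter⁻ (λ p → ρ p ℕ.≟ r) {xs = D}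

  ∈band : ∀ {lo len p} → p ∈ band lo len → p ∈ D × In lo len p
  ∈band {lo} {len} = ∈-filter⁻ (in? lo len) {xs = D}

  length-top : ∀ lo len → length (band lo (suc len)) ≡ length (band lo len) + length (row (lo + len))
  length-top lo len = length-filter-⊎ (in? lo len) (λ p → ρ p ℕ.≟ lo + len) (in? lo (suc len))
    (λ { {p} (a , b) → [ (λ lt → inj₁ (a , lt)) , inj₂ ]′ (m≤n⇒m<n∨m≡n (ℕ.s≤s⁻¹ (subst (ρ p <_) (+-suc lo len) b))) })
    (λ { {p} (a , b) → a , subst (ρ p <_) (sym (+-suc lo len)) (m≤n⇒m≤1+n b) })
    (λ e → ≤-trans (m≤m+n lo len) (≤-reflexive (sym e)) , ≤-trans (≤-reflexive (cong suc e)) (≤-reflexive (sym (+-suc lo len))))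
    (λ { (_ , b) e → <-irrefl e b }) D

  length-bottom : ∀ lo len → length (band lo (suc len)) ≡ length (band (suc lo) len) + length (row lo)
  length-bottom lo len = length-filter-⊎ (in? (suc lo) len) (λ p → ρ p ℕ.≟ lo) (in? lo (suc len))
    (λ { {p} (a , b) → [ (λ lt → inj₁ (lt , subst (ρ p <_) (+-suc lo len) b)) , (λ e → inj₂ (sym e)) ]′ (m≤n⇒m<n∨m≡n a) })
    (λ { {p} (a , b) → <⇒≤ a , subst (ρ p <_) (sym (+-suc lo len)) b })
    (λ e → ≤-reflexive (sym e) , ≤-trans (s≤s (≤-trans (≤-reflexive e) (m≤m+n lo len))) (≤-reflexive (sym (+-suc lo len))))
    (λ { (a , _) e → <-irrefl (sym e) a }) D

  -- The shorter of the two extreme rows is removed each time. The row at which the count first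
  -- exceeds the size is thus no longer than the opposite extreme row, and by `middle` every row in
  -- between has at most one cell less than it.
  cut : ∀ len lo → ¬ Over (band lo len) →
    (∀ lo len → ¬ Over (band lo (suc len)) → Over (band lo len) → length (row (lo + len)) ≤ length (row lo) → ⊥) →
    (∀ lo len → ¬ Over (band lo (suc len)) → Over (band (suc lo) len) → length (row lo) ≤ length (row (lo + len)) → ⊥) → ⊥
  cut zero lo nov _ _ = nov (over-subst (λ ()) (≤-reflexive (cong length empty)) over-[])
    where
    empty : band lo 0 ≡ []
    empty = filter-none (in? lo 0) (All.universal (λ { p (a , b) → <⇒≱ (subst (ρ p <_) (+-identityʳ lo) b) a }) D)
  cut (suc len) lo nov topc botc with length (row (lo + len)) ≤? length (row lo)
  ... | yes le = em λ { (yes ov) → topc lo len nov ov le ; (no nov′) → cut len lo nov′ topc botc }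
  ... | no nle = em λ { (yes ov) → botc lo len nov ov (<⇒≤ (≰⇒> nle)) ; (no nov′) → cut len (suc lo) nov′ topc botc }

  private
    x-key : Pos → ℕ
    x-key p = ∣ proj₁ p +ᶻ + Δ ∣

    x≡ : ∀ {p} → p ∈ D → proj₁ p ≡ + x-key p -ᶻ + Δ
    x≡ {x , y} p∈ = trans (lem x (+ Δ)) (cong (_-ᶻ + Δ) (sym (+∣i+n∣ x Δ (proj₁ (near p∈)))))
      where
      lem : ∀ a c → a ≡ a +ᶻ c -ᶻ c
      lem = solve-∀

    x-key-inj : ∀ {r p q} → p ∈ row r → q ∈ row r → x-key p ≡ x-key q → p ≡ q
    x-key-inj p∈ q∈ e =
      let p∈D , ρp = ∈row p∈
          q∈D , ρq = ∈row q∈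
      in pos-≡ (trans (x≡ p∈D) (trans (cong (λ z → + z -ᶻ + Δ) e) (sym (x≡ q∈D))))
               (trans (y≡ p∈D) (trans (cong yρ (trans ρp (sym ρq))) (sym (y≡ q∈D))))

    in-row : ∀ {r p} → p ∈ row r → (+ x-key p -ᶻ + Δ , yρ r) ∈ D
    in-row p∈ = let p∈D , ρp = ∈row p∈ in subst (_∈ D) (pos-≡ (x≡ p∈D) (trans (y≡ p∈D) (cong yρ ρp))) p∈D

    apart : ∀ r m p q → p ∈ row r → q ∈ row r → x-key p + m ≤ x-key q →
      ∃[ x ] ((x , yρ r) ∈ D × (x +ᶻ + m , yρ r) ∈ D)
    apart r m p q p∈ q∈ le = + x-key p -ᶻ + Δ , in-row p∈ ,
      hconv _ (yρ r) m (x-key q ∸ (x-key p + m)) (in-row p∈)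
        (subst (λ z → (z , yρ r) ∈ D) (trans (cong (λ z → + z -ᶻ + Δ) (sym (m+[n∸m]≡n le))) (lem (+ x-key p) (+ m) (+ (x-key q ∸ (x-key p + m))) (+ Δ))) (in-row q∈))
      where
      lem : ∀ a m j d → a +ᶻ m +ᶻ j -ᶻ d ≡ a -ᶻ d +ᶻ (m +ᶻ j)
      lem = solve-∀

  spread-row : ∀ r m → suc m ≤ length (row r) → ∃[ x ] ((x , yρ r) ∈ D × (x +ᶻ + m , yρ r) ∈ D)
  spread-row r m len =
    let a , b , a∈ , b∈ , le = spread m (map x-key (row r)) (unique-map x-key (row r) x-key-inj (APₚ.filter⁺ (λ p → ρ p ℕ.≟ r) uniq))
                                 (≤-trans len (≤-reflexive (sym (length-map x-key (row r)))))
        p , p∈ , ea = ∈-map⁻ x-key a∈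
        q , q∈ , eb = ∈-map⁻ x-key b∈
    in apart r m p q p∈ q∈ (subst₂ (λ a b → a + m ≤ b) ea eb le)

  between : ∀ lo a b m → 1 ≤ a → 1 ≤ b → suc (suc m) ≤ length (row lo) → suc (suc m) ≤ length (row (lo + (a + b))) →
    ∃[ z ] ((z , yρ (lo + a)) ∈ D × (z +ᶻ + m , yρ (lo + a)) ∈ D)
  between lo a b m 1≤a 1≤b l₁ l₂ =
    let x , p , q = spread-row lo (suc m) l₁
        x′ , p′ , q′ = spread-row (lo + (a + b)) (suc m) l₂
        z , r , s = middle m x x′ (yρ lo) a b 1≤a 1≤b p q (move (a + b) p′) (move (a + b) q′)
    in z , back r , back s
    where
    lem : ∀ l a d → l +ᶻ a -ᶻ d ≡ l -ᶻ d +ᶻ a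
    lem = solve-∀
    move : ∀ {z} n → (z , yρ (lo + n)) ∈ D → (z , yρ lo +ᶻ + n) ∈ D
    move {z} n = subst (λ w → (z , w) ∈ D) (lem (+ lo) (+ n) (+ Δ))
    back : ∀ {z} → (z , yρ lo +ᶻ + a) ∈ D → (z , yρ (lo + a)) ∈ D
    back {z} = subst (λ w → (z , w) ∈ D) (sym (lem (+ lo) (+ a) (+ Δ)))

  shorter : ∀ r m → suc (suc m) ≤ length (row r) → ∃[ x ] ((x , yρ r) ∈ D × (x +ᶻ + m , yρ r) ∈ D)
  shorter r m len = spread-row r m (≤-trans (n≤1+n _) len)

  top-case : ∀ lo len → ¬ Over (band lo (suc len)) → Over (band lo len) → length (row (lo + len)) ≤ length (row lo) →
    (∀ L → BothDet c L → ⊥) → ⊥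
  top-case lo len nov ov le goal = balanced⇒det c ur np (proj₂ B.balanced) goal
    where
    J : ℤ
    J = yρ (lo + len)
    lem₁ : ∀ y j → y -ᶻ j +ᶻ j ≡ y
    lem₁ = solve-∀
    lem₂ : ∀ y j → y +ᶻ j -ᶻ j ≡ y
    lem₂ = solve-∀
    lem₃ : ∀ a y j → a +ᶻ j +ᶻ (y -ᶻ j) ≡ a +ᶻ y
    lem₃ = solve-∀
    lem₄ : ∀ a y j → a -ᶻ j +ᶻ (y +ᶻ j) ≡ a +ᶻ y
    lem₄ = solve-∀
    depth : ∀ r n d → r + suc n ≡ lo + len → + r -ᶻ d ≡ -ᶻ (+ suc n) +ᶻ (+ (lo + len) -ᶻ d)
    depth r n d e = trans (lem (+ r) (+ suc n) d) (cong (λ z → -ᶻ (+ suc n) +ᶻ (+ z -ᶻ d)) e)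
      where
      lem : ∀ r n d → r -ᶻ d ≡ -ᶻ n +ᶻ (r +ᶻ n -ᶻ d)
      lem = solve-∀
    depth⁻ : ∀ r n → yρ r -ᶻ J ≡ -ᶻ (+ suc n) → r + suc n ≡ lo + len
    depth⁻ r n e = ℤₚ.+-injective (trans (lem (+ r) (+ suc n) (+ Δ) (+ (lo + len))) (trans (cong (λ z → z +ᶻ (+ (lo + len) +ᶻ + suc n)) e) (lem′ (+ suc n) (+ (lo + len)))))
      where
      lem : ∀ r n d l → r +ᶻ n ≡ r -ᶻ d -ᶻ (l -ᶻ d) +ᶻ (l +ᶻ n)
      lem = solve-∀
      lem′ : ∀ n l → -ᶻ n +ᶻ (l +ᶻ n) ≡ l
      lem′ = solve-∀
    L₀⇒ : ∀ {p} → p ∈ band lo len → p ∈ D × ∃[ n ] (n < len × proj₂ p -ᶻ J ≡ -ᶻ (+ suc n))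
    L₀⇒ {p} p∈ with ∈band p∈
    ... | p∈D , lo≤ , lt with ℕₚ.m≤n⇒∃[o]m+o≡n lt
    ...   | n , e = p∈D , n , ℕₚ.+-cancelˡ-< lo n len (≤-trans (s≤s (+-monoˡ-≤ n lo≤)) (≤-reflexive e)) ,
              trans (cong (_-ᶻ J) (trans (y≡ p∈D) (depth (ρ p) n (+ Δ) (trans (+-suc (ρ p) n) e)))) (lem₂ (-ᶻ (+ suc n)) J)
    L₁⇒ : ∀ {p} → p ∈ row (lo + len) → p ∈ D × proj₂ p -ᶻ J ≡ 0ℤ
    L₁⇒ p∈ = let a , b = ∈row p∈ in a , trans (cong (_-ᶻ J) (trans (y≡ a) (cong yρ b))) (ℤₚ.+-inverseʳ J)
    ⇒L₀ : ∀ {p n} → p ∈ D → n < len → proj₂ p -ᶻ J ≡ -ᶻ (+ suc n) → p ∈ band lo len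
    ⇒L₀ {p} {n} p∈ n< e = ∈-filter⁺ (in? lo len) p∈
      ( ℕₚ.+-cancelʳ-≤ (suc n) lo (ρ p) (≤-trans (+-monoʳ-≤ lo n<) (≤-reflexive (sym e′)))
      , ≤-trans (≤-trans (s≤s (m≤m+n (ρ p) n)) (≤-reflexive (sym (+-suc (ρ p) n)))) (≤-reflexive e′) )
      where
      e′ : ρ p + suc n ≡ lo + len
      e′ = depth⁻ (ρ p) n (trans (cong (_-ᶻ J) (sym (y≡ p∈))) e)
    ⇒L₁ : ∀ {p} → p ∈ D → proj₂ p -ᶻ J ≡ 0ℤ → p ∈ row (lo + len)
    ⇒L₁ {p} p∈ e = ∈-filter⁺ (λ p → ρ p ℕ.≟ lo + len) p∈ (trans (cong (λ z → ρ (proj₁ p , z)) (ℤₚ.i-j≡0⇒i≡j (proj₂ p) J e)) (ρ-yρ (proj₁ p) (lo + len)))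
    rows : ∀ m n → length (row (lo + len)) ≡ suc (suc m) → n < len →
      ∃[ x ] ((x , -ᶻ (+ suc n) +ᶻ J) ∈ D × (x +ᶻ + m , -ᶻ (+ suc n) +ᶻ J) ∈ D)
    rows m n e n< with ℕₚ.m≤n⇒∃[o]m+o≡n n<
    ... | zero , e′ = subst (λ y → ∃[ x ] ((x , y) ∈ D × (x +ᶻ + m , y) ∈ D))
            (depth lo n (+ Δ) (cong (λ z → lo + z) (trans (sym (+-identityʳ (suc n))) e′))) (shorter lo m (≤-trans (≤-reflexive (sym e)) le))
    ... | suc a , e′ = subst (λ y → ∃[ x ] ((x , y) ∈ D × (x +ᶻ + m , y) ∈ D))
            (depth (lo + suc a) n (+ Δ) (trans (+-assoc lo (suc a) (suc n)) (cong (λ z → lo + z) (trans (+-comm (suc a) (suc n)) e′))))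
            (between lo (suc a) (suc n) m (s≤s z≤n) (s≤s z≤n) (≤-trans (≤-reflexive (sym e)) le)
              (≤-reflexive (sym (trans (cong (λ z → length (row (lo + z))) (trans (+-comm (suc a) (suc n)) e′)) e))))
    nov′ : ¬ Over (band lo len ++ row (lo + len))
    nov′ ov′ = nov (over-subst sub (≤-reflexive (trans (length-top lo len) (sym (length-++ (band lo len))))) ov′)
      where
      sub : ∀ {p} → p ∈ band lo len ++ row (lo + len) → p ∈ band lo (suc len)
      sub p∈ with ∈-++⁻ (band lo len) p∈
      ... | inj₁ q = let a , b , d = ∈band q in ∈-filter⁺ (in? lo (suc len)) a (b , ≤-trans d (+-monoʳ-≤ lo (n≤1+n len)))
      ... | inj₂ q = let a , b = ∈row q in ∈-filter⁺ (in? lo (suc len)) a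
              (≤-trans (m≤m+n lo len) (≤-reflexive (sym b)) , ≤-trans (≤-reflexive (cong suc b)) (≤-reflexive (sym (+-suc lo len))))
    eq₁ : ∀ u x y → c (u ⊕ (0ℤ , J) ⊕ (x , y -ᶻ J)) ≡ c (u ⊕ (x , y))
    eq₁ (a , b) x y = cong c (pos-≡ (cong (_+ᶻ x) (ℤₚ.+-identityʳ a)) (lem₃ b y J))
    eq₂ : ∀ u x y → c (u ⊕ (0ℤ , -ᶻ J) ⊕ (x , y +ᶻ J)) ≡ c (u ⊕ (x , y))
    eq₂ (a , b) x y = cong c (pos-≡ (cong (_+ᶻ x) (ℤₚ.+-identityʳ a)) (lem₄ b y J))
    module B = Build c c D (band lo len) (row (lo + len)) Δ len shape (_-ᶻ J) (_+ᶻ J) (_⊕ (0ℤ , J)) (_⊕ (0ℤ , -ᶻ J))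
      (λ y → lem₁ y J) (λ y → lem₂ y J)
      eq₁ eq₂
      L₀⇒ L₁⇒ ⇒L₀ ⇒L₁ (APₚ.filter⁺ (in? lo len) uniq) (APₚ.filter⁺ (λ p → ρ p ℕ.≟ lo + len) uniq) rows ov nov′

  -- Reflection turns the bottom row into a top row; on the way back the two determinisms change
  -- places.
  bottom-case : ∀ lo len → ¬ Over (band lo (suc len)) → Over (band (suc lo) len) → length (row lo) ≤ length (row (lo + len)) →
    (∀ L → BothDet c L → ⊥) → ⊥
  bottom-case lo len nov ov le goal = balanced⇒det c′ (ur-iso c flip ur) (np-iso c flip np) (proj₂ B.balanced)
      (λ { L (ud , dd) → goal L
        ( (λ u v ag → subst₂ (λ a b → c a ≡ c b) (unflip u) (unflip v) (dd (fl u) (fl v) (λ x n x≤ n< → subst₂ (λ a b → c a ≡ c b) (sym (unflip⁺ u x (+ suc n))) (sym (unflip⁺ v x (+ suc n))) (ag x n x≤ n<))))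
        , (λ u v ag → subst₂ (λ a b → c a ≡ c b) (unflip u) (unflip v) (ud (fl u) (fl v) (λ x n x≤ n< → subst₂ (λ a b → c a ≡ c b) (sym (unflip⁻ u x (+ suc n))) (sym (unflip⁻ v x (+ suc n))) (ag x n x≤ n<)))) ) })
    where
    c′ : Config k
    c′ = c ∘ LinIso.to flip
    fl : Pos → Pos
    fl = LinIso.to flip
    unflip : ∀ u → fl (fl u) ≡ u
    unflip = LinIso.to-from flip
    unflip⁺ : ∀ u x y → fl (fl u ⊕ (x , y)) ≡ u ⊕ (x , -ᶻ y)
    unflip⁺ (a , b) x y = pos-≡ refl (lem b y)
      where
      lem : ∀ b y → -ᶻ (-ᶻ b +ᶻ y) ≡ b +ᶻ -ᶻ y
      lem = solve-∀
    unflip⁻ : ∀ u x y → fl (fl u ⊕ (x , -ᶻ y)) ≡ u ⊕ (x , y)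
    unflip⁻ (a , b) x y = pos-≡ refl (lem b y)
      where
      lem : ∀ b y → -ᶻ (-ᶻ b +ᶻ -ᶻ y) ≡ b +ᶻ y
      lem = solve-∀
    J : ℤ
    J = yρ lo
    lem₁ : ∀ y j → j -ᶻ (j -ᶻ y) ≡ y
    lem₁ = solve-∀
    lem₃ : ∀ b y j → -ᶻ (-ᶻ (b +ᶻ j) +ᶻ (j -ᶻ y)) ≡ b +ᶻ y
    lem₃ = solve-∀
    lem₄ : ∀ b y j → -ᶻ b +ᶻ -ᶻ j +ᶻ (j -ᶻ y) ≡ -ᶻ (b +ᶻ y)
    lem₄ = solve-∀
    height : ∀ n → yρ (lo + suc n) ≡ J -ᶻ -ᶻ (+ suc n)
    height n = lem (+ lo) (+ suc n) (+ Δ)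
      where
      lem : ∀ l n d → l +ᶻ n -ᶻ d ≡ l -ᶻ d -ᶻ -ᶻ n
      lem = solve-∀
    height⁻ : ∀ r n → J -ᶻ yρ r ≡ -ᶻ (+ suc n) → r ≡ lo + suc n
    height⁻ r n e = ℤₚ.+-injective (trans (lem (+ r) (+ lo) (+ Δ)) (trans (cong (λ z → + lo -ᶻ z) e) (lem′ (+ lo) (+ suc n))))
      where
      lem : ∀ r l d → r ≡ l -ᶻ (l -ᶻ d -ᶻ (r -ᶻ d))
      lem = solve-∀
      lem′ : ∀ l n → l -ᶻ -ᶻ n ≡ l +ᶻ n
      lem′ = solve-∀
    L₀⇒ : ∀ {p} → p ∈ band (suc lo) len → p ∈ D × ∃[ n ] (n < len × J -ᶻ proj₂ p ≡ -ᶻ (+ suc n))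
    L₀⇒ {p} p∈ with ∈band p∈
    ... | p∈D , lo< , lt with ℕₚ.m≤n⇒∃[o]m+o≡n lo<
    ...   | n , e = p∈D , n , ℕₚ.+-cancelˡ-< (suc lo) n len (≤-trans (s≤s (≤-reflexive e)) lt) ,
              trans (cong (λ z → J -ᶻ z) (trans (y≡ p∈D) (trans (cong yρ (trans (sym e) (sym (+-suc lo n)))) (height n)))) (lem₁ (-ᶻ (+ suc n)) J)
    L₁⇒ : ∀ {p} → p ∈ row lo → p ∈ D × J -ᶻ proj₂ p ≡ 0ℤ
    L₁⇒ p∈ = let a , b = ∈row p∈ in a , trans (cong (λ z → J -ᶻ z) (trans (y≡ a) (cong yρ b))) (ℤₚ.+-inverseʳ J)
    ⇒L₀ : ∀ {p n} → p ∈ D → n < len → J -ᶻ proj₂ p ≡ -ᶻ (+ suc n) → p ∈ band (suc lo) len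
    ⇒L₀ {p} {n} p∈ n< e = ∈-filter⁺ (in? (suc lo) len) p∈
      ( ≤-trans (≤-trans (s≤s (m≤m+n lo n)) (≤-reflexive (sym (+-suc lo n)))) (≤-reflexive (sym e′))
      , ≤-trans (≤-reflexive (cong suc (trans e′ (+-suc lo n)))) (s≤s (≤-trans (≤-reflexive (sym (+-suc lo n))) (+-monoʳ-≤ lo n<))) )
      where
      e′ : ρ p ≡ lo + suc n
      e′ = height⁻ (ρ p) n (trans (cong (λ z → J -ᶻ z) (sym (y≡ p∈))) e)
    ⇒L₁ : ∀ {p} → p ∈ D → J -ᶻ proj₂ p ≡ 0ℤ → p ∈ row lo
    ⇒L₁ {p} p∈ e = ∈-filter⁺ (λ p → ρ p ℕ.≟ lo) p∈ (trans (cong (λ z → ρ (proj₁ p , z)) (sym (ℤₚ.i-j≡0⇒i≡j J (proj₂ p) e))) (ρ-yρ (proj₁ p) lo))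
    rows : ∀ m n → length (row lo) ≡ suc (suc m) → n < len →
      ∃[ x ] ((x , J -ᶻ -ᶻ (+ suc n)) ∈ D × (x +ᶻ + m , J -ᶻ -ᶻ (+ suc n)) ∈ D)
    rows m n e n< with ℕₚ.m≤n⇒∃[o]m+o≡n n<
    ... | zero , e′ = subst (λ y → ∃[ x ] ((x , y) ∈ D × (x +ᶻ + m , y) ∈ D)) (height n)
            (shorter (lo + suc n) m (≤-trans (≤-reflexive (sym e)) (≤-trans le (≤-reflexive (cong (λ z → length (row (lo + z))) (trans (sym e′) (+-identityʳ (suc n))))))))
    ... | suc a , e′ = subst (λ y → ∃[ x ] ((x , y) ∈ D × (x +ᶻ + m , y) ∈ D)) (height n)
            (between lo (suc n) (suc a) m (s≤s z≤n) (s≤s z≤n) (≤-reflexive (sym e))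
              (≤-trans (≤-reflexive (sym e)) (≤-trans le (≤-reflexive (cong (λ z → length (row (lo + z))) (sym e′))))))
    nov′ : ¬ Over (band (suc lo) len ++ row lo)
    nov′ ov′ = nov (over-subst sub (≤-reflexive (trans (length-bottom lo len) (sym (length-++ (band (suc lo) len))))) ov′)
      where
      sub : ∀ {p} → p ∈ band (suc lo) len ++ row lo → p ∈ band lo (suc len)
      sub p∈ with ∈-++⁻ (band (suc lo) len) p∈
      ... | inj₁ q = let a , b , d = ∈band q in ∈-filter⁺ (in? lo (suc len)) a (<⇒≤ b , ≤-trans d (≤-reflexive (sym (+-suc lo len))))
      ... | inj₂ q = let a , b = ∈row q in ∈-filter⁺ (in? lo (suc len)) a
              (≤-reflexive (sym b) , ≤-trans (s≤s (≤-trans (≤-reflexive b) (m≤m+n lo len))) (≤-reflexive (sym (+-suc lo len))))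
    φ φ⁻ : Pos → Pos
    φ (a , b) = a , -ᶻ (b +ᶻ J)
    φ⁻ (a , b) = a , -ᶻ b +ᶻ -ᶻ J
    eq₁ : ∀ u x y → c′ (φ u ⊕ (x , J -ᶻ y)) ≡ c (u ⊕ (x , y))
    eq₁ (a , b) x y = cong c (pos-≡ refl (lem₃ b y J))
    eq₂ : ∀ u x y → c (φ⁻ u ⊕ (x , J -ᶻ y)) ≡ c′ (u ⊕ (x , y))
    eq₂ (a , b) x y = cong c (pos-≡ refl (lem₄ b y J))
    module B = Build c c′ D (band (suc lo) len) (row lo) Δ len shape (λ y → J -ᶻ y) (λ y → J -ᶻ y)
      φ φ⁻ (λ y → lem₁ y J) (λ y → lem₁ y J) eq₁ eq₂
      L₀⇒ L₁⇒ ⇒L₀ ⇒L₁ (APₚ.filter⁺ (in? (suc lo) len) uniq) (APₚ.filter⁺ (λ p → ρ p ℕ.≟ lo) uniq) rows ov nov′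

  both-det : ¬ Over D → (∀ L → BothDet c L → ⊥) → ⊥
  both-det nov goal = cut (suc (Δ + Δ)) 0
    (λ ov → nov (over-subst (proj₁ ∘ ∈band) (≤-reflexive (cong length (sym (filter-all (in? 0 (suc (Δ + Δ)))
      (All.tabulate (λ { {x , y} p∈ → z≤n , s≤s (abs-+ y (+ Δ) (proj₂ (near p∈)) ≤-refl) })))))) ov))
    (λ lo len a b d → top-case lo len a b d goal) (λ lo len a b d → bottom-case lo len a b d goal)

-- Lattice rectangles in unimodular coordinates

0≤+ : ∀ {i j} → 0ℤ ≤ᶻ i → 0ℤ ≤ᶻ j → 0ℤ ≤ᶻ i +ᶻ j
0≤+ = ℤₚ.+-mono-≤

0≤* : ∀ {i j} → 0ℤ ≤ᶻ i → 0ℤ ≤ᶻ j → 0ℤ ≤ᶻ i *ᶻ j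
0≤* {+ m} {+ n} _ _ = subst (0ℤ ≤ᶻ_) (ℤₚ.pos-* m n) (ℤ.+≤+ z≤n)

0≤*-cancel : ∀ n {i} → 0ℤ ≤ᶻ + suc n *ᶻ i → 0ℤ ≤ᶻ i
0≤*-cancel n {+ m} _ = ℤ.+≤+ z≤n

0≤+ℕ : ∀ {n} → 0ℤ ≤ᶻ + n
0≤+ℕ = ℤ.+≤+ z≤n

HalfPlane : Set
HalfPlane = ℤ × ℤ × ℤ

slack : Pos → HalfPlane → ℤ
slack (x , y) (α , β , H) = H -ᶻ (α *ᶻ x +ᶻ β *ᶻ y)

sign-split : ∀ α → 0ℤ ≤ᶻ α ⊎ 0ℤ ≤ᶻ -ᶻ α
sign-split (+ n) = inj₁ 0≤+ℕ
sign-split -[1+ n ] = inj₂ 0≤+ℕ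

slack-between : ∀ x y i j h → 0ℤ ≤ᶻ slack (x , y) h → 0ℤ ≤ᶻ slack (x +ᶻ + (i + j) , y) h → 0ℤ ≤ᶻ slack (x +ᶻ + i , y) h
slack-between x y i j (α , β , H) s₁ s₂ with sign-split α
... | inj₁ α≥ = subst (0ℤ ≤ᶻ_) (lem x y (+ i) (+ j) α β H) (0≤+ s₂ (0≤* α≥ (0≤+ℕ {j})))
  where
  lem : ∀ x y i j α β H → H -ᶻ (α *ᶻ (x +ᶻ (i +ᶻ j)) +ᶻ β *ᶻ y) +ᶻ α *ᶻ j ≡ H -ᶻ (α *ᶻ (x +ᶻ i) +ᶻ β *ᶻ y)
  lem = solve-∀
... | inj₂ α≤ = subst (0ℤ ≤ᶻ_) (lem x y (+ i) α β H) (0≤+ s₁ (0≤* α≤ (0≤+ℕ {i})))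
  where
  lem : ∀ x y i α β H → H -ᶻ (α *ᶻ x +ᶻ β *ᶻ y) +ᶻ -ᶻ α *ᶻ i ≡ H -ᶻ (α *ᶻ (x +ᶻ i) +ᶻ β *ᶻ y)
  lem = solve-∀

-- The cell z is the upper rounding of the point where the segment from (x , y) to (x′ , y + (a + b))
-- crosses the row y + a; r is the rounding error scaled by a + b.
slack-middle : ∀ m x x′ y a b z r N → suc N ≡ a + b → + (a + b) *ᶻ z ≡ + b *ᶻ x +ᶻ + a *ᶻ x′ +ᶻ + r → r ≤ a + b → ∀ h →
  0ℤ ≤ᶻ slack (x , y) h → 0ℤ ≤ᶻ slack (x +ᶻ + suc m , y) h →
  0ℤ ≤ᶻ slack (x′ , y +ᶻ + (a + b)) h → 0ℤ ≤ᶻ slack (x′ +ᶻ + suc m , y +ᶻ + (a + b)) h →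
  0ℤ ≤ᶻ slack (z , y +ᶻ + a) h × 0ℤ ≤ᶻ slack (z +ᶻ + m , y +ᶻ + a) h
slack-middle m x x′ y a b z r N N≡ nz r≤ (α , β , H) s₁ s₂ s₃ s₄ with sign-split α
... | inj₂ α≤ = left , subst (0ℤ ≤ᶻ_) (lem₂ z (y +ᶻ + a) (+ m) α β H) (0≤+ left (0≤* α≤ (0≤+ℕ {m})))
  where
  lem₁ : ∀ x x′ y a b z r α β H → (a +ᶻ b) *ᶻ z ≡ b *ᶻ x +ᶻ a *ᶻ x′ +ᶻ r →
    b *ᶻ (H -ᶻ (α *ᶻ x +ᶻ β *ᶻ y)) +ᶻ a *ᶻ (H -ᶻ (α *ᶻ x′ +ᶻ β *ᶻ (y +ᶻ (a +ᶻ b)))) +ᶻ -ᶻ α *ᶻ r ≡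
    (a +ᶻ b) *ᶻ (H -ᶻ (α *ᶻ z +ᶻ β *ᶻ (y +ᶻ a)))
  lem₁ x x′ y a b z r α β H e = trans (ring₁ x x′ y a b r α β H) (trans (cong (λ w → (a +ᶻ b) *ᶻ (H -ᶻ β *ᶻ (y +ᶻ a)) -ᶻ α *ᶻ w) (sym e)) (ring₂ y a b z α β H))
    where
    ring₁ : ∀ x x′ y a b r α β H → b *ᶻ (H -ᶻ (α *ᶻ x +ᶻ β *ᶻ y)) +ᶻ a *ᶻ (H -ᶻ (α *ᶻ x′ +ᶻ β *ᶻ (y +ᶻ (a +ᶻ b)))) +ᶻ -ᶻ α *ᶻ r ≡
      (a +ᶻ b) *ᶻ (H -ᶻ β *ᶻ (y +ᶻ a)) -ᶻ α *ᶻ (b *ᶻ x +ᶻ a *ᶻ x′ +ᶻ r)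
    ring₁ = solve-∀
    ring₂ : ∀ y a b z α β H → (a +ᶻ b) *ᶻ (H -ᶻ β *ᶻ (y +ᶻ a)) -ᶻ α *ᶻ ((a +ᶻ b) *ᶻ z) ≡ (a +ᶻ b) *ᶻ (H -ᶻ (α *ᶻ z +ᶻ β *ᶻ (y +ᶻ a)))
    ring₂ = solve-∀
  lem₂ : ∀ x y i α β H → H -ᶻ (α *ᶻ x +ᶻ β *ᶻ y) +ᶻ -ᶻ α *ᶻ i ≡ H -ᶻ (α *ᶻ (x +ᶻ i) +ᶻ β *ᶻ y)
  lem₂ = solve-∀
  left : 0ℤ ≤ᶻ slack (z , y +ᶻ + a) (α , β , H)
  left = 0≤*-cancel N (subst (0ℤ ≤ᶻ_) (trans (lem₁ x x′ y (+ a) (+ b) z (+ r) α β H nz) (cong (λ w → + w *ᶻ slack (z , y +ᶻ + a) (α , β , H)) (sym N≡)))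
    (0≤+ (0≤+ (0≤* (0≤+ℕ {b}) s₁) (0≤* (0≤+ℕ {a}) s₃)) (0≤* α≤ (0≤+ℕ {r}))))
... | inj₁ α≥ = subst (0ℤ ≤ᶻ_) (lem₂ z (y +ᶻ + a) (+ m) α β H) (0≤+ right (0≤* α≥ (0≤+ℕ {m}))) , right
  where
  lem₁ : ∀ m x x′ y a b z r s α β H → (a +ᶻ b) *ᶻ z ≡ b *ᶻ x +ᶻ a *ᶻ x′ +ᶻ r → r +ᶻ s ≡ a +ᶻ b →
    b *ᶻ (H -ᶻ (α *ᶻ (x +ᶻ (1ℤ +ᶻ m)) +ᶻ β *ᶻ y)) +ᶻ a *ᶻ (H -ᶻ (α *ᶻ (x′ +ᶻ (1ℤ +ᶻ m)) +ᶻ β *ᶻ (y +ᶻ (a +ᶻ b)))) +ᶻ α *ᶻ s ≡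
    (a +ᶻ b) *ᶻ (H -ᶻ (α *ᶻ (z +ᶻ m) +ᶻ β *ᶻ (y +ᶻ a)))
  lem₁ m x x′ y a b z r s α β H e e′ = trans (ring₁ m x x′ y a b r s α β H)
    (trans (cong₂ (λ w v → (a +ᶻ b) *ᶻ (H -ᶻ β *ᶻ (y +ᶻ a)) -ᶻ α *ᶻ (w +ᶻ (a +ᶻ b) *ᶻ (1ℤ +ᶻ m) -ᶻ v)) (sym e) e′) (ring₂ m y a b z α β H))
    where
    ring₁ : ∀ m x x′ y a b r s α β H → b *ᶻ (H -ᶻ (α *ᶻ (x +ᶻ (1ℤ +ᶻ m)) +ᶻ β *ᶻ y)) +ᶻ a *ᶻ (H -ᶻ (α *ᶻ (x′ +ᶻ (1ℤ +ᶻ m)) +ᶻ β *ᶻ (y +ᶻ (a +ᶻ b)))) +ᶻ α *ᶻ s ≡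
      (a +ᶻ b) *ᶻ (H -ᶻ β *ᶻ (y +ᶻ a)) -ᶻ α *ᶻ (b *ᶻ x +ᶻ a *ᶻ x′ +ᶻ r +ᶻ (a +ᶻ b) *ᶻ (1ℤ +ᶻ m) -ᶻ (r +ᶻ s))
    ring₁ = solve-∀
    ring₂ : ∀ m y a b z α β H → (a +ᶻ b) *ᶻ (H -ᶻ β *ᶻ (y +ᶻ a)) -ᶻ α *ᶻ ((a +ᶻ b) *ᶻ z +ᶻ (a +ᶻ b) *ᶻ (1ℤ +ᶻ m) -ᶻ (a +ᶻ b)) ≡ (a +ᶻ b) *ᶻ (H -ᶻ (α *ᶻ (z +ᶻ m) +ᶻ β *ᶻ (y +ᶻ a)))
    ring₂ = solve-∀
  lem₂ : ∀ x y i α β H → H -ᶻ (α *ᶻ (x +ᶻ i) +ᶻ β *ᶻ y) +ᶻ α *ᶻ i ≡ H -ᶻ (α *ᶻ x +ᶻ β *ᶻ y)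
  lem₂ = solve-∀
  right : 0ℤ ≤ᶻ slack (z +ᶻ + m , y +ᶻ + a) (α , β , H)
  right = 0≤*-cancel N (subst (0ℤ ≤ᶻ_) (trans (lem₁ (+ m) x x′ y (+ a) (+ b) z (+ r) (+ (a + b ∸ r)) α β H nz (cong +_ (m+[n∸m]≡n r≤))) (cong (λ w → + w *ᶻ slack (z +ᶻ + m , y +ᶻ + a) (α , β , H)) (sym N≡)))
    (0≤+ (0≤+ (0≤* (0≤+ℕ {b}) s₂) (0≤* (0≤+ℕ {a}) s₄)) (0≤* α≥ (0≤+ℕ {a + b ∸ r}))))

rect : ℕ → ℕ → List Pos
rect a b = cartesianProduct (applyUpTo +_ a) (applyUpTo +_ b)

length-rect : ∀ a b → length (rect a b) ≡ a * b
length-rect a b = trans (go (applyUpTo +_ a)) (cong₂ _*_ (length-applyUpTo +_ a) (length-applyUpTo +_ b))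
  where
  go : ∀ (xs : List ℤ) → length (cartesianProduct xs (applyUpTo +_ b)) ≡ length xs * length (applyUpTo +_ b)
  go [] = refl
  go (x ∷ xs) = trans (length-++ (map (x ,_) (applyUpTo +_ b))) (cong₂ _+_ (length-map (x ,_) (applyUpTo +_ b)) (go xs))

rect⇒ : ∀ {a b p} → p ∈ rect a b → ∃[ i ] ∃[ j ] (i < a × j < b × p ≡ (+ i , + j))
rect⇒ {a} {b} {x , y} p∈ with ∈-cartesianProduct⁻ (applyUpTo +_ a) (applyUpTo +_ b) p∈
... | x∈ , y∈ with ∈-applyUpTo⁻ +_ x∈ | ∈-applyUpTo⁻ +_ y∈
...   | i , i< , refl | j , j< , refl = i , j , i< , j< , refl

⇒rect : ∀ {a b i j} → i < a → j < b → (+ i , + j) ∈ rect a b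
⇒rect i< j< = ∈-cartesianProduct⁺ (∈-applyUpTo⁺ +_ i<) (∈-applyUpTo⁺ +_ j<)

unique-rect : ∀ a b → Unique (rect a b)
unique-rect a b = Uniqueₚ.cartesianProduct⁺ (uniq a) (uniq b)
  where
  uniq : ∀ n → Unique (applyUpTo +_ n)
  uniq n = APₚ.applyUpTo⁺₁ +_ n (λ i<j _ e → <-irrefl (ℤₚ.+-injective e) i<j)

near-rect : ∀ {a b p} → p ∈ rect a b → Near (a + b) p
near-rect {a} {b} p∈ with rect⇒ {a} {b} p∈
... | i , j , i< , j< , refl = ≤-trans (<⇒≤ i<) (m≤m+n a b) , ≤-trans (<⇒≤ j<) (m≤n+m b a)

InInterval : ℕ → ℤ → Set
InInterval a X = 0ℤ ≤ᶻ X × 0ℤ ≤ᶻ + a -ᶻ 1ℤ -ᶻ X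

interval⇒ : ∀ {a X} → InInterval a X → ∃[ i ] (i < a × X ≡ + i)
interval⇒ {a} {+ i} (_ , le) = i , ≤-trans (m≤m+n (suc i) _) (≤-reflexive (ℤₚ.+-injective
  (trans (cong (λ z → + suc i +ᶻ z) (ℤₚ.0≤i⇒+∣i∣≡i le)) (lem (+ i) (+ a))))) , refl
  where
  lem : ∀ i a → 1ℤ +ᶻ i +ᶻ (a -ᶻ 1ℤ -ᶻ i) ≡ a
  lem = solve-∀

⇒interval : ∀ {a i} → i < a → InInterval a (+ i)
⇒interval {a} {i} i< with ℕₚ.m≤n⇒∃[o]m+o≡n i<
... | o , refl = 0≤+ℕ , subst (0ℤ ≤ᶻ_) (lem (+ i) (+ o)) 0≤+ℕ
  where
  lem : ∀ i o → o ≡ 1ℤ +ᶻ i +ᶻ o -ᶻ 1ℤ -ᶻ i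
  lem = solve-∀

record Unimodular : Set where
  field
    p q p′ q′ : ℤ
    det : p *ᶻ q′ -ᶻ q *ᶻ p′ ≡ 1ℤ

module Coordinates (A : Unimodular) where
  open Unimodular A

  A⁺ A⁻ : Pos → Pos
  A⁺ (x , y) = x *ᶻ p +ᶻ y *ᶻ p′ , x *ᶻ q +ᶻ y *ᶻ q′
  A⁻ (X , Y) = q′ *ᶻ X -ᶻ p′ *ᶻ Y , p *ᶻ Y -ᶻ q *ᶻ X

  size : ℕ
  size = (∣ p ∣ + ∣ q ∣) + (∣ p′ ∣ + ∣ q′ ∣)

  private
    det-scale : ∀ x → (p *ᶻ q′ -ᶻ q *ᶻ p′) *ᶻ x ≡ x
    det-scale x = trans (cong (_*ᶻ x) det) (ℤₚ.*-identityˡ x)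

    abs-* : ∀ {m n} i j → ∣ i ∣ ≤ m → ∣ j ∣ ≤ n → ∣ i *ᶻ j ∣ ≤ n * m
    abs-* {m} {n} i j i≤ j≤ = ≤-trans (≤-reflexive (trans (ℤₚ.abs-* i j) (*-comm ∣ i ∣ ∣ j ∣))) (*-mono-≤ j≤ i≤)

    p≤ : ∣ p ∣ ≤ ∣ p ∣ + ∣ q ∣
    p≤ = m≤m+n _ _
    q≤ : ∣ q ∣ ≤ ∣ p ∣ + ∣ q ∣
    q≤ = m≤n+m _ _
    p′≤ : ∣ p′ ∣ ≤ ∣ p′ ∣ + ∣ q′ ∣
    p′≤ = m≤m+n _ _
    q′≤ : ∣ q′ ∣ ≤ ∣ p′ ∣ + ∣ q′ ∣
    q′≤ = m≤n+m _ _

    combine : ∀ n → (∣ p ∣ + ∣ q ∣) * n + (∣ p′ ∣ + ∣ q′ ∣) * n ≤ size * n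
    combine n = ≤-reflexive (sym (ℕₚ.*-distribʳ-+ n (∣ p ∣ + ∣ q ∣) (∣ p′ ∣ + ∣ q′ ∣)))

  A⁻A⁺ : ∀ v → A⁻ (A⁺ v) ≡ v
  A⁻A⁺ (x , y) = pos-≡ (trans (lem₁ p q p′ q′ x y) (det-scale x)) (trans (lem₂ p q p′ q′ x y) (det-scale y))
    where
    lem₁ : ∀ p q p′ q′ x y → q′ *ᶻ (x *ᶻ p +ᶻ y *ᶻ p′) -ᶻ p′ *ᶻ (x *ᶻ q +ᶻ y *ᶻ q′) ≡ (p *ᶻ q′ -ᶻ q *ᶻ p′) *ᶻ x
    lem₁ = solve-∀
    lem₂ : ∀ p q p′ q′ x y → p *ᶻ (x *ᶻ q +ᶻ y *ᶻ q′) -ᶻ q *ᶻ (x *ᶻ p +ᶻ y *ᶻ p′) ≡ (p *ᶻ q′ -ᶻ q *ᶻ p′) *ᶻ y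
    lem₂ = solve-∀

  A⁺A⁻ : ∀ v → A⁺ (A⁻ v) ≡ v
  A⁺A⁻ (X , Y) = pos-≡ (trans (lem₁ p q p′ q′ X Y) (det-scale X)) (trans (lem₂ p q p′ q′ X Y) (det-scale Y))
    where
    lem₁ : ∀ p q p′ q′ X Y → (q′ *ᶻ X -ᶻ p′ *ᶻ Y) *ᶻ p +ᶻ (p *ᶻ Y -ᶻ q *ᶻ X) *ᶻ p′ ≡ (p *ᶻ q′ -ᶻ q *ᶻ p′) *ᶻ X
    lem₁ = solve-∀
    lem₂ : ∀ p q p′ q′ X Y → (q′ *ᶻ X -ᶻ p′ *ᶻ Y) *ᶻ q +ᶻ (p *ᶻ Y -ᶻ q *ᶻ X) *ᶻ q′ ≡ (p *ᶻ q′ -ᶻ q *ᶻ p′) *ᶻ Y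
    lem₂ = solve-∀

  iso : LinIso
  iso = record
    { to = A⁺ ; from = A⁻
    ; to-⊕ = λ { (a , b) (c , d) → pos-≡ (lem₁ a b c d p p′) (lem₁ a b c d q q′) }
    ; to-from = A⁺A⁻ ; from-to = A⁻A⁺
    ; from-𝟎 = pos-≡ (lem₃ q′ p′) (lem₃ p q)
    ; K = size
    ; near-to = λ { n (x , y) (x≤ , y≤) →
        ≤-trans (abs-+ (x *ᶻ p) (y *ᶻ p′) (abs-* x p x≤ p≤) (abs-* y p′ y≤ p′≤)) (combine n) ,
        ≤-trans (abs-+ (x *ᶻ q) (y *ᶻ q′) (abs-* x q x≤ q≤) (abs-* y q′ y≤ q′≤)) (combine n) }
    ; near-from = λ { n (x , y) (x≤ , y≤) →
        near₁ n (q′ *ᶻ x) (p′ *ᶻ y) {∣ q′ ∣} {∣ p′ ∣} (swap-* q′ x ≤-refl x≤) (swap-* p′ y ≤-refl y≤) q′p′ ,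
        near₁ n (p *ᶻ y) (q *ᶻ x) {∣ p ∣} {∣ q ∣} (swap-* p y ≤-refl y≤) (swap-* q x ≤-refl x≤) pq } }
    where
    lem₁ : ∀ a b c d p p′ → (a +ᶻ c) *ᶻ p +ᶻ (b +ᶻ d) *ᶻ p′ ≡ a *ᶻ p +ᶻ b *ᶻ p′ +ᶻ (c *ᶻ p +ᶻ d *ᶻ p′)
    lem₁ = solve-∀
    lem₃ : ∀ a b → a *ᶻ 0ℤ -ᶻ b *ᶻ 0ℤ ≡ 0ℤ
    lem₃ = solve-∀
    swap-* : ∀ {m n} i j → ∣ i ∣ ≤ m → ∣ j ∣ ≤ n → ∣ i *ᶻ j ∣ ≤ m * n
    swap-* i j i≤ j≤ = ≤-trans (≤-reflexive (ℤₚ.abs-* i j)) (*-mono-≤ i≤ j≤)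
    q′p′ : ∣ q′ ∣ + ∣ p′ ∣ ≤ size
    q′p′ = ≤-trans (≤-reflexive (+-comm ∣ q′ ∣ ∣ p′ ∣)) (m≤n+m _ (∣ p ∣ + ∣ q ∣))
    pq : ∣ p ∣ + ∣ q ∣ ≤ size
    pq = m≤m+n _ (∣ p′ ∣ + ∣ q′ ∣)
    near₁ : ∀ n i j {a b} → ∣ i ∣ ≤ a * n → ∣ j ∣ ≤ b * n → a + b ≤ size → ∣ i -ᶻ j ∣ ≤ size * n
    near₁ n i j {a} {b} i≤ j≤ ab = ≤-trans (abs-+ i (-ᶻ j) i≤ (abs-neg j j≤)) (≤-trans (≤-reflexive (sym (ℕₚ.*-distribʳ-+ n a b))) (*-monoˡ-≤ n ab))

  module _ (a b : ℕ) where

    D : List Pos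
    D = map A⁻ (rect a b)

    -- Written as an intersection of half-planes, the sheared rectangle has its convexity properties
    -- checked for one half-plane at a time.
    sides : List HalfPlane
    sides = (-ᶻ p , -ᶻ p′ , 0ℤ) ∷ (p , p′ , + a -ᶻ 1ℤ) ∷ (-ᶻ q , -ᶻ q′ , 0ℤ) ∷ (q , q′ , + b -ᶻ 1ℤ) ∷ []

    Inside : Pos → Set
    Inside v = All (λ h → 0ℤ ≤ᶻ slack v h) sides

    private
      low : ∀ α β x y → 0ℤ -ᶻ (-ᶻ α *ᶻ x +ᶻ -ᶻ β *ᶻ y) ≡ x *ᶻ α +ᶻ y *ᶻ β
      low = solve-∀
      high : ∀ α β x y H → H -ᶻ (α *ᶻ x +ᶻ β *ᶻ y) ≡ H -ᶻ (x *ᶻ α +ᶻ y *ᶻ β)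
      high = solve-∀

    ∈D⇒ : ∀ {v} → v ∈ D → A⁺ v ∈ rect a b
    ∈D⇒ v∈ with ∈-map⁻ A⁻ v∈
    ... | w , w∈ , refl = subst (_∈ rect a b) (sym (A⁺A⁻ w)) w∈

    ⇒∈D : ∀ {v} → A⁺ v ∈ rect a b → v ∈ D
    ⇒∈D {v} w∈ = subst (_∈ D) (A⁻A⁺ v) (∈-map⁺ A⁻ w∈)

    inside⇒ : ∀ {v} → Inside v → v ∈ D
    inside⇒ {x , y} (s₁ ∷ s₂ ∷ s₃ ∷ s₄ ∷ [])
      with interval⇒ {a} (subst (0ℤ ≤ᶻ_) (low p p′ x y) s₁ , subst (0ℤ ≤ᶻ_) (high p p′ x y (+ a -ᶻ 1ℤ)) s₂)
         | interval⇒ {b} (subst (0ℤ ≤ᶻ_) (low q q′ x y) s₃ , subst (0ℤ ≤ᶻ_) (high q q′ x y (+ b -ᶻ 1ℤ)) s₄)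
    ... | i , i< , ei | j , j< , ej = ⇒∈D (subst (_∈ rect a b) (sym (pos-≡ ei ej)) (⇒rect i< j<))

    ⇒inside : ∀ {v} → v ∈ D → Inside v
    ⇒inside {x , y} v∈ with rect⇒ {a} {b} (∈D⇒ v∈)
    ... | i , j , i< , j< , e with subst (InInterval a) (sym (cong proj₁ e)) (⇒interval i<) | subst (InInterval b) (sym (cong proj₂ e)) (⇒interval j<)
    ...   | l₁ , h₁ | l₂ , h₂ = subst (0ℤ ≤ᶻ_) (sym (low p p′ x y)) l₁ ∷ subst (0ℤ ≤ᶻ_) (sym (high p p′ x y (+ a -ᶻ 1ℤ))) h₁
                              ∷ subst (0ℤ ≤ᶻ_) (sym (low q q′ x y)) l₂ ∷ subst (0ℤ ≤ᶻ_) (sym (high q q′ x y (+ b -ᶻ 1ℤ))) h₂ ∷ []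

    shape : Shape D (size * (a + b))
    shape = record
      { uniq = unique-map A⁻ (rect a b) (λ {v} {w} _ _ e → trans (sym (A⁺A⁻ v)) (trans (cong A⁺ e) (A⁺A⁻ w))) (unique-rect a b)
      ; near = λ {v} v∈ → subst (Near (size * (a + b))) (A⁻A⁺ v) (LinIso.near-from iso (a + b) (A⁺ v) (near-rect {a} {b} (∈D⇒ v∈)))
      ; hconv = λ x y i j p∈ q∈ → inside⇒ (All.zipWith (λ {h} (s , t) → slack-between x y i j h s t) (⇒inside p∈ , ⇒inside q∈))
      ; middle = middle }
      where
      middle : ∀ m x x′ y a₁ b₁ → 1 ≤ a₁ → 1 ≤ b₁ →
        (x , y) ∈ D → (x +ᶻ + suc m , y) ∈ D → (x′ , y +ᶻ + (a₁ + b₁)) ∈ D → (x′ +ᶻ + suc m , y +ᶻ + (a₁ + b₁)) ∈ D →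
        ∃[ z ] ((z , y +ᶻ + a₁) ∈ D × (z +ᶻ + m , y +ᶻ + a₁) ∈ D)
      middle m x x′ y a₁@(suc a₀) b₁ _ _ p₁ p₂ p₃ p₄ = z , inside⇒ (All.map proj₁ both) , inside⇒ (All.map proj₂ both)
        where
        N : ℕ
        N = a₀ + b₁
        ξ : ℤ
        ξ = + b₁ *ᶻ x +ᶻ + a₁ *ᶻ x′
        r : ℕ
        r = (-ᶻ ξ) %ℕ suc N
        -- Negating before and after the division turns its floor into a ceiling.
        z : ℤ
        z = -ᶻ ((-ᶻ ξ) /ℕ suc N)
        lem₁ : ∀ n q r ξ → -ᶻ ξ ≡ r +ᶻ q *ᶻ n → n *ᶻ (-ᶻ q) ≡ ξ +ᶻ r
        lem₁ n q r ξ e = trans (ring₁ n q r ξ (-ᶻ ξ) e) (cong (_+ᶻ r) (ℤₚ.neg-involutive ξ))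
          where
          ring₁ : ∀ n q r ξ w → w ≡ r +ᶻ q *ᶻ n → n *ᶻ (-ᶻ q) ≡ -ᶻ w +ᶻ r
          ring₁ n q r ξ _ refl = ring₂ n q r
            where
            ring₂ : ∀ n q r → n *ᶻ (-ᶻ q) ≡ -ᶻ (r +ᶻ q *ᶻ n) +ᶻ r
            ring₂ = solve-∀
        nz : + (a₁ + b₁) *ᶻ z ≡ ξ +ᶻ + r
        nz = trans (lem₁ (+ suc N) ((-ᶻ ξ) /ℕ suc N) (+ r) ξ (a≡a%ℕn+[a/ℕn]*n (-ᶻ ξ) (suc N))) refl
        both : All (λ h → 0ℤ ≤ᶻ slack (z , y +ᶻ + a₁) h × 0ℤ ≤ᶻ slack (z +ᶻ + m , y +ᶻ + a₁) h) sides
        both = All.zipWith (λ { {h} ((s₁ , s₂) , (s₃ , s₄)) → slack-middle m x x′ y a₁ b₁ z r N refl nz (<⇒≤ (n%ℕd<d (-ᶻ ξ) (suc N))) h s₁ s₂ s₃ s₄ })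
          (All.zip (⇒inside p₁ , ⇒inside p₂) , All.zip (⇒inside p₃ , ⇒inside p₄))

    both-det : ∀ {k} (c : Config k) → UniformlyRecurrent c → NonPeriodic c → ¬ Lang.Over c (rect a b) →
      (∀ L → BothDet (c ∘ A⁺) L → ⊥) → ⊥
    both-det c ur np nov = Cut.both-det (c ∘ A⁺) (ur-iso c iso ur) (np-iso c iso np) D (size * (a + b)) shape
      (λ ov → nov (Lang.over-subst c sub (≤-reflexive (sym (trans (length-map A⁺ D) (length-map A⁻ (rect a b)))))
        (over-map (c ∘ A⁺) c A⁺ A⁺ (λ u v → cong c (sym (LinIso.to-⊕ iso u v))) D ov)))
      where
      sub : ∀ {v} → v ∈ map A⁺ D → v ∈ rect a b
      sub v∈ with ∈-map⁻ A⁺ v∈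
      ... | w , w∈ , refl = ∈D⇒ w∈

-- Unimodular matrices along a given direction

unit-sign : ∀ d → ∃[ e ] (e *ᶻ e ≡ 1ℤ × d ≡ e *ᶻ + ∣ d ∣)
unit-sign (+ n) = 1ℤ , refl , sym (ℤₚ.*-identityˡ (+ n))
unit-sign -[1+ n ] = -ᶻ 1ℤ , refl , lem (+ suc n)
  where
  lem : ∀ n → -ᶻ n ≡ -ᶻ 1ℤ *ᶻ n
  lem = solve-∀

bézoutᶻ : ∀ {g m n} → Bézout.Identity.Identity g m n → ∃[ s ] ∃[ t ] (s *ᶻ + m +ᶻ t *ᶻ + n ≡ + g)
bézoutᶻ {g} {m} {n} (Bézout.Identity.+- x y eq) = + x , -ᶻ (+ y) ,
  trans (cong₂ _+ᶻ_ (trans (sym (ℤₚ.pos-* x m)) (cong +_ (sym eq))) (trans (lem₄ (+ y) (+ n)) (cong -ᶻ_ (sym (ℤₚ.pos-* y n))))) (lem₅ (+ g) (+ (y * n)))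
  where
  lem₄ : ∀ y d → -ᶻ y *ᶻ d ≡ -ᶻ (y *ᶻ d)
  lem₄ = solve-∀
  lem₅ : ∀ g z → g +ᶻ z +ᶻ -ᶻ z ≡ g
  lem₅ = solve-∀
bézoutᶻ {g} {m} {n} (Bézout.Identity.-+ x y eq) = -ᶻ (+ x) , + y ,
  trans (cong₂ _+ᶻ_ (trans (lem₄ (+ x) (+ m)) (cong -ᶻ_ (sym (ℤₚ.pos-* x m)))) (trans (sym (ℤₚ.pos-* y n)) (cong +_ (sym eq)))) (lem₅ (+ g) (+ (x * m)))
  where
  lem₄ : ∀ y d → -ᶻ y *ᶻ d ≡ -ᶻ (y *ᶻ d)
  lem₄ = solve-∀
  lem₅ : ∀ g z → -ᶻ z +ᶻ (g +ᶻ z) ≡ g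
  lem₅ = solve-∀

-- Division by the gcd leaves a primitive vector, and Bézout coefficients of the absolute values
-- complete it to determinant 1. With the signs distributed as below, they enter the determinant
-- only through their squares.
unimodular-along : ∀ d → d ≢ 𝟎 → ∃[ A ] ∃[ g ] (d ≡ (+ suc g *ᶻ Unimodular.p A , + suc g *ᶻ Unimodular.q A))
unimodular-along (d₁ , d₂) d≢0 with gcd ∣ d₁ ∣ ∣ d₂ ∣ in eq-g | gcd[m,n]∣m ∣ d₁ ∣ ∣ d₂ ∣ | gcd[m,n]∣n ∣ d₁ ∣ ∣ d₂ ∣ | Bézout.identity (gcd-GCD ∣ d₁ ∣ ∣ d₂ ∣)
... | zero | _ | _ | _ = ⊥-elim (gcd[m,n]≢0 ∣ d₁ ∣ ∣ d₂ ∣ nonzero eq-g)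
  where
  nonzero : ∣ d₁ ∣ ≢ 0 ⊎ ∣ d₂ ∣ ≢ 0
  nonzero with ∣ d₁ ∣ ℕ.≟ 0 | ∣ d₂ ∣ ℕ.≟ 0
  ... | no ne | _ = inj₁ ne
  ... | _ | no ne = inj₂ ne
  ... | yes e₁ | yes e₂ = ⊥-elim (d≢0 (pos-≡ (ℤₚ.∣i∣≡0⇒i≡0 e₁) (ℤₚ.∣i∣≡0⇒i≡0 e₂)))
... | suc g | divides a e₁ | divides b e₂ | bez with unit-sign d₁ | unit-sign d₂
...   | s₁ , ss₁ , ds₁ | s₂ , ss₂ , ds₂ = record { p = s₁ *ᶻ + a ; q = s₂ *ᶻ + b ; p′ = -ᶻ (s₂ *ᶻ t) ; q′ = s₁ *ᶻ s
                                                ; det = trans (lem₁ s₁ s₂ (+ a) (+ b) s t) (trans (cong₂ (λ x y → x *ᶻ (s *ᶻ + a) +ᶻ y *ᶻ (t *ᶻ + b)) ss₁ ss₂) (trans (lem₂ (s *ᶻ + a) (t *ᶻ + b)) sum≡1)) } ,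
                                       g , pos-≡ (trans ds₁ (scale s₁ a e₁)) (trans ds₂ (scale s₂ b e₂))
  where
  lem₁ : ∀ s₁ s₂ a b s t → s₁ *ᶻ a *ᶻ (s₁ *ᶻ s) -ᶻ s₂ *ᶻ b *ᶻ (-ᶻ (s₂ *ᶻ t)) ≡ s₁ *ᶻ s₁ *ᶻ (s *ᶻ a) +ᶻ s₂ *ᶻ s₂ *ᶻ (t *ᶻ b)
  lem₁ = solve-∀
  lem₂ : ∀ x y → 1ℤ *ᶻ x +ᶻ 1ℤ *ᶻ y ≡ x +ᶻ y
  lem₂ = solve-∀
  lem₃ : ∀ s a g → s *ᶻ (a *ᶻ g) ≡ g *ᶻ (s *ᶻ a)
  lem₃ = solve-∀
  scale : ∀ {n} s a → n ≡ a * suc g → s *ᶻ + n ≡ + suc g *ᶻ (s *ᶻ + a)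
  scale s a refl = trans (cong (s *ᶻ_) (ℤₚ.pos-* a (suc g))) (lem₃ s (+ a) (+ suc g))
  st : ∃[ s ] ∃[ t ] (s *ᶻ + ∣ d₁ ∣ +ᶻ t *ᶻ + ∣ d₂ ∣ ≡ + suc g)
  st = bézoutᶻ bez
  s t : ℤ
  s = proj₁ st
  t = proj₁ (proj₂ st)
  sum≡1 : s *ᶻ + a +ᶻ t *ᶻ + b ≡ 1ℤ
  sum≡1 = ℤₚ.*-cancelʳ-≡ _ _ (+ suc g) (trans (lem₆ s t (+ a) (+ b) (+ suc g)) (trans (cong₂ (λ x y → s *ᶻ x +ᶻ t *ᶻ y) (trans (sym (ℤₚ.pos-* a (suc g))) (cong +_ (sym e₁))) (trans (sym (ℤₚ.pos-* b (suc g))) (cong +_ (sym e₂)))) (trans (proj₂ (proj₂ st)) (sym (ℤₚ.*-identityˡ (+ suc g))))))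
    where
    lem₆ : ∀ s t a b g → (s *ᶻ a +ᶻ t *ᶻ b) *ᶻ g ≡ s *ᶻ (a *ᶻ g) +ᶻ t *ᶻ (b *ᶻ g)
    lem₆ = solve-∀

-- The point of disagreement closest to the origin

sq : Pos → ℕ
sq (x , y) = ∣ x ∣ * ∣ x ∣ + ∣ y ∣ * ∣ y ∣

inner : Pos → Pos → ℤ
inner (a , b) (c , d) = a *ᶻ c +ᶻ b *ᶻ d

+∣i∣² : ∀ i → + (∣ i ∣ * ∣ i ∣) ≡ i *ᶻ i
+∣i∣² (+ n) = ℤₚ.pos-* n n
+∣i∣² -[1+ n ] = refl

+sq : ∀ v → + sq v ≡ inner v v
+sq (x , y) = cong₂ _+ᶻ_ (+∣i∣² x) (+∣i∣² y)

sq-near : ∀ {n} v → Near n v → sq v ≤ n * n + n * n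
sq-near (x , y) (x≤ , y≤) = +-mono-≤ (*-mono-≤ x≤ x≤) (*-mono-≤ y≤ y≤)

i≤+∣i∣ : ∀ i → i ≤ᶻ + ∣ i ∣
i≤+∣i∣ (+ n) = ℤₚ.≤-refl
i≤+∣i∣ -[1+ n ] = ℤ.-≤+

abs⇒0≤n-i : ∀ {n} i → ∣ i ∣ ≤ n → 0ℤ ≤ᶻ + n -ᶻ i
abs⇒0≤n-i i le = ℤₚ.i≤j⇒0≤j-i (ℤₚ.≤-trans (i≤+∣i∣ i) (ℤ.+≤+ le))

≤⇒0≤- : ∀ {m n} → m ≤ n → 0ℤ ≤ᶻ + n -ᶻ + m
≤⇒0≤- {m} le = abs⇒0≤n-i (+ m) le

0≤-w-1⇒w<0 : ∀ {w} → 0ℤ ≤ᶻ -ᶻ w -ᶻ 1ℤ → w <ᶻ 0ℤ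
0≤-w-1⇒w<0 { -[1+ n ]} _ = ℤ.-<+
0≤-w-1⇒w<0 {+ zero} ()
0≤-w-1⇒w<0 {+ suc n} ()

-- Expand `sq (z + v) = sq z + 2 inner v z + sq v`.
closer : ∀ z v → 0ℤ ≤ᶻ -ᶻ inner v z -ᶻ + suc (sq v) → sq (z ⊕ v) < sq z
closer z@(z₁ , z₂) v@(v₁ , v₂) le = ℤₚ.drop‿+<+ (subst₂ _<ᶻ_ (sym expand) (ℤₚ.+-identityʳ (+ sq z)) (ℤₚ.+-monoʳ-< (+ sq z) neg))
  where
  I : ℤ
  I = inner v z
  lem₁ : ∀ i s → -ᶻ i -ᶻ (1ℤ +ᶻ s) +ᶻ (-ᶻ i -ᶻ (1ℤ +ᶻ s)) +ᶻ (1ℤ +ᶻ s) ≡ -ᶻ (i +ᶻ i +ᶻ s) -ᶻ 1ℤ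
  lem₁ = solve-∀
  neg : I +ᶻ I +ᶻ + sq v <ᶻ 0ℤ
  neg = 0≤-w-1⇒w<0 (subst (0ℤ ≤ᶻ_) (lem₁ I (+ sq v)) (0≤+ (0≤+ le le) (0≤+ℕ {suc (sq v)})))
  lem₂ : ∀ a b c d → (a +ᶻ c) *ᶻ (a +ᶻ c) +ᶻ (b +ᶻ d) *ᶻ (b +ᶻ d) ≡ a *ᶻ a +ᶻ b *ᶻ b +ᶻ (c *ᶻ a +ᶻ d *ᶻ b +ᶻ (c *ᶻ a +ᶻ d *ᶻ b) +ᶻ (c *ᶻ c +ᶻ d *ᶻ d))
  lem₂ = solve-∀
  expand : + sq (z ⊕ v) ≡ + sq z +ᶻ (I +ᶻ I +ᶻ + sq v)
  expand = trans (+sq (z ⊕ v)) (trans (lem₂ z₁ z₂ v₁ v₂) (cong₂ (λ a b → a +ᶻ (I +ᶻ I +ᶻ b)) (sym (+sq z)) (sym (+sq v))))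

closest : (P : Pos → Set) → ∀ n z → sq z ≤ n → P z → (∀ z → P z → (∀ p → sq p < sq z → ¬ P p) → ⊥) → ⊥
closest P zero z le Pz goal = goal z Pz (λ p lt _ → <⇒≱ lt (≤-trans le z≤n))
closest P (suc n) z le Pz goal = em {∃[ p ] (sq p < sq z × P p)} λ
  { (yes (p , lt , Pp)) → closest P n p (ℕ.s≤s⁻¹ (≤-trans lt le)) Pp goal
  ; (no none) → goal z Pz (λ p lt Pp → none (p , lt , Pp)) }

module Disc {k : ℕ} (c : Config k) (ur : UniformlyRecurrent c) (np : NonPeriodic c) (a b : ℕ)
  (nov : ¬ Lang.Over c (rect a b)) where
  open Lang c

  -- `K₀` bounds the squared length of a difference `d` of two cells of the rectangle. Once
  -- `inner d z` exceeds `K₀` in absolute value, its sign alone tells which of the steps `d` and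
  -- `- d` from `z` leads closer to the origin.
  Δ₀ K₀ : ℕ
  Δ₀ = (a + b) + (a + b)
  K₀ = Δ₀ * Δ₀ + Δ₀ * Δ₀

  record Closest (u v z : Pos) : Set where
    field
      differ : c (u ⊕ z) ≢ c (v ⊕ z)
      inside : ∀ p → sq p < sq z → c (u ⊕ p) ≡ c (v ⊕ p)
  open Closest

  Good : Pos → ℕ → Set
  Good d r = ∀ u v z → Closest u v z → ¬ Near r z → ∣ inner d z ∣ ≤ K₀ → ⊥

  good-mono : ∀ d {r r′} → r ≤ r′ → Good d r → Good d r′
  good-mono d r≤ g u v z cl far = g u v z cl (λ n → far (near-mono {p = z} r≤ n))

  -- If `z` is far from the origin but nearly orthogonal to `d`, its inner product with the second
  -- basis vector is large. A half-window of size `L` along the line of direction `d` through `z`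
  -- then lies in the disc of agreement, and determinism in these coordinates yields the letter at
  -- `z`.
  module Tie (A : Unimodular) (g : ℕ) (L : ℕ) (det : BothDet (c ∘ Coordinates.A⁺ A) L) where
    open Unimodular A using (p; q; p′; q′) renaming (det to det≡1)
    open Coordinates A

    d : Pos
    d = + suc g *ᶻ p , + suc g *ᶻ q

    -- `M` bounds the squared length of a step in the half-window, and `L * K₀` the drift caused by
    -- its component along `d`. When `Y` exceeds `Y₀` in absolute value, one row towards the origin
    -- outweighs both; otherwise `z` lies within radius `r`.
    M Y₀ r : ℕ
    M = (size * L) * (size * L) + (size * L) * (size * L)
    Y₀ = L * K₀ + M
    r = size * (K₀ + Y₀)

    good : Good d r
    good u v z@(z₁ , z₂) cl far tie = by-size (suc Y₀ ≤? ∣ Y ∣)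
      where
      X Y : ℤ
      X = inner (p , q) z
      Y = inner (p′ , q′) z
      X≤ : ∣ X ∣ ≤ K₀
      X≤ = ≤-trans (≤-trans (m≤m+n ∣ X ∣ (g * ∣ X ∣)) (≤-reflexive (trans (sym (ℤₚ.abs-* (+ suc g) X)) (cong ∣_∣ (lem (+ suc g) p q z₁ z₂))))) tie
        where
        lem : ∀ g p q z₁ z₂ → g *ᶻ (p *ᶻ z₁ +ᶻ q *ᶻ z₂) ≡ g *ᶻ p *ᶻ z₁ +ᶻ g *ᶻ q *ᶻ z₂
        lem = solve-∀
      inner-A : ∀ x y → inner (A⁺ (x , y)) z ≡ x *ᶻ X +ᶻ y *ᶻ Y
      inner-A x y = lem x y p q p′ q′ z₁ z₂
        where
        lem : ∀ x y p q p′ q′ z₁ z₂ → (x *ᶻ p +ᶻ y *ᶻ p′) *ᶻ z₁ +ᶻ (x *ᶻ q +ᶻ y *ᶻ q′) *ᶻ z₂ ≡ x *ᶻ (p *ᶻ z₁ +ᶻ q *ᶻ z₂) +ᶻ y *ᶻ (p′ *ᶻ z₁ +ᶻ q′ *ᶻ z₂)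
        lem = solve-∀
      agree-A : ∀ x n e → e *ᶻ Y ≡ -ᶻ (+ ∣ Y ∣) → e *ᶻ + suc n ≡ + suc n *ᶻ e → ∣ e *ᶻ + suc n ∣ ≤ L → suc Y₀ ≤ ∣ Y ∣ → ∣ x ∣ ≤ L →
        c (u ⊕ z ⊕ A⁺ (x , e *ᶻ + suc n)) ≡ c (v ⊕ z ⊕ A⁺ (x , e *ᶻ + suc n))
      agree-A x n e eY comm e≤ big x≤ = subst₂ (λ s t → c s ≡ c t) (sym (⊕-assoc u z w)) (sym (⊕-assoc v z w)) (inside cl (z ⊕ w) (closer z w
        (subst (0ℤ ≤ᶻ_) (trans (lem (+ n) (+ ∣ Y ∣) (x *ᶻ X) (+ sq w) (+ (L * K₀)) (+ M))
            (cong (λ i → -ᶻ i -ᶻ + suc (sq w)) (sym (trans (inner-A x (e *ᶻ + suc n)) (cong (x *ᶻ X +ᶻ_) (trans (cong (_*ᶻ Y) comm) (trans (ℤₚ.*-assoc (+ suc n) e Y) (cong (+ suc n *ᶻ_) eY))))))))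
          (0≤+ (0≤+ (0≤+ (≤⇒0≤- big) (0≤* (0≤+ℕ {n}) (0≤+ℕ {∣ Y ∣}))) (abs⇒0≤n-i (x *ᶻ X) xX≤)) (≤⇒0≤- sq≤)))))
        where
        w : Pos
        w = A⁺ (x , e *ᶻ + suc n)
        xX≤ : ∣ x *ᶻ X ∣ ≤ L * K₀
        xX≤ = ≤-trans (≤-reflexive (ℤₚ.abs-* x X)) (*-mono-≤ x≤ X≤)
        sq≤ : sq w ≤ M
        sq≤ = sq-near w (LinIso.near-to iso L (x , e *ᶻ + suc n) (x≤ , e≤))
        lem : ∀ n y xX s l m → y -ᶻ (1ℤ +ᶻ (l +ᶻ m)) +ᶻ n *ᶻ y +ᶻ (l -ᶻ xX) +ᶻ (m -ᶻ s) ≡ -ᶻ (xX +ᶻ (1ℤ +ᶻ n) *ᶻ (-ᶻ y)) -ᶻ (1ℤ +ᶻ s)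
        lem = solve-∀
      U V : Pos
      U = A⁻ (u ⊕ z)
      V = A⁻ (v ⊕ z)
      at-A : ∀ s t → c (A⁺ (A⁻ s ⊕ t)) ≡ c (s ⊕ A⁺ t)
      at-A s t = cong c (trans (LinIso.to-⊕ iso (A⁻ s) t) (cong (_⊕ A⁺ t) (A⁺A⁻ s)))
      conclude : c (A⁺ U) ≡ c (A⁺ V) → ⊥
      conclude e = differ cl (trans (cong c (sym (A⁺A⁻ (u ⊕ z)))) (trans e (cong c (A⁺A⁻ (v ⊕ z)))))
      -- The sign of `Y` tells on which side of the line the origin lies, hence which of the two
      -- determinisms applies.
      by-sign : suc Y₀ ≤ ∣ Y ∣ → ∀ Y′ → Y ≡ Y′ → ⊥
      by-sign big (+ y) eq = conclude (proj₁ det U V (λ x n x≤ n< → trans (at-A (u ⊕ z) _) (trans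
        (subst (λ i → c (u ⊕ z ⊕ A⁺ (x , i)) ≡ c (v ⊕ z ⊕ A⁺ (x , i))) (lem₁ (+ suc n))
          (agree-A x n (-ᶻ 1ℤ) (trans (cong (-ᶻ 1ℤ *ᶻ_) eq) (trans (sym (lem₁′ (+ y))) (cong (λ i → -ᶻ (+ ∣ i ∣)) (sym eq)))) (ℤₚ.*-comm (-ᶻ 1ℤ) (+ suc n))
            (≤-trans (≤-reflexive (cong ∣_∣ (lem₁ (+ suc n)))) n<) big x≤)) (sym (at-A (v ⊕ z) _)))))
        where
        lem₁ : ∀ n → -ᶻ 1ℤ *ᶻ n ≡ -ᶻ n
        lem₁ = solve-∀
        lem₁′ : ∀ n → -ᶻ n ≡ -ᶻ 1ℤ *ᶻ n
        lem₁′ = solve-∀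
      by-sign big -[1+ y ] eq = conclude (proj₂ det U V (λ x n x≤ n< → trans (at-A (u ⊕ z) _) (trans
        (subst (λ i → c (u ⊕ z ⊕ A⁺ (x , i)) ≡ c (v ⊕ z ⊕ A⁺ (x , i))) (ℤₚ.*-identityˡ (+ suc n))
          (agree-A x n 1ℤ (trans (ℤₚ.*-identityˡ Y) (trans eq (cong (λ i → -ᶻ (+ ∣ i ∣)) (sym eq)))) (ℤₚ.*-comm 1ℤ (+ suc n))
            (≤-trans (≤-reflexive (cong ∣_∣ (ℤₚ.*-identityˡ (+ suc n)))) n<) big x≤)) (sym (at-A (v ⊕ z) _)))))
      small : ∣ Y ∣ ≤ Y₀ → Near r z
      small Y≤ = subst (Near r) (pos-≡ (trans (lem₁ p q p′ q′ z₁ z₂) (scale z₁)) (trans (lem₂ p q p′ q′ z₁ z₂) (scale z₂)))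
          (bound q′ (-ᶻ q) (≤-trans q′≤ (m≤n+m _ (∣ p ∣ + ∣ q ∣))) (≤-trans (abs-neg q q≤) (m≤m+n _ (∣ p′ ∣ + ∣ q′ ∣))) ,
           bound (-ᶻ p′) p (≤-trans (abs-neg p′ p′≤) (m≤n+m _ (∣ p ∣ + ∣ q ∣))) (≤-trans p≤ (m≤m+n _ (∣ p′ ∣ + ∣ q′ ∣))))
        where
        p≤ : ∣ p ∣ ≤ ∣ p ∣ + ∣ q ∣
        p≤ = m≤m+n _ _
        q≤ : ∣ q ∣ ≤ ∣ p ∣ + ∣ q ∣
        q≤ = m≤n+m _ _
        p′≤ : ∣ p′ ∣ ≤ ∣ p′ ∣ + ∣ q′ ∣
        p′≤ = m≤m+n _ _
        q′≤ : ∣ q′ ∣ ≤ ∣ p′ ∣ + ∣ q′ ∣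
        q′≤ = m≤n+m _ _
        lem₁ : ∀ p q p′ q′ x y → q′ *ᶻ (p *ᶻ x +ᶻ q *ᶻ y) +ᶻ -ᶻ q *ᶻ (p′ *ᶻ x +ᶻ q′ *ᶻ y) ≡ (p *ᶻ q′ -ᶻ q *ᶻ p′) *ᶻ x
        lem₁ = solve-∀
        lem₂ : ∀ p q p′ q′ x y → -ᶻ p′ *ᶻ (p *ᶻ x +ᶻ q *ᶻ y) +ᶻ p *ᶻ (p′ *ᶻ x +ᶻ q′ *ᶻ y) ≡ (p *ᶻ q′ -ᶻ q *ᶻ p′) *ᶻ y
        lem₂ = solve-∀
        scale : ∀ x → (p *ᶻ q′ -ᶻ q *ᶻ p′) *ᶻ x ≡ x
        scale x = trans (cong (_*ᶻ x) det≡1) (ℤₚ.*-identityˡ x)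
        bound : ∀ α β → ∣ α ∣ ≤ size → ∣ β ∣ ≤ size → ∣ α *ᶻ X +ᶻ β *ᶻ Y ∣ ≤ r
        bound α β α≤ β≤ = ≤-trans (abs-+ (α *ᶻ X) (β *ᶻ Y) (≤-trans (≤-reflexive (ℤₚ.abs-* α X)) (*-mono-≤ α≤ X≤)) (≤-trans (≤-reflexive (ℤₚ.abs-* β Y)) (*-mono-≤ β≤ Y≤)))
                            (≤-reflexive (sym (ℕₚ.*-distribˡ-+ size K₀ Y₀)))
      by-size : Dec (suc Y₀ ≤ ∣ Y ∣) → ⊥
      by-size (yes big) = by-sign big Y refl
      by-size (no ¬big) = far (small (≮⇒≥ ¬big))

  good-direction : ∀ d → d ≢ 𝟎 → (∀ r → Good d r → ⊥) → ⊥
  good-direction d d≢0 goal = along (unimodular-along d d≢0)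
    where
    along : ∃[ A ] ∃[ g ] (d ≡ (+ suc g *ᶻ Unimodular.p A , + suc g *ᶻ Unimodular.q A)) → ⊥
    along (A , g , eq) = Coordinates.both-det A a b c ur np nov λ L det →
      goal (Tie.r A g L det) (subst (λ d → Good d (Tie.r A g L det)) (sym eq) (Tie.good A g L det))

  good-directions : ∀ ds → All (_≢ 𝟎) ds → (∀ r → All (λ d → Good d r) ds → ⊥) → ⊥
  good-directions [] [] goal = goal 0 []
  good-directions (d ∷ ds) (d≢0 ∷ ds≢0) goal = good-directions ds ds≢0 λ r gs → good-direction d d≢0 λ r′ g →
    goal (r + r′) (good-mono d (m≤n+m r′ r) g ∷ All.map (λ {e} → good-mono e (m≤m+n r r′)) gs)

  differences : List Pos
  differences = filter (λ d → ¬? (d ≟ᵖ 𝟎)) (map (λ { (s , t) → s ⊕ (⊖ t) }) (cartesianProduct (rect a b) (rect a b)))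

  differences≢0 : All (_≢ 𝟎) differences
  differences≢0 = Allₚ.all-filter (λ d → ¬? (d ≟ᵖ 𝟎)) (map (λ { (s , t) → s ⊕ (⊖ t) }) (cartesianProduct (rect a b) (rect a b)))

  ∈differences : ∀ {s t} → s ∈ rect a b → t ∈ rect a b → s ≢ t → s ⊕ (⊖ t) ∈ differences
  ∈differences {s} {t} s∈ t∈ s≢t = ∈-filter⁺ (λ d → ¬? (d ≟ᵖ 𝟎)) (∈-map⁺ (λ { (s , t) → s ⊕ (⊖ t) }) (∈-cartesianProduct⁺ s∈ t∈))
    (λ e → s≢t (trans (sym (⊖-cancel s t)) (trans (cong (_⊕ t) e) (trans (⊕-comm 𝟎 t) (⊕-identityʳ t)))))

  -- Without ties, z · _ orders the cells of the rectangle, and some cell is determined by the smaller ones.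
  module NoTie (u v z : Pos) (cl : Closest u v z) (no-tie : ∀ {d} → d ∈ differences → K₀ < ∣ inner d z ∣) where

    Off : ℕ
    Off = (a + b) * ∣ proj₁ z ∣ + (a + b) * ∣ proj₂ z ∣

    inner≤ : ∀ {s} → s ∈ rect a b → ∣ inner s z ∣ ≤ Off
    inner≤ {s@(s₁ , s₂)} s∈ = abs-+ (s₁ *ᶻ proj₁ z) (s₂ *ᶻ proj₂ z)
      (≤-trans (≤-reflexive (ℤₚ.abs-* s₁ (proj₁ z))) (*-monoˡ-≤ ∣ proj₁ z ∣ (proj₁ (near-rect {a} {b} s∈))))
      (≤-trans (≤-reflexive (ℤₚ.abs-* s₂ (proj₂ z))) (*-monoˡ-≤ ∣ proj₂ z ∣ (proj₂ (near-rect {a} {b} s∈))))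

    -- Keys start at 1, so that `below 1` is empty and satisfies `Over` through its single pattern.
    key : Pos → ℕ
    key s = suc ∣ inner s z +ᶻ + Off ∣

    open Threshold c key (rect a b)

    +key : ∀ {s} → s ∈ rect a b → + key s ≡ 1ℤ +ᶻ (inner s z +ᶻ + Off)
    +key {s} s∈ = cong (1ℤ +ᶻ_) (+∣i+n∣ (inner s z) Off (inner≤ s∈))

    inner-⊖ : ∀ s t → inner (s ⊕ (⊖ t)) z ≡ inner s z -ᶻ inner t z
    inner-⊖ (s₁ , s₂) (t₁ , t₂) = lem s₁ s₂ t₁ t₂ (proj₁ z) (proj₂ z)
      where
      lem : ∀ s₁ s₂ t₁ t₂ x y → (s₁ +ᶻ -ᶻ t₁) *ᶻ x +ᶻ (s₂ +ᶻ -ᶻ t₂) *ᶻ y ≡ s₁ *ᶻ x +ᶻ s₂ *ᶻ y -ᶻ (t₁ *ᶻ x +ᶻ t₂ *ᶻ y)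
      lem = solve-∀

    diff-key : ∀ {s t} → s ∈ rect a b → t ∈ rect a b → inner (s ⊕ (⊖ t)) z ≡ + key s -ᶻ + key t
    diff-key {s} {t} s∈ t∈ = trans (inner-⊖ s t) (trans (lem (inner s z) (inner t z) (+ Off)) (cong₂ _-ᶻ_ (sym (+key s∈)) (sym (+key t∈))))
      where
      lem : ∀ s t o → s -ᶻ t ≡ 1ℤ +ᶻ (s +ᶻ o) -ᶻ (1ℤ +ᶻ (t +ᶻ o))
      lem = solve-∀

    key-inj : ∀ {s t} → s ∈ rect a b → t ∈ rect a b → 1 ≤ key s → key s ≡ key t → s ≡ t
    key-inj {s} {t} s∈ t∈ _ e with s ≟ᵖ t
    ... | yes s≡t = s≡t
    ... | no s≢t = ⊥-elim (<⇒≱ (no-tie (∈differences s∈ t∈ s≢t)) (≤-trans (≤-reflexive (cong ∣_∣ (trans (diff-key s∈ t∈) (trans (cong (λ n → + n -ᶻ + key t) e) (ℤₚ.+-inverseʳ (+ key t)))))) z≤n))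

    smaller-inside : ∀ {s t} → s ∈ rect a b → t ∈ rect a b → key s < key t → sq (z ⊕ (s ⊕ (⊖ t))) < sq z
    smaller-inside {s} {t} s∈ t∈ lt = closer z d (subst (0ℤ ≤ᶻ_) (cong (_-ᶻ + suc (sq d)) (sym neg)) (≤⇒0≤- (≤-trans (s≤s sq≤) (≤-trans (no-tie (∈differences s∈ t∈ s≢t)) (≤-reflexive abs≡)))))
      where
      d : Pos
      d = s ⊕ (⊖ t)
      s≢t : s ≢ t
      s≢t refl = <-irrefl refl lt
      o : ℕ
      o = key t ∸ key s
      lem : ∀ s o → s -ᶻ (s +ᶻ o) ≡ -ᶻ o
      lem = solve-∀
      inner≡ : inner d z ≡ -ᶻ (+ o)
      inner≡ = trans (diff-key s∈ t∈) (trans (cong (λ n → + key s -ᶻ + n) (sym (m+[n∸m]≡n (<⇒≤ lt)))) (lem (+ key s) (+ o)))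
      neg : -ᶻ inner d z ≡ + o
      neg = trans (cong -ᶻ_ inner≡) (ℤₚ.neg-involutive (+ o))
      abs≡ : ∣ inner d z ∣ ≡ o
      abs≡ = trans (cong ∣_∣ inner≡) (ℤₚ.∣-i∣≡∣i∣ (+ o))
      sq≤ : sq d ≤ K₀
      sq≤ = sq-near d (near-⊕ s (⊖ t) (near-rect {a} {b} s∈) (near-⊖ t (near-rect {a} {b} t∈)))

    absurd : ⊥
    absurd = threshold (unique-rect a b) key-inj (suc (Off + Off))
      (over-subst (λ ()) (≤-reflexive (cong length (filter-none (λ p → key p <? 1) (All.universal (λ { p (s≤s ()) }) (rect a b))))) over-[])
      (λ ov → nov (over-subst (proj₁ ∘ below⇒∈) (≤-reflexive (cong length (sym (filter-all (λ p → key p <? 1 + suc (Off + Off))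
        (All.tabulate (λ {s} s∈ → s≤s (s≤s (abs-+ (inner s z) (+ Off) (inner≤ s∈) ≤-refl)))))))) ov))
      λ t p₀ p₀∈ key≡ _ _ det → differ cl (subst₂ (λ x y → c x ≡ c y) (home u p₀) (home v p₀)
        (det (u ⊕ (z ⊕ (⊖ p₀))) (v ⊕ (z ⊕ (⊖ p₀))) (agree λ {s} s∈ →
          let s∈R , lt = below⇒∈ s∈ in subst₂ (λ x y → c x ≡ c y) (sym (place u p₀ s)) (sym (place v p₀ s))
            (inside cl (z ⊕ (s ⊕ (⊖ p₀))) (smaller-inside s∈R p₀∈ (subst (key s <_) (sym key≡) lt))))))
      where
      home : ∀ w p₀ → w ⊕ (z ⊕ (⊖ p₀)) ⊕ p₀ ≡ w ⊕ z
      home w p₀ = trans (⊕-assoc w _ p₀) (cong (w ⊕_) (⊖-cancel z p₀))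
      place : ∀ w p₀ s → w ⊕ (z ⊕ (⊖ p₀)) ⊕ s ≡ w ⊕ (z ⊕ (s ⊕ (⊖ p₀)))
      place w p₀ s = trans (⊕-assoc w _ s) (cong (w ⊕_) (trans (⊕-assoc z (⊖ p₀) s) (cong (z ⊕_) (⊕-comm (⊖ p₀) s))))

  absurd : ⊥
  absurd = good-directions differences differences≢0 λ r goods → start r goods (ur r)
    where
    start : ∀ r → All (λ d → Good d r) differences → ∃[ R ] (∀ u v → ∃[ o ] (Near R o × (∀ p → Near r p → c (u ⊕ p) ≡ c (v ⊕ o ⊕ p)))) → ⊥
    start r goods (R , rec) = em {∃[ z ] (c (𝟎 ⊕ z) ≢ c (w ⊕ z))} λ
      { (yes (z , ne)) → closest (λ z → c (𝟎 ⊕ z) ≢ c (w ⊕ z)) (sq z) z ≤-refl ne λ z′ ne′ min →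
          let cl = record { differ = ne′ ; inside = λ p lt → decidable-stable (c (𝟎 ⊕ p) Finₚ.≟ c (w ⊕ p)) (min p lt) } in
          case Any.any? (λ d → ∣ inner d z′ ∣ ≤? K₀) differences of λ
            { (yes tie) → let d , d∈ , le = find tie in All.lookup goods d∈ 𝟎 w z′ cl (λ n → ne′ (proj₂ (proj₂ found) z′ n)) le
            ; (no none) → NoTie.absurd 𝟎 w z′ cl (λ d∈ → ≰⇒> (λ le → none (lose d∈ le))) }
      ; (no none) → np w w≢0 (λ v → trans (cong c (⊕-comm v w)) (trans (sym (decidable-stable (c (𝟎 ⊕ v) Finₚ.≟ c (w ⊕ v)) (λ ne → none (v , ne)))) (cong c (trans (⊕-comm 𝟎 v) (⊕-identityʳ v))))) }
      where
      found : ∃[ o ] (Near R o × (∀ p → Near r p → c (𝟎 ⊕ p) ≡ c ((+ suc R , 0ℤ) ⊕ o ⊕ p)))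
      found = rec 𝟎 (+ suc R , 0ℤ)
      -- Starting at distance `R + 1` makes the return vector nonzero. The configuration and its
      -- translate by `w` agree on the ball of radius `r`, so the closest disagreement lies outside
      -- it, in the range of `goods`.
      w : Pos
      w = (+ suc R , 0ℤ) ⊕ proj₁ found
      w≢0 : w ≢ 𝟎
      w≢0 e = <⇒≱ ≤-refl (≤-trans (≤-reflexive (trans (sym (ℤₚ.∣-i∣≡∣i∣ (+ suc R))) (cong ∣_∣ (lem (+ suc R) (proj₁ (proj₁ found)) (cong proj₁ e))))) (proj₁ (proj₁ (proj₂ found))))
        where
        lem : ∀ r o → r +ᶻ o ≡ 0ℤ → -ᶻ r ≡ o
        lem r o e = trans (sym (trans (cong (-ᶻ r +ᶻ_) e) (ℤₚ.+-identityʳ _))) (lem₂ r o)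
          where
          lem₂ : ∀ r o → -ᶻ r +ᶻ (r +ᶻ o) ≡ o
          lem₂ = solve-∀

rectangle-complexity : ∀ {k} (c : Config k) → UniformlyRecurrent c → NonPeriodic c → ∀ a b → ¬ ¬ Lang.Over c (rect a b)
rectangle-complexity c ur np a b = Disc.absurd c ur np a b

-- Recurrence of the patterns of a substitution

[m+kn]/n : ∀ m k n .{{_ : NonZero n}} → (m + k * n) / n ≡ m / n + k
[m+kn]/n m k n = trans (+-distrib-/-∣ʳ m (n∣m*n k)) (cong (λ z → m / n + z) (m*n/n≡m k n))

n<m^n : ∀ {m} → 2 ≤ m → ∀ n → n < m ^ n
n<m^n 2≤m zero = s≤s z≤n
n<m^n {m} 2≤m (suc n) = ≤-trans (+-mono-≤ (≤-trans (s≤s z≤n) (n<m^n 2≤m n)) (n<m^n 2≤m n))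
  (≤-trans (≤-reflexive (cong (λ z → m ^ n + z) (sym (+-identityʳ (m ^ n))))) (*-monoˡ-≤ (m ^ n) 2≤m))

module Substitutive {k M : ℕ} {{M≢0 : NonZero M}} (σ : Substitution k M) where

  letter : Fin k → ℕ → ℕ → Fin k
  letter a x y = σ a (fromℕ< (m%n<n x M)) (fromℕ< (m%n<n y M))

  letter-cong : ∀ a {x x′ y y′} → x % M ≡ x′ % M → y % M ≡ y′ % M → letter a x y ≡ letter a x′ y′
  letter-cong a {x} {x′} {y} {y′} ex ey =
    cong₂ (σ a) (Finₚ.fromℕ<-cong _ _ ex (m%n<n x M) (m%n<n x′ M)) (Finₚ.fromℕ<-cong _ _ ey (m%n<n y M) (m%n<n y′ M))

  quot rem : ℕ → ℕ → ℕ
  quot x m = _/_ x (M ^ m) {{ℕₚ.m^n≢0 M m}}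
  rem x m = _%_ x (M ^ m) {{ℕₚ.m^n≢0 M m}}

  quot-rem : ∀ x m → x ≡ rem x m + quot x m * M ^ m
  quot-rem x m = m≡m%n+[m/n]*n x (M ^ m) {{ℕₚ.m^n≢0 M m}}

  rem< : ∀ x m → rem x m < M ^ m
  rem< x m = m%n<n x (M ^ m) {{ℕₚ.m^n≢0 M m}}

  quot< : ∀ {x n} m → x < n * M ^ m → quot x m < n
  quot< m = m<n*o⇒m/o<n {{ℕₚ.m^n≢0 M m}}

  iter-block : ∀ m t a X Y x y → x < M ^ m → y < M ^ m →
    iter σ (m + t) a (x + X * M ^ m) (y + Y * M ^ m) ≡ iter σ m (iter σ t a X Y) x y
  iter-block zero t a X Y zero zero _ _ = cong₂ (iter σ t a) (ℕₚ.*-identityʳ X) (ℕₚ.*-identityʳ Y)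
  iter-block zero t a X Y (suc x) y (s≤s ()) _
  iter-block zero t a X Y zero (suc y) _ (s≤s ())
  iter-block (suc m) t a X Y x y x< y< =
    trans (letter-cong _ (mod x X) (mod y Y))
      (cong (λ b → letter b x y) (trans (cong₂ (iter σ (m + t) a) (quo x X) (quo y Y))
        (iter-block m t a X Y (x / M) (y / M) (small x x<) (small y y<))))
    where
    shape : ∀ X → X * M ^ suc m ≡ X * M ^ m * M
    shape X = trans (cong (X *_) (*-comm M (M ^ m))) (sym (*-assoc X (M ^ m) M))
    mod : ∀ x X → (x + X * M ^ suc m) % M ≡ x % M
    mod x X = trans (cong (λ z → (x + z) % M) (shape X)) ([m+kn]%n≡m%n x (X * M ^ m) M)
    quo : ∀ x X → (x + X * M ^ suc m) / M ≡ x / M + X * M ^ m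
    quo x X = trans (cong (λ z → (x + z) / M) (shape X)) ([m+kn]/n x (X * M ^ m) M)
    small : ∀ x → x < M ^ suc m → x / M < M ^ m
    small x x< = m<n*o⇒m/o<n (subst (x <_) (*-comm M (M ^ m)) x<)

  BoxIn : Config k → Set
  BoxIn c = ∀ n u → ∃[ a ] ∃[ i ] ∃[ x₀ ] ∃[ y₀ ] (x₀ + suc n ≤ M ^ i × y₀ + suc n ≤ M ^ i ×
    (∀ x y → x < suc n → y < suc n → c (u ⊕ (+ x , + y)) ≡ iter σ i a (x₀ + x) (y₀ + y)))

  inX⇒boxIn : ∀ c → InX σ c → BoxIn c
  inX⇒boxIn c inX n u = go (inX (pat (rect (suc n) (suc n)) (λ v → c (u ⊕ v))) (⊖ u , λ {v} _ → cong c (flipped v)))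
    where
    lem : ∀ u v → u +ᶻ v ≡ v -ᶻ (-ᶻ u)
    lem = solve-∀
    flipped : ∀ v → u ⊕ v ≡ v -ᵥ (⊖ u)
    flipped (v₁ , v₂) = pos-≡ (lem (proj₁ u) v₁) (lem (proj₂ u) v₂)
    go : ∃[ a ] ∃[ i ] AppearsInIter σ (pat (rect (suc n) (suc n)) (λ v → c (u ⊕ v))) i a → _
    go (a , i , (w₁ , w₂) , find-at) = a , i , x₀ , y₀ , bound , bound′ , values
      where
      At : ℕ → ℕ → Set
      At x y = ∃[ X ] ∃[ Y ] ((+ x , + y) -ᵥ (w₁ , w₂) ≡ (+ X , + Y) × X < M ^ i × Y < M ^ i × c (u ⊕ (+ x , + y)) ≡ iter σ i a X Y)
      at : ∀ {x y} → x < suc n → y < suc n → At x y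
      at x< y< = find-at (⇒rect x< y<)
      origin : At 0 0
      origin = at (s≤s z≤n) (s≤s z≤n)
      x₀ y₀ : ℕ
      x₀ = proj₁ origin
      y₀ = proj₁ (proj₂ origin)
      e₀ : (+ 0 , + 0) -ᵥ (w₁ , w₂) ≡ (+ x₀ , + y₀)
      e₀ = proj₁ (proj₂ (proj₂ origin))
      shift : ∀ x X w x₀ → + x -ᶻ w ≡ + X → + 0 -ᶻ w ≡ + x₀ → X ≡ x₀ + x
      shift x X w x₀ e e′ = ℤₚ.+-injective (trans (sym e) (trans (lem₂ (+ x) w) (cong (_+ᶻ + x) e′)))
        where
        lem₂ : ∀ x w → x -ᶻ w ≡ + 0 -ᶻ w +ᶻ x
        lem₂ = solve-∀
      values : ∀ x y → x < suc n → y < suc n → c (u ⊕ (+ x , + y)) ≡ iter σ i a (x₀ + x) (y₀ + y)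
      values x y x< y< = let X , Y , e , _ , _ , v = at x< y< in
        trans v (cong₂ (iter σ i a) (shift x X w₁ x₀ (cong proj₁ e) (cong proj₁ e₀)) (shift y Y w₂ y₀ (cong proj₂ e) (cong proj₂ e₀)))
      bound : x₀ + suc n ≤ M ^ i
      bound = let X , Y , e , X< , _ , _ = at {n} {n} ≤-refl ≤-refl in
        ≤-trans (≤-reflexive (trans (+-suc x₀ n) (cong suc (sym (shift n X w₁ x₀ (cong proj₁ e) (cong proj₁ e₀)))))) X<
      bound′ : y₀ + suc n ≤ M ^ i
      bound′ = let X , Y , e , _ , Y< , _ = at {n} {n} ≤-refl ≤-refl in
        ≤-trans (≤-reflexive (trans (+-suc y₀ n) (cong suc (sym (shift n Y w₂ y₀ (cong proj₂ e) (cong proj₂ e₀)))))) Y<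

  -- A window of side 2 must fit into a square of side `M ^ i`, which excludes `M = 1`.
  boxIn⇒2≤M : ∀ c → BoxIn c → 2 ≤ M
  boxIn⇒2≤M c bx = let a , i , x₀ , y₀ , le , _ = bx 1 𝟎 in not-one i (≤-trans (m≤n+m 2 x₀) le)
    where
    not-one : ∀ i → 2 ≤ M ^ i → 2 ≤ M
    not-one i le with 2 ≤? M
    ... | yes p = p
    ... | no ¬p = ⊥-elim (<⇒≱ le (≤-reflexive (trans (cong (_^ i) (ℕₚ.≤-antisym (ℕ.s≤s⁻¹ (≰⇒> ¬p)) (ℕₚ.n≢0⇒n>0 (ℕ.≢-nonZero⁻¹ M)))) (ℕₚ.^-zeroˡ i))))

  SameSeed : ℕ → Fin k → ℕ → ℕ → ℕ → Fin k → ℕ → ℕ → Set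
  SameSeed t a X Y t′ a′ X′ Y′ = ∀ e f → e < 2 → f < 2 → iter σ t a (e + X) (f + Y) ≡ iter σ t′ a′ (e + X′) (f + Y′)

  -- Substitution acts letter by letter, so the four level-`l` blocks over a 2 × 2 seed depend on
  -- the seed and not on the place where it occurs.
  transport : ∀ {t a X Y t′ a′ X′ Y′} → SameSeed t a X Y t′ a′ X′ Y′ → ∀ l x y → x < 2 * M ^ l → y < 2 * M ^ l →
    iter σ (l + t) a (x + X * M ^ l) (y + Y * M ^ l) ≡ iter σ (l + t′) a′ (x + X′ * M ^ l) (y + Y′ * M ^ l)
  transport {t} {a} {X} {Y} {t′} {a′} {X′} {Y′} same l x y x< y< =
    trans (unfold t a X Y) (trans (cong (λ b → iter σ l b (rem x l) (rem y l)) (same (quot x l) (quot y l) (quot< l x<) (quot< l y<)))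
      (sym (unfold t′ a′ X′ Y′)))
    where
    split : ∀ x X → x + X * M ^ l ≡ rem x l + (quot x l + X) * M ^ l
    split x X = trans (cong (_+ X * M ^ l) (quot-rem x l)) (trans (+-assoc (rem x l) _ _) (cong (λ z → rem x l + z) (sym (ℕₚ.*-distribʳ-+ (M ^ l) (quot x l) X))))
    unfold : ∀ t a X Y → iter σ (l + t) a (x + X * M ^ l) (y + Y * M ^ l) ≡ iter σ l (iter σ t a (quot x l + X) (quot y l + Y)) (rem x l) (rem y l)
    unfold t a X Y = trans (cong₂ (iter σ (l + t) a) (split x X) (split y Y))
      (iter-block l t a (quot x l + X) (quot y l + Y) (rem x l) (rem y l) (rem< x l) (rem< y l))

  M^-split : ∀ {l i} → l ≤ i → M ^ i ≡ M ^ (i ∸ l) * M ^ l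
  M^-split {l} {i} l≤i = trans (cong (M ^_) (sym (m∸n+n≡m l≤i))) (ℕₚ.^-distribˡ-+-* M (i ∸ l) l)

  module Reduce (2≤M : 2 ≤ M) where

    -- A pair of adjacent cells lies in a pair of adjacent level-l blocks, both inside the square.
    parent : ∀ l i X → l < i → 2 + X ≤ M ^ i → ∃[ P ] ∃[ x ] (X ≡ x + P * M ^ l × 2 + x ≤ 2 * M ^ l × 2 + P ≤ M ^ (i ∸ l))
    parent l i X l<i X≤ = choose (2 + q ≤? m)
      where
      m q r : ℕ
      m = M ^ (i ∸ l)
      q = quot X l
      r = rem X l
      X≡ : X ≡ r + q * M ^ l
      X≡ = quot-rem X l
      M^i : M ^ i ≡ m * M ^ l
      M^i = M^-split (<⇒≤ l<i)
      r< : r < M ^ l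
      r< = rem< X l
      q< : q < m
      q< = quot< l (≤-trans (≤-trans (n≤1+n (suc X)) X≤) (≤-reflexive M^i))
      2≤m : 2 ≤ m
      2≤m = ≤-trans 2≤M (≤-trans (≤-reflexive (sym (ℕₚ.*-identityʳ M))) (ℕₚ.^-monoʳ-≤ M (ℕₚ.m<n⇒0<n∸m l<i)))
      double : 2 * M ^ l ≡ M ^ l + M ^ l
      double = cong (λ z → M ^ l + z) (+-identityʳ (M ^ l))
      last : ∀ q → q < m → ¬ 2 + q ≤ m → X ≡ r + q * M ^ l → ∃[ P ] ∃[ x ] (X ≡ x + P * M ^ l × 2 + x ≤ 2 * M ^ l × 2 + P ≤ m)
      last zero _ ¬le _ = ⊥-elim (¬le 2≤m)
      last (suc q) q< ¬le eq = q , r + M ^ l , trans eq (sym (+-assoc r (M ^ l) (q * M ^ l))) ,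
        ≤-trans (+-monoˡ-≤ (M ^ l) r+2≤) (≤-reflexive (sym double)) , q<
        where
        m≡ : m ≡ 2 + q
        m≡ = ℕₚ.≤-antisym (ℕ.s≤s⁻¹ (≰⇒> ¬le)) q<
        r+2≤ : 2 + r ≤ M ^ l
        r+2≤ = ℕₚ.+-cancelʳ-≤ (suc q * M ^ l) (2 + r) (M ^ l) (≤-trans (≤-reflexive (cong (λ z → 2 + z) (sym eq))) (≤-trans X≤ (≤-reflexive (trans M^i (cong (_* M ^ l) m≡)))))
      choose : Dec (2 + q ≤ m) → ∃[ P ] ∃[ x ] (X ≡ x + P * M ^ l × 2 + x ≤ 2 * M ^ l × 2 + P ≤ m)
      choose (yes le) = q , r , X≡ , ≤-trans (s≤s r<) (≤-trans (+-monoˡ-≤ (M ^ l) (≤-trans (s≤s z≤n) r<)) (≤-reflexive (sym double))) , le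
      choose (no ¬le) = last q q< ¬le X≡

    B : ℕ
    B = (k ^ 2) ^ 2

    Short : ℕ → Fin k → ℕ → ℕ → Set
    Short i a X Y = ∃[ i′ ] ∃[ X′ ] ∃[ Y′ ] (i′ ≤ B × 2 + X′ ≤ M ^ i′ × 2 + Y′ ≤ M ^ i′ × SameSeed i a X Y i′ a X′ Y′)

    -- `B` is the number of 2 × 2 patterns. Following the given seed up through more than `B`
    -- levels, two of its ancestors coincide, and cutting out the levels between them produces the
    -- same seed at a smaller level.
    reduce : ∀ fuel i a X Y → i ≤ fuel → 2 + X ≤ M ^ i → 2 + Y ≤ M ^ i → Short i a X Y
    reduce fuel i a X Y i≤ X≤ Y≤ with i ≤? B
    ... | yes i≤B = i , X , Y , i≤B , X≤ , Y≤ , λ e f _ _ → refl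
    reduce zero i a X Y i≤ X≤ Y≤ | no i≰B = ⊥-elim (i≰B (≤-trans i≤ z≤n))
    reduce (suc fuel) i a X Y i≤ X≤ Y≤ | no i≰B = shorten (Finₚ.pigeonhole {B} {suc B} ≤-refl code)
      where
      lev : Fin (suc B) → ℕ
      lev = toℕ
      lev< : ∀ l → lev l < i
      lev< l = ≤-trans (Finₚ.toℕ<n l) (≰⇒> i≰B)
      px : (l : Fin (suc B)) → ∃[ P ] ∃[ x ] (X ≡ x + P * M ^ lev l × 2 + x ≤ 2 * M ^ lev l × 2 + P ≤ M ^ (i ∸ lev l))
      px l = parent (lev l) i X (lev< l) X≤
      py : (l : Fin (suc B)) → ∃[ P ] ∃[ x ] (Y ≡ x + P * M ^ lev l × 2 + x ≤ 2 * M ^ lev l × 2 + P ≤ M ^ (i ∸ lev l))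
      py l = parent (lev l) i Y (lev< l) Y≤
      window : Fin (suc B) → Fin 2 → Fin 2 → Fin k
      window l e f = iter σ (i ∸ lev l) a (toℕ e + proj₁ (px l)) (toℕ f + proj₁ (py l))
      code : Fin (suc B) → Fin B
      code l = funToFin {2} (λ e → funToFin {2} (window l e))
      shorten : (∃[ l ] ∃[ l′ ] (l Fin.< l′ × code l ≡ code l′)) → Short i a X Y
      shorten (l , l′ , l<l′ , e) = map₂ (map₂ (map₂ λ { (b , p , q , s) → b , p , q , λ e f e< f< → trans (same e f e< f<) (s e f e< f<) }))
          (reduce fuel i₁ a X₁ Y₁ (ℕ.s≤s⁻¹ (≤-trans i₁<i i≤)) (fits x x≤ P′ P′≤) (fits y y≤ Q′ Q′≤))
        where
        x y P P′ Q Q′ i₁ X₁ Y₁ : ℕ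
        x = proj₁ (proj₂ (px l))
        y = proj₁ (proj₂ (py l))
        P = proj₁ (px l)
        Q = proj₁ (py l)
        P′ = proj₁ (px l′)
        Q′ = proj₁ (py l′)
        i₁ = lev l + (i ∸ lev l′)
        X₁ = x + P′ * M ^ lev l
        Y₁ = y + Q′ * M ^ lev l
        x≤ : 2 + x ≤ 2 * M ^ lev l
        x≤ = proj₁ (proj₂ (proj₂ (proj₂ (px l))))
        y≤ : 2 + y ≤ 2 * M ^ lev l
        y≤ = proj₁ (proj₂ (proj₂ (proj₂ (py l))))
        P′≤ : 2 + P′ ≤ M ^ (i ∸ lev l′)
        P′≤ = proj₂ (proj₂ (proj₂ (proj₂ (px l′))))
        Q′≤ : 2 + Q′ ≤ M ^ (i ∸ lev l′)
        Q′≤ = proj₂ (proj₂ (proj₂ (proj₂ (py l′))))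
        i₁<i : i₁ < i
        i₁<i = ≤-trans (+-monoˡ-≤ (i ∸ lev l′) l<l′) (≤-reflexive (m+[n∸m]≡n (<⇒≤ (lev< l′))))
        fits : ∀ x → 2 + x ≤ 2 * M ^ lev l → ∀ P → 2 + P ≤ M ^ (i ∸ lev l′) → 2 + (x + P * M ^ lev l) ≤ M ^ i₁
        fits x x≤ P P≤ = ≤-trans (+-monoˡ-≤ (P * M ^ lev l) x≤) (≤-trans (≤-reflexive (sym (ℕₚ.*-distribʳ-+ (M ^ lev l) 2 P)))
          (≤-trans (*-monoˡ-≤ (M ^ lev l) P≤) (≤-reflexive (trans (*-comm (M ^ (i ∸ lev l′)) (M ^ lev l)) (sym (ℕₚ.^-distribˡ-+-* M (lev l) (i ∸ lev l′)))))))
        seeds : SameSeed (i ∸ lev l) a P Q (i ∸ lev l′) a P′ Q′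
        seeds e₁ f₁ e< f< = subst₂ (λ e f → iter σ (i ∸ lev l) a (e + P) (f + Q) ≡ iter σ (i ∸ lev l′) a (e + P′) (f + Q′)) (Finₚ.toℕ-fromℕ< e<) (Finₚ.toℕ-fromℕ< f<)
          (funToFin-injective (window l (fromℕ< e<)) (window l′ (fromℕ< e<))
            (funToFin-injective (λ e → funToFin {2} (window l e)) (λ e → funToFin {2} (window l′ e)) e (fromℕ< e<)) (fromℕ< f<))
        shift : ∀ e x P X → X ≡ x + P * M ^ lev l → e + X ≡ (e + x) + P * M ^ lev l
        shift e x P X eq = trans (cong (λ z → e + z) eq) (sym (+-assoc e x (P * M ^ lev l)))
        less : ∀ e x → e < 2 → 2 + x ≤ 2 * M ^ lev l → e + x < 2 * M ^ lev l
        less e x e< x≤ = ≤-trans (+-monoˡ-≤ x e<) x≤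
        same : SameSeed i a X Y i₁ a X₁ Y₁
        same e f e< f< = trans (cong₂ (λ j z → iter σ j a z (f + Y)) (sym (m+[n∸m]≡n (<⇒≤ (lev< l)))) (shift e x P X (proj₁ (proj₂ (proj₂ (px l))))))
          (trans (cong (iter σ (lev l + (i ∸ lev l)) a ((e + x) + P * M ^ lev l)) (shift f y Q Y (proj₁ (proj₂ (proj₂ (py l))))))
            (trans (transport {i ∸ lev l} {a} {P} {Q} {i ∸ lev l′} {a} {P′} {Q′} seeds (lev l) (e + x) (f + y) (less e x e< x≤) (less f y f< y≤))
              (cong₂ (iter σ i₁ a) (+-assoc e x (P′ * M ^ lev l)) (+-assoc f y (Q′ * M ^ lev l)))))

  log≤ : 2 ≤ M → ∀ J i s → M ^ J < s → s ≤ M ^ i → J ≤ i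
  log≤ 2≤M J i s lt le with J ≤? i
  ... | yes p = p
  ... | no ¬p = ⊥-elim (<⇒≱ (≤-trans lt le) (ℕₚ.^-monoʳ-≤ M (<⇒≤ (≰⇒> ¬p))))

  -- A window of twice the side of a level-`J` block contains a whole one, starting at the next
  -- multiple of `M ^ J`.
  block-in : ∀ c → BoxIn c → ∀ J u → ∃[ b ] ∃[ ox ] ∃[ oy ] (ox ≤ M ^ J × oy ≤ M ^ J ×
    (∀ x y → x < M ^ J → y < M ^ J → c (u ⊕ (+ (ox + x) , + (oy + y))) ≡ iter σ J b x y))
  block-in c bx J u = found (bx (pred2 (M ^ J)) u)
    where
    pred2 : ℕ → ℕ
    pred2 p = ℕ.pred (p + p)
    size≡ : suc (pred2 (M ^ J)) ≡ M ^ J + M ^ J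
    size≡ = ℕₚ.suc-pred (M ^ J + M ^ J) {{ℕ.>-nonZero (≤-trans (ℕₚ.m^n>0 M J) (m≤m+n (M ^ J) (M ^ J)))}}
    found : ∃[ a ] ∃[ i ] ∃[ x₀ ] ∃[ y₀ ] (x₀ + suc (pred2 (M ^ J)) ≤ M ^ i × y₀ + suc (pred2 (M ^ J)) ≤ M ^ i ×
      (∀ x y → x < suc (pred2 (M ^ J)) → y < suc (pred2 (M ^ J)) → c (u ⊕ (+ x , + y)) ≡ iter σ i a (x₀ + x) (y₀ + y))) → _
    found (a , i , x₀ , y₀ , x₀≤ , y₀≤ , vals) = iter σ (i ∸ J) a (next x₀) (next y₀) , off x₀ , off y₀ , ℕₚ.m∸n≤m (M ^ J) (rem x₀ J) , ℕₚ.m∸n≤m (M ^ J) (rem y₀ J) ,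
      λ x y x< y< → trans (vals (off x₀ + x) (off y₀ + y) (less x₀ x x<) (less y₀ y y<))
        (trans (cong₂ (iter σ i a) (align x₀ x) (align y₀ y)) (trans (cong (λ j → iter σ j a (x + next x₀ * M ^ J) (y + next y₀ * M ^ J)) (sym (m+[n∸m]≡n J≤i)))
          (iter-block J (i ∸ J) a (next x₀) (next y₀) x y x< y<)))
      where
      next off : ℕ → ℕ
      next z = suc (quot z J)
      off z = M ^ J ∸ rem z J
      J≤i : J ≤ i
      J≤i = log≤ (boxIn⇒2≤M c bx) J i (M ^ J + M ^ J) (≤-trans (≤-reflexive (+-comm 1 (M ^ J))) (+-monoʳ-≤ (M ^ J) (ℕₚ.m^n>0 M J)))
              (≤-trans (≤-reflexive (sym size≡)) (≤-trans (m≤n+m _ x₀) x₀≤))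
      less : ∀ z x → x < M ^ J → off z + x < suc (pred2 (M ^ J))
      less z x x< = ≤-trans (≤-reflexive (sym (+-suc (off z) x))) (≤-trans (+-mono-≤ (ℕₚ.m∸n≤m (M ^ J) (rem z J)) x<) (≤-reflexive (sym size≡)))
      align : ∀ z x → z + (off z + x) ≡ x + next z * M ^ J
      align z x = trans (sym (+-assoc z (off z) x)) (trans (+-comm (z + off z) x) (cong (λ w → x + w) (trans (cong (_+ off z) (quot-rem z J))
        (trans (lem (rem z J) (quot z J * M ^ J) (off z)) (cong (_+ quot z J * M ^ J) (m+[n∸m]≡n (<⇒≤ (rem< z J))))))))
        where
        lem : ∀ r q o → r + q + o ≡ r + o + q
        lem = ℕ-Solver.solve-∀

  module Recurrent (c₀ : Config k) (bx₀ : BoxIn c₀) (pr : ℕ) (prim : ∀ a b → LetterIn σ a pr b) where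

    2≤M : 2 ≤ M
    2≤M = boxIn⇒2≤M c₀ bx₀

    open Reduce 2≤M public

    letter-in : ∀ e a b → LetterIn σ a (pr + e) b
    letter-in e a b = let x , y , x< , y< , eq = prim a (iter σ e b 0 0) in
      x , y , ≤-trans x< (ℕₚ.^-monoʳ-≤ M (m≤m+n pr e)) , ≤-trans y< (ℕₚ.^-monoʳ-≤ M (m≤m+n pr e)) ,
      trans (cong₂ (iter σ (pr + e) b) (sym (+-identityʳ x)) (sym (+-identityʳ y))) (trans (iter-block pr e b 0 0 x y x< y<) eq)

    -- `n` levels make blocks of side at least `n`, at most `B` reach a reduced seed, and `pr`
    -- brings in every letter. A seed of lower level is padded, so that the total depends on `n`
    -- alone.
    level : ℕ → ℕ
    level n = n + (B + pr)

    occurs : ∀ c → BoxIn c → ∀ n u b → ∃[ x₀ ] ∃[ y₀ ] (x₀ + n ≤ M ^ level n × y₀ + n ≤ M ^ level n ×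
      (∀ x y → x < n → y < n → c (u ⊕ (+ x , + y)) ≡ iter σ (level n) b (x₀ + x) (y₀ + y)))
    occurs c bx n u b = seeded (bx (ℕ.pred (2 * M ^ suc n)) u)
      where
      size≡ : suc (ℕ.pred (2 * M ^ suc n)) ≡ 2 * M ^ suc n
      size≡ = ℕₚ.suc-pred (2 * M ^ suc n) {{ℕ.>-nonZero (≤-trans (ℕₚ.m^n>0 M (suc n)) (m≤m+n (M ^ suc n) _))}}
      N≤ : M ^ n ≤ M ^ suc n
      N≤ = ℕₚ.^-monoʳ-≤ M (n≤1+n n)
      n≤M^n : n ≤ M ^ n
      n≤M^n = <⇒≤ (n<m^n 2≤M n)
      seeded : ∃[ a ] ∃[ i ] ∃[ x₀ ] ∃[ y₀ ] (x₀ + suc (ℕ.pred (2 * M ^ suc n)) ≤ M ^ i × y₀ + suc (ℕ.pred (2 * M ^ suc n)) ≤ M ^ i ×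
        (∀ x y → x < suc (ℕ.pred (2 * M ^ suc n)) → y < suc (ℕ.pred (2 * M ^ suc n)) → c (u ⊕ (+ x , + y)) ≡ iter σ i a (x₀ + x) (y₀ + y))) → _
      seeded (a , i , x₀ , y₀ , x₀≤ , y₀≤ , vals) = place (reduce (i ∸ n) (i ∸ n) a (quot x₀ n) (quot y₀ n) ≤-refl (inb x₀ x₀≤) (inb y₀ y₀≤))
        where
        n≤i : n ≤ i
        n≤i = log≤ 2≤M n i (2 * M ^ suc n) (≤-trans (s≤s N≤) (≤-trans (≤-reflexive (+-comm 1 (M ^ suc n))) (+-monoʳ-≤ (M ^ suc n) (≤-trans (ℕₚ.m^n>0 M (suc n)) (m≤m+n (M ^ suc n) 0)))))
                (≤-trans (≤-reflexive (sym size≡)) (≤-trans (m≤n+m _ x₀) x₀≤))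
        inb : ∀ z → z + suc (ℕ.pred (2 * M ^ suc n)) ≤ M ^ i → 2 + quot z n ≤ M ^ (i ∸ n)
        inb z z≤ = ℕₚ.*-cancelʳ-≤ (2 + quot z n) (M ^ (i ∸ n)) (M ^ n) {{ℕₚ.m^n≢0 M n}} (≤-trans (≤-reflexive (ℕₚ.*-distribʳ-+ (M ^ n) 2 (quot z n)))
          (≤-trans (+-mono-≤ (*-monoʳ-≤ 2 N≤) (≤-trans (m≤n+m (quot z n * M ^ n) (rem z n)) (≤-reflexive (sym (quot-rem z n)))))
            (≤-trans (≤-reflexive (trans (+-comm (2 * M ^ suc n) z) (cong (λ w → z + w) (sym size≡)))) (≤-trans z≤ (≤-reflexive (M^-split n≤i))))))
        place : Short (i ∸ n) a (quot x₀ n) (quot y₀ n) → _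
        place (i′ , X′ , Y′ , i′≤B , X′≤ , Y′≤ , same) = at-letter (letter-in (B ∸ i′) a b)
          where
          e : ℕ
          e = pr + (B ∸ i′)
          level≡ : (n + i′) + e ≡ level n
          level≡ = trans (+-assoc n i′ e) (cong (λ w → n + w) (trans (lem i′ pr (B ∸ i′)) (cong (_+ pr) (m+[n∸m]≡n i′≤B))))
            where
            lem : ∀ i p d → i + (p + d) ≡ i + d + p
            lem = ℕ-Solver.solve-∀
          rx ry : ℕ
          rx = rem x₀ n
          ry = rem y₀ n
          less : ∀ z x → x < n → rem z n + x < 2 * M ^ n
          less z x x< = ≤-trans (+-mono-≤ (rem< z n) (<⇒≤ (≤-trans x< n≤M^n))) (≤-reflexive (cong (λ w → M ^ n + w) (sym (+-identityʳ (M ^ n)))))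
          inner< : ∀ z P → z < 2 * M ^ n → 2 + P ≤ M ^ i′ → z + P * M ^ n < M ^ (n + i′)
          inner< z P z< P≤ = ≤-trans (+-monoˡ-≤ (P * M ^ n) z<) (≤-trans (≤-reflexive (sym (ℕₚ.*-distribʳ-+ (M ^ n) 2 P)))
            (≤-trans (*-monoˡ-≤ (M ^ n) P≤) (≤-reflexive (trans (*-comm (M ^ i′) (M ^ n)) (sym (ℕₚ.^-distribˡ-+-* M n i′))))))
          at-letter : LetterIn σ a e b → _
          at-letter (x₁ , y₁ , x₁< , y₁< , eq) = pos rx X′ x₁ , pos ry Y′ y₁ , fits x₀ X′ x₁ X′≤ x₁< , fits y₀ Y′ y₁ Y′≤ y₁< , values
            where
            pos : ℕ → ℕ → ℕ → ℕ
            pos r P q = r + P * M ^ n + q * M ^ (n + i′)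
            fits : ∀ z P q → 2 + P ≤ M ^ i′ → q < M ^ e → pos (rem z n) P q + n ≤ M ^ level n
            fits z P q P≤ q< = ≤-trans (≤-reflexive (lem (rem z n) (P * M ^ n) (q * M ^ (n + i′)) n))
              (≤-trans (+-monoˡ-≤ (q * M ^ (n + i′)) (≤-trans (+-monoˡ-≤ (P * M ^ n) (≤-trans (+-mono-≤ (<⇒≤ (rem< z n)) n≤M^n) (≤-reflexive (cong (λ w → M ^ n + w) (sym (+-identityʳ (M ^ n)))))))
                (≤-trans (≤-reflexive (sym (ℕₚ.*-distribʳ-+ (M ^ n) 2 P))) (≤-trans (*-monoˡ-≤ (M ^ n) P≤) (≤-reflexive (trans (*-comm (M ^ i′) (M ^ n)) (sym (ℕₚ.^-distribˡ-+-* M n i′))))))))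
              (≤-trans (*-monoˡ-≤ (M ^ (n + i′)) q<) (≤-reflexive (trans (*-comm (M ^ e) (M ^ (n + i′))) (trans (sym (ℕₚ.^-distribˡ-+-* M (n + i′) e)) (cong (M ^_) level≡))))))
              where
              lem : ∀ r p q n → r + p + q + n ≡ r + n + p + q
              lem = ℕ-Solver.solve-∀
            regroup : ∀ r P q x → (r + x + P * M ^ n) + q * M ^ (n + i′) ≡ pos r P q + x
            regroup r P q x = lem r x (P * M ^ n) (q * M ^ (n + i′))
              where
              lem : ∀ r x p q → (r + x + p) + q ≡ r + p + q + x
              lem = ℕ-Solver.solve-∀
            source : ∀ z x → z + x ≡ rem z n + x + quot z n * M ^ n
            source z x = trans (cong (_+ x) (quot-rem z n)) (lem (rem z n) (quot z n * M ^ n) x)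
              where
              lem : ∀ r q x → r + q + x ≡ r + x + q
              lem = ℕ-Solver.solve-∀
            values : ∀ x y → x < n → y < n → c (u ⊕ (+ x , + y)) ≡ iter σ (level n) b (pos rx X′ x₁ + x) (pos ry Y′ y₁ + y)
            values x y x< y< =
              trans (vals x y (in-box x<) (in-box y<))
              (trans (cong₂ (iter σ i a) (source x₀ x) (source y₀ y))
              (trans (cong (λ j → iter σ j a (rx + x + quot x₀ n * M ^ n) (ry + y + quot y₀ n * M ^ n)) (sym (m+[n∸m]≡n n≤i)))
              (trans (transport {i ∸ n} {a} {quot x₀ n} {quot y₀ n} {i′} {a} {X′} {Y′} same n (rx + x) (ry + y) (less x₀ x x<) (less y₀ y y<))
              (trans (cong (λ l → iter σ (n + i′) l (rx + x + X′ * M ^ n) (ry + y + Y′ * M ^ n)) (sym eq))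
              (trans (sym (iter-block (n + i′) e b x₁ y₁ (rx + x + X′ * M ^ n) (ry + y + Y′ * M ^ n) (inner< (rx + x) X′ (less x₀ x x<) X′≤) (inner< (ry + y) Y′ (less y₀ y y<) Y′≤)))
              (trans (cong₂ (iter σ (n + i′ + e) b) (regroup rx X′ x₁ x) (regroup ry Y′ y₁ y))
                (cong (λ j → iter σ j b (pos rx X′ x₁ + x) (pos ry Y′ y₁ + y)) level≡)))))))
              where
              in-box : ∀ {x} → x < n → x < suc (ℕ.pred (2 * M ^ suc n))
              in-box x< = ≤-trans x< (≤-trans n≤M^n (≤-trans N≤ (≤-trans (m≤m+n (M ^ suc n) _) (≤-reflexive (sym size≡)))))

    radius : ℕ → ℕ
    radius n = M ^ level n + M ^ level n

    -- Near every position `c` has a whole block of level `level n`, and such a block contains all n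
    -- × n patterns of `c′`. Two configurations are allowed, in order to pass between `c₀`, its
    -- image under the substitution and an arbitrary member of the subshift.
    recurs : ∀ c c′ → BoxIn c → BoxIn c′ → ∀ n u v → ∃[ ox ] ∃[ oy ] (ox ≤ radius n × oy ≤ radius n ×
      (∀ x y → x < n → y < n → c′ (u ⊕ (+ x , + y)) ≡ c (v ⊕ (+ ox , + oy) ⊕ (+ x , + y))))
    recurs c c′ bx bx′ n u v =
      let b , px , py , px≤ , py≤ , vals = block-in c bx (level n) v
          x₀ , y₀ , x₀≤ , y₀≤ , vals′ = occurs c′ bx′ n u b
      in px + x₀ , py + y₀ , +-mono-≤ px≤ (≤-trans (m≤m+n x₀ n) x₀≤) , +-mono-≤ py≤ (≤-trans (m≤m+n y₀ n) y₀≤) ,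
         λ x y x< y< → trans (vals′ x y x< y<) (trans (sym (vals (x₀ + x) (y₀ + y) (lt x₀ x< x₀≤) (lt y₀ y< y₀≤)))
           (cong c (trans (cong₂ (λ s t → v ⊕ (+ s , + t)) (sym (+-assoc px x₀ x)) (sym (+-assoc py y₀ y))) (sym (⊕-assoc v _ _)))))
      where
      lt : ∀ z {x} → x < n → z + n ≤ M ^ level n → z + x < M ^ level n
      lt z {x} x< le = ≤-trans (≤-reflexive (sym (+-suc z x))) (≤-trans (+-monoʳ-≤ z x<) le)

    uniformly-recurrent : UniformlyRecurrent c₀
    uniformly-recurrent n = radius (suc (n + n)) , λ u v →
      let ox , oy , ox≤ , oy≤ , vals = recurs c₀ c₀ bx₀ bx₀ (suc (n + n)) (u ⊕ corner) (v ⊕ corner) in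
      (+ ox , + oy) , (ox≤ , oy≤) , λ { (p₁ , p₂) (p₁≤ , p₂≤) →
        trans (cong c₀ (sym (from-corner u (p₁ , p₂) (p₁≤ , p₂≤))))
          (trans (vals ∣ p₁ +ᶻ + n ∣ ∣ p₂ +ᶻ + n ∣ (s≤s (abs-+ p₁ (+ n) p₁≤ ≤-refl)) (s≤s (abs-+ p₂ (+ n) p₂≤ ≤-refl)))
            (cong c₀ (trans (cong (_⊕ (+ ∣ p₁ +ᶻ + n ∣ , + ∣ p₂ +ᶻ + n ∣)) (⊕-swap v corner (+ ox , + oy))) (from-corner (v ⊕ (+ ox , + oy)) (p₁ , p₂) (p₁≤ , p₂≤))))) }
      where
      corner : Pos
      corner = -ᶻ (+ n) , -ᶻ (+ n)
      lem : ∀ n p → -ᶻ n +ᶻ (p +ᶻ n) ≡ p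
      lem = solve-∀
      from-corner : ∀ w p → Near n p → w ⊕ corner ⊕ (+ ∣ proj₁ p +ᶻ + n ∣ , + ∣ proj₂ p +ᶻ + n ∣) ≡ w ⊕ p
      from-corner w (p₁ , p₂) (p₁≤ , p₂≤) = trans (⊕-assoc w corner _) (cong (w ⊕_)
        (pos-≡ (trans (cong (-ᶻ (+ n) +ᶻ_) (+∣i+n∣ p₁ n p₁≤)) (lem (+ n) p₁)) (trans (cong (-ᶻ (+ n) +ᶻ_) (+∣i+n∣ p₂ n p₂≤)) (lem (+ n) p₂))))

-- Recognizability

∣i-j∣<n : ∀ {i j n} → i < n → j < n → ∣ + i -ᶻ + j ∣ < n
∣i-j∣<n {i} {j} {n} i< j< = ≤-trans (s≤s (≤-trans (≤-reflexive (cong ∣_∣ (ℤₚ.m-n≡m⊖n i j))) (ℤₚ.∣m⊝n∣≤m⊔n i j))) (ℕₚ.⊔-lub i< j<)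

small-multiple : ∀ q M x → q *ᶻ + M ≡ x → ∣ x ∣ < M → q ≡ 0ℤ
small-multiple q M x e lt = ℤₚ.∣i∣≡0⇒i≡0 (zero-factor ∣ q ∣ (≤-<-trans (≤-reflexive (trans (sym (ℤₚ.abs-* q (+ M))) (cong ∣_∣ e))) lt))
  where
  zero-factor : ∀ n → n * M < M → n ≡ 0
  zero-factor zero _ = refl
  zero-factor (suc n) lt = ⊥-elim (<⇒≱ lt (m≤m+n M (n * M)))

module _ (M : ℕ) {{_ : NonZero M}} where

  divmod-unique : ∀ x i v → i < M → x ≡ + i +ᶻ v *ᶻ + M → x %ℕ M ≡ i × x /ℕ M ≡ v
  divmod-unique x i v i< eq = ℤₚ.+-injective (same-rem (+ r) (+ i) q v q≡v e) , q≡v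
    where
    r : ℕ
    r = x %ℕ M
    q : ℤ
    q = x /ℕ M
    e : + r +ᶻ q *ᶻ + M ≡ + i +ᶻ v *ᶻ + M
    e = trans (sym (a≡a%ℕn+[a/ℕn]*n x M)) eq
    lem : ∀ r i q v m → r +ᶻ q *ᶻ m ≡ i +ᶻ v *ᶻ m → (q -ᶻ v) *ᶻ m ≡ i -ᶻ r
    lem r i q v m e = trans (lem₁ r q v m) (trans (cong (λ z → z -ᶻ v *ᶻ m -ᶻ r) e) (lem₂ i r v m))
      where
      lem₁ : ∀ r q v m → (q -ᶻ v) *ᶻ m ≡ r +ᶻ q *ᶻ m -ᶻ v *ᶻ m -ᶻ r
      lem₁ = solve-∀
      lem₂ : ∀ i r v m → i +ᶻ v *ᶻ m -ᶻ v *ᶻ m -ᶻ r ≡ i -ᶻ r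
      lem₂ = solve-∀
    q≡v : q ≡ v
    q≡v = ℤₚ.i-j≡0⇒i≡j q v (small-multiple (q -ᶻ v) M (+ i -ᶻ + r) (lem (+ r) (+ i) q v (+ M) e) (∣i-j∣<n i< (n%ℕd<d x M)))
    same-rem : ∀ r i q v → q ≡ v → r +ᶻ q *ᶻ + M ≡ i +ᶻ v *ᶻ + M → r ≡ i
    same-rem r i q .q refl e = trans (lem₃ r (q *ᶻ + M)) (trans (cong (_-ᶻ q *ᶻ + M) e) (sym (lem₃ i (q *ᶻ + M))))
      where
      lem₃ : ∀ a b → a ≡ a +ᶻ b -ᶻ b
      lem₃ = solve-∀

  -- The quotient times `M` is a sum of three terms, each smaller than `M` in absolute value.
  quotient≤2 : ∀ e r → e < M → ∣ r ∣ < M → ∣ (+ e +ᶻ r) /ℕ M ∣ ≤ 2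
  quotient≤2 e r e< r< = ℕ.s≤s⁻¹ (ℕₚ.*-cancelʳ-< M ∣ q ∣ 3 (≤-<-trans
      (≤-reflexive (trans (sym (ℤₚ.abs-* q (+ M))) (cong ∣_∣ (lem (+ e +ᶻ r) (+ ((+ e +ᶻ r) %ℕ M)) (q *ᶻ + M) (a≡a%ℕn+[a/ℕn]*n (+ e +ᶻ r) M)))))
      (≤-<-trans (abs-+ (+ e +ᶻ r) (-ᶻ (+ ((+ e +ᶻ r) %ℕ M))) (abs-+ (+ e) r (<⇒≤ e<) (<⇒≤ r<)) (abs-neg (+ ((+ e +ᶻ r) %ℕ M)) ≤-refl))
        (≤-trans (≤-reflexive (sym (+-suc (M + M) _))) (≤-trans (+-monoʳ-≤ (M + M) (n%ℕd<d (+ e +ᶻ r) M)) (≤-reflexive (lem₂ M)))))))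
    where
    q : ℤ
    q = (+ e +ᶻ r) /ℕ M
    lem : ∀ x r q → x ≡ r +ᶻ q → q ≡ x +ᶻ -ᶻ r
    lem _ r q refl = lem′ r q
      where
      lem′ : ∀ r q → q ≡ r +ᶻ q +ᶻ -ᶻ r
      lem′ = solve-∀
    lem₂ : ∀ m → m + m + m ≡ 3 * m
    lem₂ = ℕ-Solver.solve-∀

_∙_ : ℤ → Pos → Pos
n ∙ (x , y) = n *ᶻ x , n *ᶻ y

module DeterminedLine {k : ℕ} (X : Pos → Fin k) (f : Pos) (f≤ : Near 4 f) (S₂ : ℕ) where

  reach : ℕ
  reach = (k + k !) * 4

  -- Walking against `f`, each letter determines the next, so with `k` letters the walk has period
  -- `k !` after at most `k` steps. It starts `k` steps ahead of `w`, which puts `w` in the periodic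
  -- part.
  determined⇒periodic : (∀ w w′ → Near (S₂ + reach) w → Near (S₂ + reach) w′ → X (w ⊕ f) ≡ X (w′ ⊕ f) → X w ≡ X w′) →
    ∀ w → Near S₂ w → X (w ⊕ ((-ᶻ (+ (k !))) ∙ f)) ≡ X w
  determined⇒periodic dt w w≤ = sym (subst₂ (λ s t → X s ≡ X t) at-k at-k! (per k ≤-refl ≤-refl))
    where
    pt : ℕ → Pos
    pt i = w ⊕ ((+ k -ᶻ + i) ∙ f)
    lem₀ : ∀ a k x → a +ᶻ (k -ᶻ k) *ᶻ x ≡ a
    lem₀ = solve-∀
    lem₁ : ∀ a k n x → a +ᶻ (k -ᶻ (k +ᶻ n)) *ᶻ x ≡ a +ᶻ (-ᶻ n) *ᶻ x
    lem₁ = solve-∀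
    lem₂ : ∀ a k i x → a +ᶻ (k -ᶻ i) *ᶻ x ≡ a +ᶻ (k -ᶻ (1ℤ +ᶻ i)) *ᶻ x +ᶻ x
    lem₂ = solve-∀
    at-k : pt k ≡ w
    at-k = pos-≡ (lem₀ (proj₁ w) (+ k) (proj₁ f)) (lem₀ (proj₂ w) (+ k) (proj₂ f))
    at-k! : pt (k + k !) ≡ w ⊕ ((-ᶻ (+ (k !))) ∙ f)
    at-k! = pos-≡ (lem₁ (proj₁ w) (+ k) (+ (k !)) (proj₁ f)) (lem₁ (proj₂ w) (+ k) (+ (k !)) (proj₂ f))
    next : ∀ i → pt i ≡ pt (suc i) ⊕ f
    next i = pos-≡ (lem₂ (proj₁ w) (+ k) (+ i) (proj₁ f)) (lem₂ (proj₂ w) (+ k) (+ i) (proj₂ f))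
    coeff≤ : ∀ i → i ≤ k + k ! → ∣ + k -ᶻ + i ∣ ≤ k + k !
    coeff≤ i i≤ = ≤-trans (≤-reflexive (cong ∣_∣ (ℤₚ.m-n≡m⊖n k i))) (≤-trans (ℤₚ.∣m⊝n∣≤m⊔n k i) (ℕₚ.⊔-lub (m≤m+n k (k !)) i≤))
    near-pt : ∀ i → i ≤ k + k ! → Near (S₂ + reach) (pt i)
    near-pt i i≤ = near-⊕ w ((+ k -ᶻ + i) ∙ f) w≤
      ( ≤-trans (≤-reflexive (ℤₚ.abs-* (+ k -ᶻ + i) (proj₁ f))) (*-mono-≤ (coeff≤ i i≤) (proj₁ f≤))
      , ≤-trans (≤-reflexive (ℤₚ.abs-* (+ k -ᶻ + i) (proj₂ f))) (*-mono-≤ (coeff≤ i i≤) (proj₂ f≤)) )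
    step : ∀ i j → i < k + k ! → j < k + k ! → X (pt i) ≡ X (pt j) → X (pt (suc i)) ≡ X (pt (suc j))
    step i j i< j< e = dt (pt (suc i)) (pt (suc j)) (near-pt (suc i) i<) (near-pt (suc j) j<)
      (trans (cong X (sym (next i))) (trans e (cong X (next j))))
    per : ∀ n → k ≤ n → n + k ! ≤ k + k ! → X (pt n) ≡ X (pt (n + k !))
    per with Finₚ.pigeonhole {k} {suc k} ≤-refl (λ i → X (pt (toℕ i)))
    ... | i , j , i<j , e = eventually-periodic (λ i j → X (pt i) ≡ X (pt j)) refl trans (k + k !) k step
                              (toℕ i) (toℕ j) i<j (ℕ.s≤s⁻¹ (Finₚ.toℕ<n j)) e

module Recognizable {k M : ℕ} {{M≢0 : NonZero M}} (σ : Substitution k M)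
  (c₀ : Config k) (bx₀ : Substitutive.BoxIn σ c₀) (pr : ℕ) (prim : ∀ a b → LetterIn σ a pr b) (np : NonPeriodic c₀)
  (d₁ d₂ : ℕ) (d₁< : d₁ < M) (d₂< : d₂ < M)
  (det₀ : ∀ a b → Substitutive.letter σ a d₁ d₂ ≡ Substitutive.letter σ b d₁ d₂ → a ≡ b) where
  open Substitutive σ
  open Recurrent c₀ bx₀ pr prim

  image : Config k → Config k
  image c (x , y) = letter (c (x /ℕ M , y /ℕ M)) (x %ℕ M) (y %ℕ M)

  image-at : ∀ c v₁ v₂ i j → image c (+ i +ᶻ v₁ *ᶻ + M , + j +ᶻ v₂ *ᶻ + M) ≡ letter (c (v₁ +ᶻ + (i / M) , v₂ +ᶻ + (j / M))) i j
  image-at c v₁ v₂ i j =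
    let rx , qx = unique i v₁
        ry , qy = unique j v₂
    in trans (cong₂ (λ p q → letter (c p) (proj₁ q) (proj₂ q)) (pos-≡ qx qy) (pos-≡′ rx ry))
         (letter-cong _ (m%n%n≡m%n i M) (m%n%n≡m%n j M))
    where
    pos-≡′ : ∀ {a b c d : ℕ} → a ≡ c → b ≡ d → (a , b) ≡ (c , d)
    pos-≡′ = cong₂ _,_
    lem : ∀ r q v m → r +ᶻ q *ᶻ m +ᶻ v *ᶻ m ≡ r +ᶻ (v +ᶻ q) *ᶻ m
    lem = solve-∀
    unique : ∀ i v → (+ i +ᶻ v *ᶻ + M) %ℕ M ≡ i % M × (+ i +ᶻ v *ᶻ + M) /ℕ M ≡ v +ᶻ + (i / M)
    unique i v = divmod-unique M _ (i % M) (v +ᶻ + (i / M)) (m%n<n i M)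
      (trans (cong (λ z → z +ᶻ v *ᶻ + M) (trans (cong +_ (m≡m%n+[m/n]*n i M)) (cong (λ z → + (i % M) +ᶻ z) (ℤₚ.pos-* (i / M) M)))) (lem (+ (i % M)) (+ (i / M)) v (+ M)))

  image-cell : ∀ c v₁ v₂ i j → i < M → j < M → image c (+ i +ᶻ v₁ *ᶻ + M , + j +ᶻ v₂ *ᶻ + M) ≡ letter (c (v₁ , v₂)) i j
  image-cell c v₁ v₂ i j i< j< = trans (image-at c v₁ v₂ i j) (cong (λ p → letter (c p) i j)
    (pos-≡ (trans (cong (λ z → v₁ +ᶻ + z) (m<n⇒m/n≡0 i<)) (ℤₚ.+-identityʳ v₁)) (trans (cong (λ z → v₂ +ᶻ + z) (m<n⇒m/n≡0 j<)) (ℤₚ.+-identityʳ v₂))))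

  boxIn-image : ∀ c → BoxIn c → BoxIn (image c)
  boxIn-image c bx n (u₁ , u₂) = lifted (bx (suc n) (u₁ /ℕ M , u₂ /ℕ M))
    where
    r₁ r₂ : ℕ
    r₁ = u₁ %ℕ M
    r₂ = u₂ %ℕ M
    lem : ∀ r q x → r +ᶻ q +ᶻ x ≡ r +ᶻ x +ᶻ q
    lem = solve-∀
    at : ∀ u x → u +ᶻ + x ≡ + (u %ℕ M + x) +ᶻ (u /ℕ M) *ᶻ + M
    at u x = trans (cong (_+ᶻ + x) (a≡a%ℕn+[a/ℕn]*n u M)) (lem (+ (u %ℕ M)) ((u /ℕ M) *ᶻ + M) (+ x))
    in-range : ∀ r x → r < M → x < suc n → (r + x) / M < suc (suc n)
    in-range r x r< x< = m<n*o⇒m/o<n (≤-trans (+-mono-≤ r< (<⇒≤ x<)) (+-monoʳ-≤ M (≤-trans (≤-reflexive (sym (ℕₚ.*-identityʳ (suc n)))) (*-monoʳ-≤ (suc n) (≤-trans (s≤s z≤n) 2≤M)))))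
    lifted : ∃[ a ] ∃[ i ] ∃[ x₀ ] ∃[ y₀ ] (x₀ + suc (suc n) ≤ M ^ i × y₀ + suc (suc n) ≤ M ^ i ×
      (∀ x y → x < suc (suc n) → y < suc (suc n) → c ((u₁ /ℕ M , u₂ /ℕ M) ⊕ (+ x , + y)) ≡ iter σ i a (x₀ + x) (y₀ + y))) → _
    lifted (a , i , x₀ , y₀ , x₀≤ , y₀≤ , vals) = a , suc i , r₁ + x₀ * M , r₂ + y₀ * M , bound r₁ x₀ (n%ℕd<d u₁ M) x₀≤ , bound r₂ y₀ (n%ℕd<d u₂ M) y₀≤ , values
      where
      bound : ∀ r z → r < M → z + suc (suc n) ≤ M ^ i → r + z * M + suc n ≤ M ^ suc i
      bound r z r< z≤ = ≤-trans (+-mono-≤ (+-monoˡ-≤ (z * M) (<⇒≤ r<)) (≤-trans (≤-reflexive (sym (ℕₚ.*-identityʳ (suc n)))) (*-monoʳ-≤ (suc n) (≤-trans (s≤s z≤n) 2≤M))))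
        (≤-trans (≤-reflexive (lem₁ M z n)) (≤-trans (*-monoˡ-≤ M z≤) (≤-reflexive (*-comm (M ^ i) M))))
        where
        lem₁ : ∀ m z n → m + z * m + (1 + n) * m ≡ (z + (1 + (1 + n))) * m
        lem₁ = ℕ-Solver.solve-∀
      regroup : ∀ r z x → r + z * M + x ≡ r + x + z * M
      regroup r z x = lem₂ r (z * M) x
        where
        lem₂ : ∀ r z x → r + z + x ≡ r + x + z
        lem₂ = ℕ-Solver.solve-∀
      unfold : ∀ x y → iter σ (suc i) a (r₁ + x₀ * M + x) (r₂ + y₀ * M + y) ≡ letter (iter σ i a (x₀ + (r₁ + x) / M) (y₀ + (r₂ + y) / M)) (r₁ + x) (r₂ + y)
      unfold x y = trans (cong₂ (iter σ (suc i) a) (regroup r₁ x₀ x) (regroup r₂ y₀ y))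
        (trans (letter-cong _ ([m+kn]%n≡m%n (r₁ + x) x₀ M) ([m+kn]%n≡m%n (r₂ + y) y₀ M))
          (cong (λ b → letter b (r₁ + x) (r₂ + y)) (cong₂ (iter σ i a) (trans ([m+kn]/n (r₁ + x) x₀ M) (+-comm _ x₀)) (trans ([m+kn]/n (r₂ + y) y₀ M) (+-comm _ y₀)))))
      values : ∀ x y → x < suc n → y < suc n → image c ((u₁ , u₂) ⊕ (+ x , + y)) ≡ iter σ (suc i) a (r₁ + x₀ * M + x) (r₂ + y₀ * M + y)
      values x y x< y< = trans (cong (image c) (pos-≡ (at u₁ x) (at u₂ y)))
        (trans (image-at c (u₁ /ℕ M) (u₂ /ℕ M) (r₁ + x) (r₂ + y))
          (trans (cong (λ b → letter b (r₁ + x) (r₂ + y)) (vals ((r₁ + x) / M) ((r₂ + y) / M) (in-range r₁ x (n%ℕd<d u₁ M) x<) (in-range r₂ y (n%ℕd<d u₂ M) y<)))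
            (sym (unfold x y))))

  -- No vector of size at most `k ! * 4` is a local period on radius `S₂`. `S₁` adds the reach of
  -- the walk in `DeterminedLine`, and `S` adds a radius in which every letter is seen, with room
  -- for the displacements `ε` and `ε′`.
  S₂ S₁ S : ℕ
  S₂ = proj₁ (no-local-period c₀ uniformly-recurrent np (k ! * 4))
  S₁ = S₂ + (k + k !) * 4
  S = S₁ + (M ^ pr + M ^ pr) + 8

  Determining : ℕ → ℕ → Set
  Determining e₁ e₂ = ∀ a b → letter a e₁ e₂ ≡ letter b e₁ e₂ → a ≡ b

  -- σ(X) and σ(Y) agree up to the shift r. At a determining position e, the letter X w is a function
  -- of the letter Y (w ⊕ ε), which is a function of X (w ⊕ ε ⊕ ε′); if ε ⊕ ε′ ≠ 0 this forces a period,
  -- and otherwise e + r mod M is determining too.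
  module Shifted (v v′ : Pos) (r₁ r₂ : ℤ) (r₁< : ∣ r₁ ∣ < M) (r₂< : ∣ r₂ ∣ < M)
    (rel : ∀ w e₁ e₂ → Near S w → e₁ < M → e₂ < M →
      letter (c₀ (v ⊕ w)) e₁ e₂ ≡ letter (c₀ (v′ ⊕ (w ⊕ ((+ e₁ +ᶻ r₁) /ℕ M , (+ e₂ +ᶻ r₂) /ℕ M)))) ((+ e₁ +ᶻ r₁) %ℕ M) ((+ e₂ +ᶻ r₂) %ℕ M)) where

    X Y : Pos → Fin k
    X w = c₀ (v ⊕ w)
    Y w = c₀ (v′ ⊕ w)

    -- `Determining` quantifies over all letters, whereas `rel` speaks only of letters near the
    -- centre; primitivity bridges the two.
    all-letters : ∀ b → ∃[ w ] (Near (M ^ pr + M ^ pr) w × Y w ≡ b)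
    all-letters b =
      let a , ox , oy , ox≤ , oy≤ , vals = block-in c₀ bx₀ pr v′
          x , y , x< , y< , eq = prim b a
      in (+ (ox + x) , + (oy + y)) , (+-mono-≤ ox≤ (<⇒≤ x<) , +-mono-≤ oy≤ (<⇒≤ y<)) , trans (vals x y x< y<) eq

    no-determined-line : ∀ f → Near 4 f → f ≢ 𝟎 → (∀ w w′ → Near S₁ w → Near S₁ w′ → X (w ⊕ f) ≡ X (w′ ⊕ f) → X w ≡ X w′) → ⊥
    no-determined-line f f≤ f≢0 dt = proj₂ (no-local-period c₀ uniformly-recurrent np (k ! * 4)) t t≢0 t≤ v
        (λ p p≤ → trans (cong c₀ (⊕-assoc v p t)) (DeterminedLine.determined⇒periodic X f f≤ S₂ dt p p≤))
      where
      t : Pos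
      t = (-ᶻ (+ (k !))) ∙ f
      abs≤ : ∀ x → ∣ x ∣ ≤ 4 → ∣ -ᶻ (+ (k !)) *ᶻ x ∣ ≤ k ! * 4
      abs≤ x x≤ = ≤-trans (≤-reflexive (ℤₚ.abs-* (-ᶻ (+ (k !))) x)) (*-mono-≤ (abs-neg (+ (k !)) ≤-refl) x≤)
      t≤ : Near (k ! * 4) t
      t≤ = abs≤ (proj₁ f) (proj₁ f≤) , abs≤ (proj₂ f) (proj₂ f≤)
      zero-coord : ∀ x → -ᶻ (+ (k !)) *ᶻ x ≡ 0ℤ → x ≡ 0ℤ
      zero-coord x e = [ (λ z → ⊥-elim (ℕ.≢-nonZero⁻¹ (k !) {{k !≢0}} (ℤₚ.+-injective (trans (sym (ℤₚ.neg-involutive (+ (k !)))) (cong -ᶻ_ z))))) , id ]′ (ℤₚ.i*j≡0⇒i≡0∨j≡0 (-ᶻ (+ (k !))) e)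
      t≢0 : t ≢ 𝟎
      t≢0 e = f≢0 (pos-≡ (zero-coord (proj₁ f) (cong proj₁ e)) (zero-coord (proj₂ f) (cong proj₂ e)))

    module At (e₁ e₂ : ℕ) (e₁< : e₁ < M) (e₂< : e₂ < M) (dt : Determining e₁ e₂) where
      ε ε′ : Pos
      ε = (+ e₁ +ᶻ r₁) /ℕ M , (+ e₂ +ᶻ r₂) /ℕ M
      ε′ = (+ e₁ +ᶻ -ᶻ r₁) /ℕ M , (+ e₂ +ᶻ -ᶻ r₂) /ℕ M
      f₁ f₂ b₁ b₂ : ℕ
      f₁ = (+ e₁ +ᶻ r₁) %ℕ M
      f₂ = (+ e₂ +ᶻ r₂) %ℕ M
      b₁ = (+ e₁ +ᶻ -ᶻ r₁) %ℕ M
      b₂ = (+ e₂ +ᶻ -ᶻ r₂) %ℕ M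
      ε≤ : Near 2 ε
      ε≤ = quotient≤2 M e₁ r₁ e₁< r₁< , quotient≤2 M e₂ r₂ e₂< r₂<
      ε′≤ : Near 2 ε′
      ε′≤ = quotient≤2 M e₁ (-ᶻ r₁) e₁< (≤-<-trans (abs-neg r₁ ≤-refl) r₁<) , quotient≤2 M e₂ (-ᶻ r₂) e₂< (≤-<-trans (abs-neg r₂ ≤-refl) r₂<)

      returns : ∀ e r → e < M → (+ ((+ e +ᶻ -ᶻ r) %ℕ M) +ᶻ r) %ℕ M ≡ e × (+ ((+ e +ᶻ -ᶻ r) %ℕ M) +ᶻ r) /ℕ M ≡ -ᶻ ((+ e +ᶻ -ᶻ r) /ℕ M)
      returns e r e< = divmod-unique M _ e (-ᶻ ((+ e +ᶻ -ᶻ r) /ℕ M)) e< (lem (+ e) r (+ ((+ e +ᶻ -ᶻ r) %ℕ M)) ((+ e +ᶻ -ᶻ r) /ℕ M) (+ M) (a≡a%ℕn+[a/ℕn]*n (+ e +ᶻ -ᶻ r) M))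
        where
        lem : ∀ e r b q m → e +ᶻ -ᶻ r ≡ b +ᶻ q *ᶻ m → b +ᶻ r ≡ e +ᶻ -ᶻ q *ᶻ m
        lem e r b q m eq = trans (lem₁ b r q m) (trans (cong (λ z → z +ᶻ r +ᶻ -ᶻ q *ᶻ m) (sym eq)) (lem₂ e r q m))
          where
          lem₁ : ∀ b r q m → b +ᶻ r ≡ b +ᶻ q *ᶻ m +ᶻ r +ᶻ -ᶻ q *ᶻ m
          lem₁ = solve-∀
          lem₂ : ∀ e r q m → e +ᶻ -ᶻ r +ᶻ r +ᶻ -ᶻ q *ᶻ m ≡ e +ᶻ -ᶻ q *ᶻ m
          lem₂ = solve-∀

      forward : ∀ w → Near S w → letter (X w) e₁ e₂ ≡ letter (Y (w ⊕ ε)) f₁ f₂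
      forward w w≤ = rel w e₁ e₂ w≤ e₁< e₂<

      backward : ∀ w → Near S (w ⊕ ε′) → letter (Y w) e₁ e₂ ≡ letter (X (w ⊕ ε′)) b₁ b₂
      backward w w≤ = sym (trans (rel (w ⊕ ε′) b₁ b₂ w≤ (n%ℕd<d (+ e₁ +ᶻ -ᶻ r₁) M) (n%ℕd<d (+ e₂ +ᶻ -ᶻ r₂) M))
        (let m₁ , q₁ = returns e₁ r₁ e₁<
             m₂ , q₂ = returns e₂ r₂ e₂<
         in trans (cong (λ p → letter (Y (w ⊕ ε′ ⊕ p)) ((+ b₁ +ᶻ r₁) %ℕ M) ((+ b₂ +ᶻ r₂) %ℕ M)) (pos-≡ q₁ q₂))
              (trans (cong (λ p → letter (Y p) ((+ b₁ +ᶻ r₁) %ℕ M) ((+ b₂ +ᶻ r₂) %ℕ M)) (⊕-cancel w ε′))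
                (cong₂ (letter (Y w)) m₁ m₂))))

      S₁+8≤ : S₁ + 8 ≤ S
      S₁+8≤ = +-monoˡ-≤ 8 (m≤m+n S₁ _)

      letters+8≤ : (M ^ pr + M ^ pr) + 8 ≤ S
      letters+8≤ = +-monoˡ-≤ 8 (m≤n+m (M ^ pr + M ^ pr) S₁)

      opposite : ε ⊕ ε′ ≡ 𝟎
      opposite with (ε ⊕ ε′) ≟ᵖ 𝟎
      ... | yes e = e
      ... | no ne = ⊥-elim (no-determined-line (ε ⊕ ε′) (near-⊕ ε ε′ ε≤ ε′≤) ne λ w w′ w≤ w′≤ eq →
              dt (X w) (X w′) (trans (forward w (grow w w≤)) (trans (cong (λ a → letter a f₁ f₂)
                (dt (Y (w ⊕ ε)) (Y (w′ ⊕ ε)) (trans (backward (w ⊕ ε) (grow₂ w w≤)) (trans (cong (λ a → letter a b₁ b₂) (trans (cong X (⊕-assoc w ε ε′)) (trans eq (cong X (sym (⊕-assoc w′ ε ε′)))))) (sym (backward (w′ ⊕ ε) (grow₂ w′ w′≤)))))))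
                (sym (forward w′ (grow w′ w′≤))))))
        where
        grow : ∀ w → Near S₁ w → Near S w
        grow w = near-mono {p = w} (≤-trans (m≤m+n S₁ 8) S₁+8≤)
        grow₂ : ∀ w → Near S₁ w → Near S (w ⊕ ε ⊕ ε′)
        grow₂ w w≤ = near-mono {p = w ⊕ ε ⊕ ε′} (≤-trans (≤-trans (≤-reflexive (+-assoc S₁ 2 2)) (+-monoʳ-≤ S₁ (s≤s (s≤s (s≤s (s≤s z≤n)))))) S₁+8≤) (near-⊕ (w ⊕ ε) ε′ (near-⊕ w ε w≤ ε≤) ε′≤)

      -- Letters that look alike at the new residue are realized in `Y`. As `ε` and `ε′` cancel,
      -- `forward` makes the letters of `X` at displacement `ε′` equal, and `backward` returns this
      -- equality to `Y`.
      next-determining : Determining f₁ f₂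
      next-determining a b eq =
        let wa , wa≤ , ya = all-letters a
            wb , wb≤ , yb = all-letters b
        in trans (sym ya) (trans (dt (Y wa) (Y wb) (trans (backward wa (near₁ wa wa≤)) (trans (cong (λ l → letter l b₁ b₂) (same-X wa wb wa≤ wb≤ (trans (cong (λ l → letter l f₁ f₂) ya) (trans eq (cong (λ l → letter l f₁ f₂) (sym yb)))))) (sym (backward wb (near₁ wb wb≤)))))) yb)
        where
        near₁ : ∀ w → Near (M ^ pr + M ^ pr) w → Near S (w ⊕ ε′)
        near₁ w w≤ = near-mono {p = w ⊕ ε′} (≤-trans (+-monoʳ-≤ _ (s≤s (s≤s z≤n))) letters+8≤) (near-⊕ w ε′ w≤ ε′≤)
        back : ∀ w → w ⊕ ε′ ⊕ ε ≡ w
        back w = trans (⊕-assoc w ε′ ε) (trans (cong (w ⊕_) (trans (⊕-comm ε′ ε) opposite)) (⊕-identityʳ w))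
        same-X : ∀ wa wb → Near (M ^ pr + M ^ pr) wa → Near (M ^ pr + M ^ pr) wb → letter (Y wa) f₁ f₂ ≡ letter (Y wb) f₁ f₂ → X (wa ⊕ ε′) ≡ X (wb ⊕ ε′)
        same-X wa wb wa≤ wb≤ e = dt _ _ (trans (forward (wa ⊕ ε′) (near₁ wa wa≤)) (trans (cong (λ p → letter (Y p) f₁ f₂) (back wa)) (trans e (trans (cong (λ p → letter (Y p) f₁ f₂) (sym (back wb))) (sym (forward (wb ⊕ ε′) (near₁ wb wb≤)))))))

    ε₀ g : Pos
    ε₀ = At.ε d₁ d₂ d₁< d₂< det₀
    g = (r₁ , r₂) ⊕ (⊖ ((+ M) ∙ ε₀))

    -- By `opposite` at successive residues the quotient stays `ε₀`, so reduction modulo `M`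
    -- subtracts the same multiple each time: inside the block the residues form a true arithmetic
    -- progression of step `g`.
    record Orbit (t : ℕ) : Set where
      field
        e₁ e₂ : ℕ
        e₁< : e₁ < M
        e₂< : e₂ < M
        dt : Determining e₁ e₂
        ε≡ : At.ε e₁ e₂ e₁< e₂< dt ≡ ε₀
        at : (+ e₁ , + e₂) ≡ (+ d₁ , + d₂) ⊕ ((+ t) ∙ g)

    orbit : ∀ t → Orbit t
    orbit zero = record { e₁ = d₁ ; e₂ = d₂ ; e₁< = d₁< ; e₂< = d₂< ; dt = det₀ ; ε≡ = refl ; at = pos-≡ (lem (+ d₁) (proj₁ g)) (lem (+ d₂) (proj₂ g)) }
      where
      lem : ∀ d g → d ≡ d +ᶻ 0ℤ *ᶻ g
      lem = solve-∀
    orbit (suc t) = record { e₁ = A.f₁ ; e₂ = A.f₂ ; e₁< = n%ℕd<d (+ e₁ +ᶻ r₁) M ; e₂< = n%ℕd<d (+ e₂ +ᶻ r₂) M ; dt = A.next-determining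
                           ; ε≡ = pos-≡ (same-ε e₁ r₁ (proj₁ ε₀) e₁< (cong proj₁ ε≡) (cong proj₁ N.opposite)) (same-ε e₂ r₂ (proj₂ ε₀) e₂< (cong proj₂ ε≡) (cong proj₂ N.opposite))
                           ; at = pos-≡ (moved e₁ r₁ d₁ (proj₁ ε₀) (cong proj₁ ε≡) (cong proj₁ at)) (moved e₂ r₂ d₂ (proj₂ ε₀) (cong proj₂ ε≡) (cong proj₂ at)) }
      where
      open Orbit (orbit t)
      module A = At e₁ e₂ e₁< e₂< dt
      module N = At A.f₁ A.f₂ (n%ℕd<d (+ e₁ +ᶻ r₁) M) (n%ℕd<d (+ e₂ +ᶻ r₂) M) A.next-determining
      lem₁ : ∀ x f q m → x ≡ f +ᶻ q *ᶻ m → f ≡ x -ᶻ m *ᶻ q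
      lem₁ _ f q m refl = lem f q m
        where
        lem : ∀ f q m → f ≡ f +ᶻ q *ᶻ m -ᶻ m *ᶻ q
        lem = solve-∀
      f≡ : ∀ e r ε → (+ e +ᶻ r) /ℕ M ≡ ε → + ((+ e +ᶻ r) %ℕ M) ≡ + e +ᶻ r -ᶻ + M *ᶻ ε
      f≡ e r ε refl = lem₁ (+ e +ᶻ r) _ _ (+ M) (a≡a%ℕn+[a/ℕn]*n (+ e +ᶻ r) M)
      moved : ∀ e r d ε → (+ e +ᶻ r) /ℕ M ≡ ε → + e ≡ + d +ᶻ + t *ᶻ (r +ᶻ -ᶻ (+ M *ᶻ ε)) →
        + ((+ e +ᶻ r) %ℕ M) ≡ + d +ᶻ + suc t *ᶻ (r +ᶻ -ᶻ (+ M *ᶻ ε))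
      moved e r d ε q≡ e≡ = trans (f≡ e r ε q≡) (trans (cong (λ z → z +ᶻ r -ᶻ + M *ᶻ ε) e≡) (lem₂ (+ d) (+ t) r (+ M *ᶻ ε)))
        where
        lem₂ : ∀ d t r mε → d +ᶻ t *ᶻ (r +ᶻ -ᶻ mε) +ᶻ r -ᶻ mε ≡ d +ᶻ (1ℤ +ᶻ t) *ᶻ (r +ᶻ -ᶻ mε)
        lem₂ = solve-∀
      same-ε : ∀ e r ε → e < M → (+ e +ᶻ r) /ℕ M ≡ ε →
        (+ ((+ e +ᶻ r) %ℕ M) +ᶻ r) /ℕ M +ᶻ (+ ((+ e +ᶻ r) %ℕ M) +ᶻ -ᶻ r) /ℕ M ≡ 0ℤ → (+ ((+ e +ᶻ r) %ℕ M) +ᶻ r) /ℕ M ≡ ε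
      same-ε e r ε e< q≡ opp = trans (lem₃ _ _ opp) (trans (cong -ᶻ_ (proj₂ (divmod-unique M _ e (-ᶻ ε) e< (trans (cong (_+ᶻ -ᶻ r) (f≡ e r ε q≡)) (lem₄ (+ e) r (+ M) ε))))) (ℤₚ.neg-involutive ε))
        where
        lem₃ : ∀ a b → a +ᶻ b ≡ 0ℤ → a ≡ -ᶻ b
        lem₃ a b eq = trans (lem₅ a b) (trans (cong (_-ᶻ b) eq) (ℤₚ.+-identityˡ (-ᶻ b)))
          where
          lem₅ : ∀ a b → a ≡ a +ᶻ b -ᶻ b
          lem₅ = solve-∀
        lem₄ : ∀ e r m ε → e +ᶻ r -ᶻ m *ᶻ ε +ᶻ -ᶻ r ≡ e +ᶻ -ᶻ ε *ᶻ m
        lem₄ = solve-∀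

    -- After M steps of length g the orbit would leave the block unless g = 0.
    no-shift : (r₁ , r₂) ≡ 𝟎
    no-shift = pos-≡ (coord d₁ e₁ r₁ (proj₁ ε₀) d₁< e₁< r₁< (cong proj₁ at)) (coord d₂ e₂ r₂ (proj₂ ε₀) d₂< e₂< r₂< (cong proj₂ at))
      where
      open Orbit (orbit M)
      lem₁ : ∀ e d m g → e ≡ d +ᶻ m *ᶻ g → g *ᶻ m ≡ e -ᶻ d
      lem₁ _ d m g refl = lem d m g
        where
        lem : ∀ d m g → g *ᶻ m ≡ d +ᶻ m *ᶻ g -ᶻ d
        lem = solve-∀
      lem₂ : ∀ r m ε → r +ᶻ -ᶻ (m *ᶻ ε) ≡ 0ℤ → ε *ᶻ m ≡ r
      lem₂ r m ε eq = trans (lem r m ε) (trans (cong (λ z → r -ᶻ z) eq) (ℤₚ.+-identityʳ r))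
        where
        lem : ∀ r m ε → ε *ᶻ m ≡ r -ᶻ (r +ᶻ -ᶻ (m *ᶻ ε))
        lem = solve-∀
      -- `g = 0` makes `r` a multiple of `M`, and `r` is smaller than `M` in absolute value.
      coord : ∀ d e r ε → d < M → e < M → ∣ r ∣ < M → + e ≡ + d +ᶻ + M *ᶻ (r +ᶻ -ᶻ (+ M *ᶻ ε)) → r ≡ 0ℤ
      coord d e r ε d< e< r< eq = trans (sym ε*M) (trans (cong (_*ᶻ + M) (small-multiple ε M r ε*M r<)) (ℤₚ.*-zeroˡ (+ M)))
        where
        ε*M : ε *ᶻ + M ≡ r
        ε*M = lem₂ r (+ M) ε (small-multiple (r +ᶻ -ᶻ (+ M *ᶻ ε)) M (+ e -ᶻ + d) (lem₁ (+ e) (+ d) (+ M) _ eq) (∣i-j∣<n e< d<))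

  -- `2 S + 1` whole blocks around a central one, and one more for the partial block at the corner
  -- of the window.
  N₀ : ℕ
  N₀ = (suc S + suc S) * M

  recognize : ∀ v v′ i₁ i₂ j₁ j₂ → i₁ < M → i₂ < M → j₁ < M → j₂ < M →
    (∀ x y → x < N₀ → y < N₀ → image c₀ ((+ i₁ +ᶻ proj₁ v *ᶻ + M , + i₂ +ᶻ proj₂ v *ᶻ + M) ⊕ (+ x , + y)) ≡
                               image c₀ ((+ j₁ +ᶻ proj₁ v′ *ᶻ + M , + j₂ +ᶻ proj₂ v′ *ᶻ + M) ⊕ (+ x , + y))) →
    i₁ ≡ j₁ × i₂ ≡ j₂
  recognize v@(v₁ , v₂) v′@(v₁′ , v₂′) i₁ i₂ j₁ j₂ i₁< i₂< j₁< j₂< same =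
      back (cong proj₁ zero-shift) , back (cong proj₂ zero-shift)
    where
    back : ∀ {i j} → + j -ᶻ + i ≡ 0ℤ → i ≡ j
    back e = ℤₚ.+-injective (sym (ℤₚ.i-j≡0⇒i≡j _ _ e))
    s : ℕ
    s = suc S
    mid : Pos
    mid = + s , + s
    -- Offset in the window of residue `e` in the block at displacement `w` from the middle; the
    -- term `M ∸ i` skips the partial block at the corner.
    col : ℤ → ℕ → ℕ → ℕ
    col w e i = ∣ w +ᶻ + S ∣ * M + e + (M ∸ i)
    col≡ : ∀ w e i → ∣ w ∣ ≤ S → i < M → + col w e i ≡ (+ s +ᶻ w) *ᶻ + M +ᶻ + e -ᶻ + i
    col≡ w e i w≤ i< = trans (cong₂ (λ a b → a +ᶻ + e +ᶻ b) (trans (ℤₚ.pos-* ∣ w +ᶻ + S ∣ M) (cong (_*ᶻ + M) (+∣i+n∣ w S w≤)))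
        (trans (sym (ℤₚ.⊖-≥ (<⇒≤ i<))) (sym (ℤₚ.m-n≡m⊖n M i)))) (lem w (+ S) (+ e) (+ i) (+ M))
      where
      lem : ∀ w s e i m → (w +ᶻ s) *ᶻ m +ᶻ e +ᶻ (m -ᶻ i) ≡ (1ℤ +ᶻ s +ᶻ w) *ᶻ m +ᶻ e -ᶻ i
      lem = solve-∀
    col< : ∀ w e i → ∣ w ∣ ≤ S → e < M → col w e i < N₀
    col< w e i w≤ e< = ≤-trans (+-mono-≤ (≤-trans (≤-reflexive (sym (+-suc (∣ w +ᶻ + S ∣ * M) e))) (+-mono-≤ (*-monoˡ-≤ M (abs-+ w (+ S) w≤ ≤-refl)) e<)) (ℕₚ.m∸n≤m M i)) (≤-reflexive (lem S M))
      where
      lem : ∀ s m → (s + s) * m + m + m ≡ (1 + s + (1 + s)) * m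
      lem = ℕ-Solver.solve-∀
    lemX : ∀ i v s w m e → i +ᶻ v *ᶻ m +ᶻ ((s +ᶻ w) *ᶻ m +ᶻ e -ᶻ i) ≡ e +ᶻ (v +ᶻ s +ᶻ w) *ᶻ m
    lemX = solve-∀
    lemY : ∀ j i v s w m e r q → e +ᶻ (j -ᶻ i) ≡ r +ᶻ q *ᶻ m → j +ᶻ v *ᶻ m +ᶻ ((s +ᶻ w) *ᶻ m +ᶻ e -ᶻ i) ≡ r +ᶻ (v +ᶻ s +ᶻ (w +ᶻ q)) *ᶻ m
    lemY j i v s w m e r q eq = trans (lem₁ j i v s w m e) (trans (cong (λ z → z +ᶻ (v +ᶻ s +ᶻ w) *ᶻ m) eq) (lem₂ v s w m r q))
      where
      lem₁ : ∀ j i v s w m e → j +ᶻ v *ᶻ m +ᶻ ((s +ᶻ w) *ᶻ m +ᶻ e -ᶻ i) ≡ e +ᶻ (j -ᶻ i) +ᶻ (v +ᶻ s +ᶻ w) *ᶻ m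
      lem₁ = solve-∀
      lem₂ : ∀ v s w m r q → r +ᶻ q *ᶻ m +ᶻ (v +ᶻ s +ᶻ w) *ᶻ m ≡ r +ᶻ (v +ᶻ s +ᶻ (w +ᶻ q)) *ᶻ m
      lem₂ = solve-∀
    rel : ∀ w e₁ e₂ → Near S w → e₁ < M → e₂ < M →
      letter (c₀ (v ⊕ mid ⊕ w)) e₁ e₂ ≡ letter (c₀ (v′ ⊕ mid ⊕ (w ⊕ ((+ e₁ +ᶻ (+ j₁ -ᶻ + i₁)) /ℕ M , (+ e₂ +ᶻ (+ j₂ -ᶻ + i₂)) /ℕ M)))) ((+ e₁ +ᶻ (+ j₁ -ᶻ + i₁)) %ℕ M) ((+ e₂ +ᶻ (+ j₂ -ᶻ + i₂)) %ℕ M)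
    rel (w₁ , w₂) e₁ e₂ (w₁≤ , w₂≤) e₁< e₂< =
      trans (sym (image-cell c₀ _ _ e₁ e₂ e₁< e₂<))
      (trans (cong (image c₀) (sym (pos-≡ (placeX i₁ v₁ w₁ e₁ w₁≤ i₁<) (placeX i₂ v₂ w₂ e₂ w₂≤ i₂<))))
      (trans (same (col w₁ e₁ i₁) (col w₂ e₂ i₂) (col< w₁ e₁ i₁ w₁≤ e₁<) (col< w₂ e₂ i₂ w₂≤ e₂<))
      (trans (cong (image c₀) (pos-≡ (placeY i₁ j₁ v₁′ w₁ e₁ w₁≤ i₁<) (placeY i₂ j₂ v₂′ w₂ e₂ w₂≤ i₂<)))
        (image-cell c₀ _ _ _ _ (n%ℕd<d (+ e₁ +ᶻ (+ j₁ -ᶻ + i₁)) M) (n%ℕd<d (+ e₂ +ᶻ (+ j₂ -ᶻ + i₂)) M)))))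
      where
      placeX : ∀ i v w e → ∣ w ∣ ≤ S → i < M → + i +ᶻ v *ᶻ + M +ᶻ + col w e i ≡ + e +ᶻ (v +ᶻ + s +ᶻ w) *ᶻ + M
      placeX i v w e w≤ i< = trans (cong (λ z → + i +ᶻ v *ᶻ + M +ᶻ z) (col≡ w e i w≤ i<)) (lemX (+ i) v (+ s) w (+ M) (+ e))
      placeY : ∀ i j v w e → ∣ w ∣ ≤ S → i < M → + j +ᶻ v *ᶻ + M +ᶻ + col w e i ≡
        + ((+ e +ᶻ (+ j -ᶻ + i)) %ℕ M) +ᶻ (v +ᶻ + s +ᶻ (w +ᶻ (+ e +ᶻ (+ j -ᶻ + i)) /ℕ M)) *ᶻ + M
      placeY i j v w e w≤ i< = trans (cong (λ z → + j +ᶻ v *ᶻ + M +ᶻ z) (col≡ w e i w≤ i<))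
        (lemY (+ j) (+ i) v (+ s) w (+ M) (+ e) (+ ((+ e +ᶻ (+ j -ᶻ + i)) %ℕ M)) ((+ e +ᶻ (+ j -ᶻ + i)) /ℕ M) (a≡a%ℕn+[a/ℕn]*n (+ e +ᶻ (+ j -ᶻ + i)) M))
    zero-shift : (+ j₁ -ᶻ + i₁ , + j₂ -ᶻ + i₂) ≡ 𝟎
    zero-shift = Shifted.no-shift (v ⊕ mid) (v′ ⊕ mid) (+ j₁ -ᶻ + i₁) (+ j₂ -ᶻ + i₂) (∣i-j∣<n j₁< i₁<) (∣i-j∣<n j₂< i₂<) rel

-- Counting patterns by residue class

sumTo : (ℕ → ℕ) → ℕ → ℕ
sumTo f zero    = 0
sumTo f (suc n) = sumTo f n + f n

sumTo-mono : ∀ {f g} → (∀ i → f i ≤ g i) → ∀ n → sumTo f n ≤ sumTo g n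
sumTo-mono le zero = z≤n
sumTo-mono le (suc n) = +-mono-≤ (sumTo-mono le n) (le n)

sumTo-*ˡ : ∀ c f n → sumTo (λ i → c * f i) n ≡ c * sumTo f n
sumTo-*ˡ c f zero = sym (ℕₚ.*-zeroʳ c)
sumTo-*ˡ c f (suc n) = trans (cong (_+ c * f n) (sumTo-*ˡ c f n)) (sym (ℕₚ.*-distribˡ-+ c (sumTo f n) (f n)))

sumTo-cong : ∀ {f g} → (∀ i → f i ≡ g i) → ∀ n → sumTo f n ≡ sumTo g n
sumTo-cong eq zero = refl
sumTo-cong eq (suc n) = cong₂ _+_ (sumTo-cong eq n) (eq n)

sumTo-+ : ∀ f g n → sumTo (λ i → f i + g i) n ≡ sumTo f n + sumTo g n
sumTo-+ f g zero = refl
sumTo-+ f g (suc n) = trans (cong (_+ (f n + g n)) (sumTo-+ f g n)) (lem (sumTo f n) (sumTo g n) (f n) (g n))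
  where
  lem : ∀ a b c d → a + b + (c + d) ≡ a + c + (b + d)
  lem = ℕ-Solver.solve-∀

sumTo-shift : ∀ f n → sumTo (λ i → f (suc i)) n + f 0 ≡ sumTo f n + f n
sumTo-shift f zero = refl
sumTo-shift f (suc n) = trans (lem (sumTo (λ i → f (suc i)) n) (f (suc n)) (f 0)) (cong (_+ f (suc n)) (sumTo-shift f n))
  where
  lem : ∀ a b c → a + b + c ≡ a + c + b
  lem = ℕ-Solver.solve-∀

catTo : {U : Set} → (ℕ → List U) → ℕ → List U
catTo L zero    = []
catTo L (suc n) = catTo L n ++ L n

∈catTo : {U : Set} (L : ℕ → List U) (n : ℕ) {u : U} → u ∈ catTo L n → ∃[ i ] (i < n × u ∈ L i)
∈catTo L (suc n) u∈ with ∈-++⁻ (catTo L n) u∈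
... | inj₁ p = let i , i< , q = ∈catTo L n p in i , m≤n⇒m≤1+n i< , q
... | inj₂ p = n , ≤-refl , p

length-catTo : {U : Set} (L : ℕ → List U) (n : ℕ) → length (catTo L n) ≡ sumTo (λ i → length (L i)) n
length-catTo L zero = refl
length-catTo L (suc n) = trans (length-++ (catTo L n)) (cong (_+ length (L n)) (length-catTo L n))

allPairs-catTo : {U : Set} {R : U → U → Set} (L : ℕ → List U) (n : ℕ) → (∀ i → i < n → AllPairs R (L i)) →
  (∀ i j → i < j → j < n → ∀ {u v} → u ∈ L i → v ∈ L j → R u v) → AllPairs R (catTo L n)
allPairs-catTo L zero _ _ = []
allPairs-catTo L (suc n) ap cross = APₚ.++⁺ (allPairs-catTo L n (λ i i< → ap i (m≤n⇒m≤1+n i<)) (λ i j i<j j< → cross i j i<j (m≤n⇒m≤1+n j<)))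
  (ap n ≤-refl) (All.tabulate (λ u∈ → All.tabulate (λ v∈ → let i , i< , q = ∈catTo L n u∈ in cross i n i< ≤-refl q v∈)))

-- The number of cells v ≥ 0 with v M + d < z.
module Cells (M : ℕ) {{_ : NonZero M}} (d : ℕ) (d< : d < M) where

  cells : ℕ → ℕ
  cells z = (z + (M ∸ suc d)) / M

  private
    M≡ : suc d + (M ∸ suc d) ≡ M
    M≡ = m+[n∸m]≡n d<

    suc-* : ∀ v → suc v * M ≡ suc (v * M + d) + (M ∸ suc d)
    suc-* v = trans (cong (_+ v * M) (sym M≡)) (lem d (M ∸ suc d) (v * M))
      where
      lem : ∀ d t w → 1 + d + t + w ≡ 1 + (w + d) + t
      lem = ℕ-Solver.solve-∀

  cells⇒< : ∀ {v z} → v < cells z → v * M + d < z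
  cells⇒< {v} {z} lt = ℕₚ.+-cancelʳ-≤ (M ∸ suc d) (suc (v * M + d)) z
    (≤-trans (≤-reflexive (sym (suc-* v))) (≤-trans (*-monoˡ-≤ M lt) (m/n*n≤m (z + (M ∸ suc d)) M)))

  <⇒cells : ∀ {v z} → v * M + d < z → v < cells z
  <⇒cells {v} {z} lt = ≤-trans (≤-reflexive (sym (m*n/n≡m (suc v) M)))
    (/-monoˡ-≤ M (≤-trans (≤-reflexive (suc-* v)) (+-monoˡ-≤ (M ∸ suc d) lt)))

  cells-+ : ∀ z q → cells (z + q * M) ≡ cells z + q
  cells-+ z q = trans (cong (_/ M) (lem z (q * M) (M ∸ suc d))) ([m+kn]/n (z + (M ∸ suc d)) q M)
    where
    lem : ∀ z w t → z + w + t ≡ z + t + w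
    lem = ℕ-Solver.solve-∀

  cells-mono : ∀ {y z} → y ≤ z → cells y ≤ cells z
  cells-mono le = /-monoˡ-≤ M (+-monoˡ-≤ (M ∸ suc d) le)

  -- Blocks whose determining position falls into a window of length `a` that starts at residue `ρ`.
  count : ℕ → ℕ → ℕ
  count a ρ = cells (ρ + a) ∸ cells ρ

  count+ : ∀ a ρ → cells ρ + count a ρ ≡ cells (ρ + a)
  count+ a ρ = m+[n∸m]≡n (cells-mono (m≤m+n ρ a))

  q≤count : ∀ a ρ q → q * M ≤ a → q ≤ count a ρ
  q≤count a ρ q le = ℕₚ.+-cancelˡ-≤ (cells ρ) q (count a ρ)
    (≤-trans (≤-reflexive (sym (cells-+ ρ q))) (≤-trans (cells-mono (+-monoʳ-≤ ρ le)) (≤-reflexive (sym (count+ a ρ)))))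

  count≤q : ∀ a ρ q → a ≤ q * M → count a ρ ≤ q
  count≤q a ρ q le = ℕₚ.+-cancelˡ-≤ (cells ρ) (count a ρ) q
    (≤-trans (≤-reflexive (count+ a ρ)) (≤-trans (cells-mono (+-monoʳ-≤ ρ le)) (≤-reflexive (cells-+ ρ q))))

  -- Lengthening by one shifts the range of summation: `cells a` leaves, and
  -- `cells (M + a) = cells a + 1` enters.
  sum-cells : ∀ a → sumTo (λ ρ → cells (ρ + a)) M ≡ a + sumTo cells M
  sum-cells zero = sumTo-cong (λ ρ → cong cells (+-identityʳ ρ)) M
  sum-cells (suc a) = ℕₚ.+-cancelʳ-≡ (cells a) _ _ (trans (cong (_+ cells a) (sumTo-cong (λ ρ → cong cells (+-suc ρ a)) M))
    (trans (sumTo-shift (λ ρ → cells (ρ + a)) M) (trans (cong₂ _+_ (sum-cells a) (trans (cong cells (trans (+-comm M a) (cong (λ z → a + z) (sym (+-identityʳ M))))) (cells-+ a 1)))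
      (lem a (sumTo cells M) (cells a)))))
    where
    lem : ∀ a s c → a + s + (c + 1) ≡ 1 + a + s + c
    lem = ℕ-Solver.solve-∀

  sum-count : ∀ a → sumTo (count a) M ≡ a
  sum-count a = ℕₚ.+-cancelˡ-≡ (sumTo cells M) _ _ (trans (sym (sumTo-+ cells (count a) M))
    (trans (sumTo-cong (count+ a) M) (trans (sum-cells a) (+-comm a (sumTo cells M)))))

-- Propagation of the lower bound to all sizes

module _ {U : Set} {_≈_ : U → U → Set} (E : IsEq _≈_) where
  open IsEq E

  transversal : ∀ us → ∃[ rs ] (AllPairs (λ u v → ¬ u ≈ v) rs × (∀ {u} → u ∈ us → Any (_≈ u) rs))
  transversal [] = [] , [] , λ ()
  transversal (u ∷ us) with transversal us
  ... | rs , ap , cov with Any.any? (_≈? u) rs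
  ...   | yes old = rs , ap , λ { (here refl) → old ; (there v∈) → cov v∈ }
  ...   | no new = u ∷ rs , All.tabulate (λ r∈ u≈r → new (lose r∈ (≈-sym u≈r))) ∷ ap , λ { (here refl) → here ≈-refl ; (there v∈) → there (cov v∈) }

module Complexity {k M : ℕ} {{M≢0 : NonZero M}} (σ : Substitution k M)
  (c₀ : Config k) (bx₀ : Substitutive.BoxIn σ c₀) (pr : ℕ) (prim : ∀ a b → LetterIn σ a pr b) (np : NonPeriodic c₀)
  (d₁ d₂ : ℕ) (d₁< : d₁ < M) (d₂< : d₂ < M)
  (det₀ : ∀ a b → Substitutive.letter σ a d₁ d₂ ≡ Substitutive.letter σ b d₁ d₂ → a ≡ b) where
  open Substitutive σ
  open Recurrent c₀ bx₀ pr prim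
  open Recognizable σ c₀ bx₀ pr prim np d₁ d₂ d₁< d₂< det₀ using (image; image-cell; boxIn-image; N₀; recognize)

  private
    module X = Cells M d₁ d₁<
    module Y = Cells M d₂ d₂<

  Same : Config k → ℕ → ℕ → Pos → Pos → Set
  Same c a b = Lang.Agree c (rect a b)

  -- By `recurs` all patterns occur in an explicit finite box, so a transversal of that box lists
  -- them. The strict inequality becomes decidable, and the double negation of
  -- `rectangle-complexity` can be removed.
  over! : ∀ a b → Lang.Over c₀ (rect a b)
  over! a b = decide (length (rect a b) <? length rs)
    where
    N : ℕ
    N = a + b
    candidates rs : List Pos
    candidates = rect (suc (radius N)) (suc (radius N))
    E : IsEq (Same c₀ a b)
    E = Lang.Agree-isEq c₀ (rect a b)
    rs = proj₁ (transversal E candidates)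
    covers : ∀ u → Any (λ r → Same c₀ a b r u) rs
    covers u =
      let ox , oy , ox≤ , oy≤ , vals = recurs c₀ c₀ bx₀ bx₀ N u 𝟎
      in Any.map (λ r≈ → IsEq.≈-trans E r≈ (Lang.agree (λ p∈ → moved ox oy vals (rect⇒ {a} {b} p∈))))
           (proj₂ (proj₂ (transversal E candidates)) (⇒rect (s≤s ox≤) (s≤s oy≤)))
      where
      moved : ∀ ox oy → (∀ x y → x < N → y < N → c₀ (u ⊕ (+ x , + y)) ≡ c₀ (𝟎 ⊕ (+ ox , + oy) ⊕ (+ x , + y))) →
        ∀ {p} → ∃[ i ] ∃[ j ] (i < a × j < b × p ≡ (+ i , + j)) → c₀ ((+ ox , + oy) ⊕ p) ≡ c₀ (u ⊕ p)
      moved ox oy vals (i , j , i< , j< , refl) = sym (vals i j (≤-trans i< (m≤m+n a b)) (≤-trans j< (m≤n+m b a)))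
    decide : Dec (length (rect a b) < length rs) → Lang.Over c₀ (rect a b)
    decide (yes lt) = rs , proj₁ (proj₂ (transversal E candidates)) , lt
    decide (no nlt) = ⊥-elim (rectangle-complexity c₀ uniformly-recurrent np a b (λ { (us , ap , lt) →
      covered-by-few E rs us (All.universal covers us) (≤-<-trans (≮⇒≥ nlt) lt) ap }))

  Q P : ℕ
  Q = N₀ * N₀
  P = suc Q

  record Good (a b : ℕ) : Set where
    field
      positions : List Pos
      distinct  : AllPairs (λ u v → ¬ Same c₀ a b u v) positions
      many      : P * (a * b) ≤ Q * length positions
  open Good

  -- Integrality: `(Q + 1) a b ≤ Q (a b + 1)` as soon as `a b ≤ Q`.
  good-small : ∀ a b → a ≤ N₀ → b ≤ N₀ → Good a b
  good-small a b a≤ b≤ = let us , ap , lt = over! a b in record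
    { positions = us ; distinct = ap
    ; many = ≤-trans (+-monoˡ-≤ (Q * (a * b)) (*-mono-≤ a≤ b≤))
        (≤-trans (≤-reflexive (sym (ℕₚ.*-suc Q (a * b)))) (*-monoʳ-≤ Q (≤-trans (s≤s (≤-reflexive (sym (length-rect a b)))) lt))) }

  good-large : ∀ a b → N₀ ≤ a → N₀ ≤ b → (∀ ρ₁ ρ₂ → Good (X.count a ρ₁) (Y.count b ρ₂)) → Good a b
  good-large a b N₀≤a N₀≤b goods = record
    { positions = map τ total
    ; distinct = APₚ.map⁺ (AllPairs.map (λ {u} {v} n ag → n (Lang.agree (λ p∈ → pull u v ag (rect⇒ {a} {b} p∈)))) total-distinct)
    ; many = ≤-trans (≤-reflexive expand) (≤-trans (sumTo-mono (λ ρ₁ → sumTo-mono (λ ρ₂ → many (goods ρ₁ ρ₂)) M) M) (≤-reflexive collect)) }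
    where
    C : Config k
    C = image c₀
    -- Subtracting `cells ρ` makes `u` the first block whose determining position is seen from
    -- residue `ρ`.
    base : ℕ → ℕ → Pos → Pos
    base ρ₁ ρ₂ (u₁ , u₂) = u₁ -ᶻ + X.cells ρ₁ , u₂ -ᶻ + Y.cells ρ₂
    place : ℕ → ℕ → Pos → Pos
    place ρ₁ ρ₂ u = + ρ₁ +ᶻ proj₁ (base ρ₁ ρ₂ u) *ᶻ + M , + ρ₂ +ᶻ proj₂ (base ρ₁ ρ₂ u) *ᶻ + M
    L : ℕ → ℕ → List Pos
    L ρ₁ ρ₂ = map (place ρ₁ ρ₂) (positions (goods ρ₁ ρ₂))
    line : ℕ → List Pos
    line ρ₁ = catTo (L ρ₁) M
    total : List Pos
    total = catTo line M

    column : ∀ d (cells : ℕ → ℕ) ρ a s → (∀ {v z} → v < cells z → v * M + d < z) → (∀ {v z} → v * M + d < z → v < cells z) →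
      cells ρ + s < cells (ρ + a) → ∃[ x ] (x < a × (∀ u → + ρ +ᶻ (u -ᶻ + cells ρ) *ᶻ + M +ᶻ + x ≡ + d +ᶻ (u +ᶻ + s) *ᶻ + M))
    column d cells ρ a s below above lt = x , x<a , λ u → eq u
      where
      z x : ℕ
      z = (cells ρ + s) * M + d
      x = z ∸ ρ
      ρ≤z : ρ ≤ z
      ρ≤z = ≮⇒≥ (λ z<ρ → <⇒≱ (above z<ρ) (m≤m+n (cells ρ) s))
      x<a : x < a
      x<a = ℕₚ.+-cancelˡ-< ρ x a (≤-trans (s≤s (≤-reflexive (m+[n∸m]≡n ρ≤z))) (below lt))
      lem : ∀ ρ u n s m d x → ρ +ᶻ x ≡ (n +ᶻ s) *ᶻ m +ᶻ d → ρ +ᶻ (u -ᶻ n) *ᶻ m +ᶻ x ≡ d +ᶻ (u +ᶻ s) *ᶻ m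
      lem ρ u n s m d x e = trans (lem₁ ρ u n m x) (trans (cong (λ w → w +ᶻ (u -ᶻ n) *ᶻ m) e) (lem₂ u n s m d))
        where
        lem₁ : ∀ ρ u n m x → ρ +ᶻ (u -ᶻ n) *ᶻ m +ᶻ x ≡ ρ +ᶻ x +ᶻ (u -ᶻ n) *ᶻ m
        lem₁ = solve-∀
        lem₂ : ∀ u n s m d → (n +ᶻ s) *ᶻ m +ᶻ d +ᶻ (u -ᶻ n) *ᶻ m ≡ d +ᶻ (u +ᶻ s) *ᶻ m
        lem₂ = solve-∀
      eq : ∀ u → + ρ +ᶻ (u -ᶻ + cells ρ) *ᶻ + M +ᶻ + x ≡ + d +ᶻ (u +ᶻ + s) *ᶻ + M
      eq u = lem (+ ρ) u (+ cells ρ) (+ s) (+ M) (+ d) (+ x) (trans (cong +_ (m+[n∸m]≡n ρ≤z)) (cong (_+ᶻ + d) (ℤₚ.pos-* (cells ρ + s) M)))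

    desubstitute : ∀ ρ₁ ρ₂ u v → Same C a b (place ρ₁ ρ₂ u) (place ρ₁ ρ₂ v) → Same c₀ (X.count a ρ₁) (Y.count b ρ₂) u v
    desubstitute ρ₁ ρ₂ u v ag = Lang.agree (λ p∈ → cell (rect⇒ {X.count a ρ₁} {Y.count b ρ₂} p∈))
      where
      cell : ∀ {p} → ∃[ s ] ∃[ t ] (s < X.count a ρ₁ × t < Y.count b ρ₂ × p ≡ (+ s , + t)) → c₀ (u ⊕ p) ≡ c₀ (v ⊕ p)
      cell (s , t , s< , t< , refl) =
        let x , x< , ex = column d₁ X.cells ρ₁ a s X.cells⇒< X.<⇒cells (≤-trans (≤-reflexive (sym (+-suc (X.cells ρ₁) s))) (≤-trans (+-monoʳ-≤ (X.cells ρ₁) s<) (≤-reflexive (X.count+ a ρ₁))))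
            y , y< , ey = column d₂ Y.cells ρ₂ b t Y.cells⇒< Y.<⇒cells (≤-trans (≤-reflexive (sym (+-suc (Y.cells ρ₂) t))) (≤-trans (+-monoʳ-≤ (Y.cells ρ₂) t<) (≤-reflexive (Y.count+ b ρ₂))))
            read = λ w → trans (cong C (pos-≡ (ex (proj₁ w)) (ey (proj₂ w)))) (image-cell c₀ (proj₁ w +ᶻ + s) (proj₂ w +ᶻ + t) d₁ d₂ d₁< d₂<)
        in det₀ _ _ (trans (sym (read u)) (trans (Lang.at ag (⇒rect x< y<)) (read v)))

    residues : ∀ ρ₁ ρ₂ ρ₁′ ρ₂′ u v → ρ₁ < M → ρ₂ < M → ρ₁′ < M → ρ₂′ < M →
      Same C a b (place ρ₁ ρ₂ u) (place ρ₁′ ρ₂′ v) → ρ₁ ≡ ρ₁′ × ρ₂ ≡ ρ₂′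
    residues ρ₁ ρ₂ ρ₁′ ρ₂′ u v l₁ l₂ l₁′ l₂′ ag = recognize (base ρ₁ ρ₂ u) (base ρ₁′ ρ₂′ v) ρ₁ ρ₂ ρ₁′ ρ₂′ l₁ l₂ l₁′ l₂′
      (λ x y x< y< → Lang.at ag (⇒rect (≤-trans x< N₀≤a) (≤-trans y< N₀≤b)))

    line-distinct : ∀ ρ₁ → ρ₁ < M → AllPairs (λ u v → ¬ Same C a b u v) (line ρ₁)
    line-distinct ρ₁ ρ₁< = allPairs-catTo (L ρ₁) M
      (λ ρ₂ _ → APₚ.map⁺ (AllPairs.map (λ {u} {v} n ag → n (desubstitute ρ₁ ρ₂ u v ag)) (distinct (goods ρ₁ ρ₂))))
      (λ i j i<j j< u∈ v∈ ag → case ∈-map⁻ (place ρ₁ i) u∈ of λ { (u , _ , refl) → case ∈-map⁻ (place ρ₁ j) v∈ of λ { (v , _ , refl) →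
        <-irrefl (proj₂ (residues ρ₁ i ρ₁ j u v ρ₁< (≤-trans i<j (<⇒≤ j<)) ρ₁< j< ag)) i<j } })

    total-distinct : AllPairs (λ u v → ¬ Same C a b u v) total
    total-distinct = allPairs-catTo line M line-distinct
      (λ i j i<j j< u∈ v∈ ag →
        let ρ , ρ< , u∈′ = ∈catTo (L i) M u∈
            ρ′ , ρ′< , v∈′ = ∈catTo (L j) M v∈
        in cross i j i<j j< ρ ρ′ ρ< ρ′< u∈′ v∈′ ag)
      where
      cross : ∀ i j → i < j → j < M → ∀ ρ ρ′ → ρ < M → ρ′ < M → ∀ {u v} → u ∈ L i ρ → v ∈ L j ρ′ → ¬ Same C a b u v
      cross i j i<j j< ρ ρ′ ρ< ρ′< u∈ v∈ ag with ∈-map⁻ (place i ρ) u∈ | ∈-map⁻ (place j ρ′) v∈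
      ... | u , _ , refl | v , _ , refl = <-irrefl (proj₁ (residues i ρ j ρ′ u v (≤-trans i<j (<⇒≤ j<)) ρ< j< ρ′< ag)) i<j

    -- The positions collected so far belong to `image c₀`. Its patterns recur in `c₀`, and distinct
    -- patterns remain distinct at their copies.
    copy : ∀ w → ∃[ ox ] ∃[ oy ] (ox ≤ radius (a + b) × oy ≤ radius (a + b) ×
      (∀ x y → x < a + b → y < a + b → C (w ⊕ (+ x , + y)) ≡ c₀ (𝟎 ⊕ (+ ox , + oy) ⊕ (+ x , + y))))
    copy w = recurs c₀ C bx₀ (boxIn-image c₀ bx₀) (a + b) w 𝟎
    τ : Pos → Pos
    τ w = 𝟎 ⊕ (+ proj₁ (copy w) , + proj₁ (proj₂ (copy w)))
    pull : ∀ u v → Same c₀ a b (τ u) (τ v) → ∀ {p} → ∃[ i ] ∃[ j ] (i < a × j < b × p ≡ (+ i , + j)) → C (u ⊕ p) ≡ C (v ⊕ p)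
    pull u v ag (i , j , i< , j< , refl) =
      trans (proj₂ (proj₂ (proj₂ (proj₂ (copy u)))) i j i<′ j<′) (trans (Lang.at ag (⇒rect i< j<)) (sym (proj₂ (proj₂ (proj₂ (proj₂ (copy v)))) i j i<′ j<′)))
      where
      i<′ : i < a + b
      i<′ = ≤-trans i< (m≤m+n a b)
      j<′ : j < a + b
      j<′ = ≤-trans j< (m≤n+m b a)

    expand : P * (a * b) ≡ sumTo (λ ρ₁ → sumTo (λ ρ₂ → P * (X.count a ρ₁ * Y.count b ρ₂)) M) M
    expand = sym (trans (sumTo-cong (λ ρ₁ → trans (sumTo-*ˡ P (λ ρ₂ → X.count a ρ₁ * Y.count b ρ₂) M) (cong (P *_) (trans (sumTo-*ˡ (X.count a ρ₁) (Y.count b) M) (trans (cong (X.count a ρ₁ *_) (Y.sum-count b)) (*-comm (X.count a ρ₁) b))))) M)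
      (trans (sumTo-*ˡ P (λ ρ₁ → b * X.count a ρ₁) M) (cong (P *_) (trans (sumTo-*ˡ b (X.count a) M) (trans (cong (b *_) (X.sum-count a)) (*-comm b a))))))

    collect : sumTo (λ ρ₁ → sumTo (λ ρ₂ → Q * length (positions (goods ρ₁ ρ₂))) M) M ≡ Q * length (map τ total)
    collect = trans (sumTo-cong (λ ρ₁ → trans (sumTo-*ˡ Q (λ ρ₂ → length (positions (goods ρ₁ ρ₂))) M) (cong (Q *_) (trans (sumTo-cong (λ ρ₂ → sym (length-map (place ρ₁ ρ₂) (positions (goods ρ₁ ρ₂)))) M) (sym (length-catTo (L ρ₁) M))))) M)
      (trans (sumTo-*ˡ Q (λ ρ₁ → length (line ρ₁)) M) (cong (Q *_) (trans (sym (length-catTo line M)) (sym (length-map τ total)))))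

  M≤N₀ : M ≤ N₀
  M≤N₀ = m≤m+n M _

  -- Near-squares are stable: if both sides lie between `n` and `n + 1`, all counts lie between `q`
  -- and `q + 1` for `q = n / M`. So both sides reach the threshold `N₀` together, and no rectangle
  -- with one short and one long side ever arises.
  good : ∀ fuel n → n ≤ fuel → 1 ≤ n → ∀ a b → n ≤ a → a ≤ suc n → n ≤ b → b ≤ suc n → Good a b
  good zero n n≤ 1≤n = ⊥-elim (<⇒≱ 1≤n n≤)
  good (suc fuel) n n≤ 1≤n a b n≤a a≤ n≤b b≤ with suc n ≤? N₀
  ... | yes small = good-small a b (≤-trans a≤ small) (≤-trans b≤ small)
  ... | no large = good-large a b (≤-trans N₀≤n n≤a) (≤-trans N₀≤n n≤b) λ ρ₁ ρ₂ →
          good fuel q (ℕ.s≤s⁻¹ (≤-trans q<n n≤)) 1≤q (X.count a ρ₁) (Y.count b ρ₂)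
            (X.q≤count a ρ₁ q (≤-trans qM≤n n≤a)) (X.count≤q a ρ₁ (suc q) (≤-trans a≤ sn≤))
            (Y.q≤count b ρ₂ q (≤-trans qM≤n n≤b)) (Y.count≤q b ρ₂ (suc q) (≤-trans b≤ sn≤))
    where
    q : ℕ
    q = n / M
    N₀≤n : N₀ ≤ n
    N₀≤n = ℕ.s≤s⁻¹ (≰⇒> large)
    qM≤n : q * M ≤ n
    qM≤n = m/n*n≤m n M
    sn≤ : suc n ≤ suc q * M
    sn≤ = ≤-trans (≤-reflexive (cong suc (m≡m%n+[m/n]*n n M))) (+-monoˡ-≤ (q * M) (m%n<n n M))
    1≤q : 1 ≤ q
    1≤q = m≥n⇒m/n>0 (≤-trans M≤N₀ N₀≤n)
    q<n : q < n
    q<n = m/n<m n M {{ℕ.>-nonZero 1≤n}} 2≤M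

  squares : ∀ c → BoxIn c → ∀ n → ∃[ m ] (LangAtLeast c n m × P * (n * n) ≤ Q * m)
  squares c bx zero = 0 , ([] , [] , [] , z≤n) , ≤-reflexive (trans (ℕₚ.*-zeroʳ P) (sym (ℕₚ.*-zeroʳ Q)))
  squares c bx n@(suc _) = length (positions G) , (map sq′ (positions G) , APₚ.map⁺ (AllPairs.map differ (distinct G)) , Allₚ.map⁺ (All.universal appears (positions G)) , ≤-reflexive (sym (length-map sq′ (positions G)))) , many G
    where
    G : Good n n
    G = good n n ≤-refl (s≤s z≤n) n n ≤-refl (n≤1+n n) ≤-refl (n≤1+n n)
    sq′ : Pos → Square k n
    sq′ u i j = c₀ (u ⊕ (+ toℕ i , + toℕ j))
    differ : ∀ {u v} → ¬ Same c₀ n n u v → DistinctSquares (sq′ u) (sq′ v)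
    differ {u} {v} ne eq = ne (Lang.agree (λ p∈ → cell (rect⇒ {n} {n} p∈)))
      where
      cell : ∀ {p} → ∃[ i ] ∃[ j ] (i < n × j < n × p ≡ (+ i , + j)) → c₀ (u ⊕ p) ≡ c₀ (v ⊕ p)
      cell (i , j , i< , j< , refl) = subst₂ (λ x y → c₀ (u ⊕ (+ x , + y)) ≡ c₀ (v ⊕ (+ x , + y))) (Finₚ.toℕ-fromℕ< i<) (Finₚ.toℕ-fromℕ< j<) (eq (fromℕ< i<) (fromℕ< j<))
    appears : ∀ u → SquareAppears (sq′ u) c
    appears u =
      let ox , oy , _ , _ , vals = recurs c c₀ bx bx₀ n u 𝟎
          w = 𝟎 ⊕ (+ ox , + oy)
      in ⊖ w , λ i j → trans (vals (toℕ i) (toℕ j) (Finₚ.toℕ<n i) (Finₚ.toℕ<n j)) (cong c (pos-≡ (lem (proj₁ w) (+ toℕ i)) (lem (proj₂ w) (+ toℕ j))))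
      where
      lem : ∀ w x → w +ᶻ x ≡ x -ᶻ (-ᶻ w)
      lem = solve-∀

aperiodic⇒nonPeriodic : ∀ {k} (c : Config k) → ¬ Periodic c → NonPeriodic c
aperiodic⇒nonPeriodic c ¬per t t≢0 per = ¬per (t , t≢0 , λ v → trans (cong c (sym (back v))) (per (v -ᵥ t)))
  where
  lem : ∀ v t → v -ᶻ t +ᶻ t ≡ v
  lem = solve-∀
  back : ∀ v → (v -ᵥ t) ⊕ t ≡ v
  back (v₁ , v₂) = pos-≡ (lem v₁ (proj₁ t)) (lem v₂ (proj₂ t))

theorem12 : ∀ (k M : ℕ) .{{_ : NonZero M}} (σ : Substitution k M) →
    Primitive σ → HasDeterminingPosition σ → Aperiodic σ →
    -- K = p / (suc q) > 1
    ∃[ p ] ∃[ q ] (suc q < p ×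
    (∀ (c : Config k) → InX σ c → ∀ (n : ℕ) →
    ∃[ m ] (LangAtLeast c n m × p * (n * n) ≤ suc q * m)))
theorem12 k zero σ _ (() , _) _
theorem12 k M@(suc _) σ (pr , prim) (i , j , det) ((c₀ , inX₀) , ¬per) =
  P , ℕ.pred Q , ≤-reflexive (cong suc suc-pred-Q) ,
  λ c inX n → subst (λ q → ∃[ m ] (LangAtLeast c n m × P * (n * n) ≤ q * m)) (sym suc-pred-Q) (squares c (inX⇒boxIn c inX) n)
  where
  open Substitutive σ
  index : ∀ (i : Fin M) → fromℕ< (m%n<n (toℕ i) M) ≡ i
  index i = Finₚ.toℕ-injective (trans (Finₚ.toℕ-fromℕ< _) (m<n⇒m%n≡m (Finₚ.toℕ<n i)))
  det′ : ∀ a b → letter a (toℕ i) (toℕ j) ≡ letter b (toℕ i) (toℕ j) → a ≡ b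
  det′ a b e = det a b (subst₂ (λ x y → σ a x y ≡ σ b x y) (index i) (index j) e)
  open Complexity σ c₀ (inX⇒boxIn c₀ inX₀) pr prim (aperiodic⇒nonPeriodic c₀ (¬per c₀ inX₀)) (toℕ i) (toℕ j) (Finₚ.toℕ<n i) (Finₚ.toℕ<n j) det′
  suc-pred-Q : suc (ℕ.pred Q) ≡ Q
  suc-pred-Q = ℕₚ.suc-pred Q {{ℕ.>-nonZero (*-mono-≤ (≤-trans (s≤s z≤n) M≤N₀) (≤-trans (s≤s z≤n) M≤N₀))}}
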